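{- For every toroidal map $G$, there is a bijection between the Schnyder woods of $G$ and the Schnyder woods of its dual $G^*$.
   Context: A toroidal map is a graph embedded on the torus with no contractible loop, no two edges with the same endpoints whose union is a contractible cycle, and all faces homeomorphic to open disks; $G^*$ is its (toroidal) dual map. A Schnyder wood of a map $H$ embedded on the torus is an orientation and coloring of its edges with colors $0,1,2$ (indices modulo 3), each edge oriented in one direction or in two opposite directions (with distinct colors), such that (T1) every vertex $v$ has out-degree exactly one in each color, the edges $e_0(v),e_1(v),e_2(v)$ leaving $v$ in colors $0,1,2$ occur in counterclockwise order, and each edge entering $v$ in color $i$ enters in the counterclockwise sector from $e_{i+1}(v)$ to $e_{i-1}(v)$; (T2) every monochromatic cycle of color $i$ (directed cycle of edges colored $i$, oriented by color $i$) intersects at least one monochromatic cycle of color $i-1$ and at least one of color $i+1$. -}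

module Defs where

open import Data.Nat using (ℕ; zero; suc; _<_; _*_; _+_)
open import Data.Fin using (Fin; zero; suc; inject₁; fromℕ; _≟_)
open import Data.Integer using (ℤ; 0ℤ; 1ℤ) renaming (_+_ to _+ℤ_; _-_ to _-ℤ_)
open import Data.Maybe using (Maybe; just; nothing)
open import Data.Vec using (Vec; lookup)
open import Data.Product using (Σ; ∃; ∃₂; _×_; _,_)
open import Data.Sum using (_⊎_)
open import Relation.Nullary using (¬_; does)
open import Relation.Binary.PropositionalEquality using (_≡_; _≢_; refl; sym; trans; cong)
open import Relation.Binary.Construct.Closure.ReflexiveTransitive using (Star)
open import Data.Bool using (if_then_else_)
open import Function using (_∘_)

iter : ∀ {A : Set} → (A → A) → ℕ → A → A
iter f zero    x = x
iter f (suc k) x = f (iter f k x)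

next3 : Fin 3 → Fin 3
next3 zero = suc zero
next3 (suc zero) = suc (suc zero)
next3 (suc (suc zero)) = zero

prev3 : Fin 3 → Fin 3
prev3 zero = suc (suc zero)
prev3 (suc zero) = zero
prev3 (suc (suc zero)) = suc zero

-- Combinatorial maps (oriented 2-cell embeddings).
-- Darts = half-edges, Fin D.  Dart d is the end of its edge at its
-- tail vertex, pointing along the edge.
--   α : the other dart of the same edge (fixed-point-free involution)
--   σ : the next dart counterclockwise around the tail vertex
--   σ⁻ : inverse of σ
-- Vertices are the σ-orbits, edges the α-orbits, faces the orbits of σ ∘ α.

record Map : Set where
  field
    D       : ℕ
    α σ σ⁻  : Fin D → Fin D
    α-invol : ∀ d → α (α d) ≡ d
    α-fpf   : ∀ d → α d ≢ d
    σσ⁻     : ∀ d → σ (σ⁻ d) ≡ d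
    σ⁻σ     : ∀ d → σ⁻ (σ d) ≡ d

  φ : Fin D → Fin D
  φ = σ ∘ α

  SameVertex : Fin D → Fin D → Set
  SameVertex d d' = ∃ λ k → iter σ k d ≡ d'

  -- d lies in the (closed) counterclockwise sector around a common vertex
  -- going from dart a to dart b
  InSector : Fin D → Fin D → Fin D → Set
  InSector a b d = ∃ λ k → iter σ k a ≡ d × (∀ j → j < k → iter σ j a ≢ b)

-- The dual map: same darts and edges; the dual dart of d crosses d from
-- the face on its right to the face on its left.  The counterclockwise
-- rotation around a face (= dual vertex) is then α ∘ σ⁻.

dual : Map → Map
dual M = record
  { D = D
  ; α = α
  ; σ = α ∘ σ⁻
  ; σ⁻ = σ ∘ α
  ; α-invol = α-invol
  ; α-fpf = α-fpf
  ; σσ⁻ = λ d → trans (cong α (σ⁻σ (α d))) (α-invol d)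
  ; σ⁻σ = λ d → trans (cong σ (α-invol (σ⁻ d))) (σσ⁻ d)
  }
  where open Map M

module _ (M : Map) where
  open Map M

  Step : Fin D → Fin D → Set
  Step d d' = σ d ≡ d' ⊎ α d ≡ d'

  δ : Fin D → Fin D → ℤ
  δ d d' = if does (d' ≟ d) then 1ℤ else 0ℤ

record ToroidalMap : Set where
  field
    map : Map
  open Map map public
  field
    nV         : ℕ
    vert       : Fin D → Fin nV
    vert-σ     : ∀ d → vert (σ d) ≡ vert d
    vert-orbit : ∀ d d' → vert d ≡ vert d' → ∃ λ k → iter σ k d ≡ d'
    vert-onto  : ∀ v → ∃ λ d → vert d ≡ v
    nF         : ℕ
    face       : Fin D → Fin nF
    face-φ     : ∀ d → face (φ d) ≡ face d
    face-orbit : ∀ d d' → face d ≡ face d' → ∃ λ k → iter φ k d ≡ d'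
    face-onto  : ∀ f → ∃ λ d → face d ≡ f
    connected  : ∀ d d' → Star (Step map) d d'
    -- Euler characteristic V - E + F = 0 (genus one), with E = D / 2
    euler      : 2 * (nV + nF) ≡ D

  -- an integer 1-chain (dart-weights; the net flow along d is x d - x (α d))
  -- is null-homologous (= contractible, on the torus) iff it is an integer
  -- combination of face boundaries
  NullHomologous : (Fin D → ℤ) → Set
  NullHomologous x = ∃ λ (c : Fin nF → ℤ) →
    ∀ d → x d -ℤ x (α d) ≡ c (face d) -ℤ c (face (α d))

  field
    no-contractible-loop : ∀ d → vert d ≡ vert (α d) → ¬ NullHomologous (δ map d)
    no-contractible-2cycle : ∀ d₁ d₂ → d₁ ≢ d₂ →
      vert d₁ ≡ vert d₂ → vert (α d₁) ≡ vert (α d₂) → vert d₁ ≢ vert (α d₁) →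
      ¬ NullHomologous (λ d → δ map d₁ d +ℤ δ map (α d₂) d)

-- Schnyder woods.  An orientation+colouring is encoded by giving, for
-- each dart d, either 'just i' (the edge of d is oriented away from the
-- tail of d, in colour i) or 'nothing'.

Colouring : Map → Set
Colouring M = Vec (Maybe (Fin 3)) (Map.D M)

module _ (M : Map) (col : Colouring M) where
  open Map M

  out : Fin D → Maybe (Fin 3)
  out = lookup col

  record MonoCycle (i : Fin 3) : Set where
    field
      len    : ℕ
      cyc    : Fin (suc len) → Fin D
      colour : ∀ j → out (cyc j) ≡ just i
      link   : ∀ (j : Fin len) → SameVertex (α (cyc (inject₁ j))) (cyc (suc j))
      close  : SameVertex (α (cyc (fromℕ len))) (cyc zero)

  Intersect : ∀ {i i'} → MonoCycle i → MonoCycle i' → Set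
  Intersect C C' = ∃₂ λ j j' → SameVertex (MonoCycle.cyc C j) (MonoCycle.cyc C' j')

  record IsSchnyderWood : Set where
    field
      oriented   : ∀ d → out d ≡ nothing → ¬ (out (α d) ≡ nothing)
      bidistinct : ∀ d i → out d ≡ just i → out (α d) ≢ just i
      out-exists : ∀ d i → ∃ λ d' → SameVertex d d' × out d' ≡ just i
      out-unique : ∀ d d' i → SameVertex d d' → out d ≡ just i → out d' ≡ just i → d ≡ d'
      ccw-order  : ∀ d₀ d₁ d₂ → SameVertex d₀ d₁ → SameVertex d₀ d₂ →
                   out d₀ ≡ just zero → out d₁ ≡ just (suc zero) →
                   out d₂ ≡ just (suc (suc zero)) → InSector d₀ d₂ d₁
      entering   : ∀ d i e₊ e₋ → out (α d) ≡ just i →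
                   SameVertex d e₊ → SameVertex d e₋ →
                   out e₊ ≡ just (next3 i) → out e₋ ≡ just (prev3 i) → InSector e₊ e₋ d
      T2         : ∀ i (C : MonoCycle i) →
                   (∃ λ (C' : MonoCycle (prev3 i)) → Intersect C C') ×
                   (∃ λ (C' : MonoCycle (next3 i)) → Intersect C C')

SWBijection : Map → Map → Set
SWBijection M N =
  Σ (Colouring M → Colouring N) λ f →
  Σ (Colouring N → Colouring M) λ g →
    (∀ c → IsSchnyderWood M c → IsSchnyderWood N (f c)) ×
    (∀ c → IsSchnyderWood N c → IsSchnyderWood M (g c)) ×
    (∀ c → IsSchnyderWood M c → g (f c) ≡ c) ×
    (∀ c → IsSchnyderWood N c → f (g c) ≡ c)

{-# OPTIONS --safe #-}
module Submission where

-- A Schnyder wood is the same as an angle labelling.  Around each edge the labels change three times, at its two ends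
-- or its two sides, in a self-dual pattern; so reading them around faces yields a colouring of the dual, and doing this
-- twice reverses all darts.  A face boundary without label change would be a monochromatic cycle violating (T2), hence
-- by Euler's formula every face has exactly one outgoing dual edge of each colour.
--
-- For (T2) of the dual, suppose that a dual κ-path leads from a dual i-cycle D to a disjoint dual κ-cycle E.  Being
-- disjoint on a torus, D and E are homologically dependent, so some combination of them is the coboundary of a vertex
-- potential p.  Along primal edges of suitable colours p is monotone, and (T2) then provides primal κ-cycles in
-- the maximal and the minimal level of p.  These two are dependent as well, say as the boundary of a face function q.
-- Since κ-cycles are crossed neither by E nor by the connecting path, q is constant where p jumps, and
-- restricting it to one level of p shows that a single primal κ-cycle is null-homologous.  But a null-homologous cycle
-- cannot be crossed by cycles of the other two colours, as all crossings have the same sign; it would have to be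
-- reversed by cycles of both.

open import Defs
open import Algebra.Bundles using (AbelianGroup)
import Data.Integer.Properties as ℤₚ
open import Algebra.Properties.Semiring.Sum ℤₚ.+-*-semiring
  using (sum; sum-cong-≗; sum-replicate-zero; sum-remove; ∑-distrib-+; ∑-comm; sum-permute; *-distribˡ-sum)
open import Data.Bool using (if_then_else_)
open import Data.Empty using (⊥; ⊥-elim)
open import Data.Fin as Fin using (Fin; zero; suc; toℕ; inject₁; fromℕ; punchIn; punchOut; _≟_; _<?_; _↑ˡ_; _↑ʳ_; splitAt)
open import Data.Fin.Induction using (<-weakInduction)
open import Data.Fin.Permutation using (permutation)
open import Data.Fin.Properties
  using (all?; any?; ¬∀⟶∃¬; pigeonhole; <-cmp; toℕ-inject₁; toℕ-fromℕ; join-splitAt; punchInᵢ≢i;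
         punchOut-punchIn; punchOut-cong)
open import Data.Fin.Relation.Unary.Top using (view; ‵fromℕ; ‵inject₁)
open import Data.Integer using (ℤ; 0ℤ; 1ℤ; _+_; _-_; _*_; -_; _≤_; +_)
import Data.Integer as ℤ
open import Data.Integer.Tactic.RingSolver using (solve-∀)
open import Data.List using (List; length; filter; tabulate; allFin)
import Data.List as List
open import Data.List.Membership.Propositional.Properties using (∈-filter⁺; ∈-allFin)
open import Data.List.Relation.Unary.Any using (index)
open import Data.List.Relation.Unary.Any.Properties using (lookup-index)
open import Data.Maybe using (Maybe; just; nothing)
open import Data.Maybe.Properties using (≡-dec; just-injective)
open import Data.Nat as ℕ using (ℕ; zero; suc; z≤n; s≤s)
open import Data.Nat.Induction using (<-wellFounded)
import Data.Nat.Properties as ℕₚ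
open import Data.Product using (Σ; ∃; ∃₂; _×_; _,_; proj₁; proj₂)
open import Data.Sum using (_⊎_; inj₁; inj₂; [_,_]′)
open import Data.Vec as Vec using (lookup)
open import Data.Vec.Properties using (lookup∘tabulate; tabulate∘lookup; tabulate-cong)
open import Function using (_∘_; case_of_)
open import Induction.WellFounded using (Acc; acc)
open import Relation.Binary.Construct.Closure.ReflexiveTransitive using (Star; ε; _◅_; _◅◅_)
open import Relation.Binary.Definitions using (tri<; tri≈; tri>)
open import Relation.Binary.PropositionalEquality
open import Relation.Nullary using (¬_; Dec; yes; no; does; contradiction)

-- Integer sums and homogeneous linear systems

-- The obstacle is that crossing arguments feed on (T2), which for the dual is the very claim. Dual
-- cycles therefore only produce a potential on primal vertices, and the contradiction is extracted
-- from primal cycles, for which (T2) is known. Their colour is that of E because primal and dual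
-- edges of equal colour never cross: q is then constant along E and along the connecting dual path.
-- The path makes q take the same value at E and at D; only then does subtracting a single constant
-- make q vanish wherever p jumps. Homology is reduced to integer linear algebra on darts. A
-- dependence comes out of counting unknowns, so its coefficients have unknown size and sign;
-- accordingly a change of potential along a cycle is written as an arbitrary factor times a
-- nonnegative count, and colours are selected by the signs that occur. Euler's formula enters
-- twice: it counts the coloured dual darts and the equations of the linear system.

i*j≢0 : ∀ {i j} → i ≢ 0ℤ → j ≢ 0ℤ → i * j ≢ 0ℤ
i*j≢0 {i} {j} i≢0 j≢0 = [ i≢0 , j≢0 ]′ ∘ ℤₚ.i*j≡0⇒i≡0∨j≡0 i

+-nonneg-zero : ∀ {i j} → 0ℤ ≤ i → 0ℤ ≤ j → i + j ≡ 0ℤ → i ≡ 0ℤ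
+-nonneg-zero {i} {j} 0≤i 0≤j i+j≡0 = ℤₚ.≤-antisym
  (subst₂ _≤_ (ℤₚ.+-identityʳ i) i+j≡0 (ℤₚ.+-monoʳ-≤ i 0≤j)) 0≤i

0≤i*i : ∀ i → 0ℤ ≤ i * i
0≤i*i (+ n) = subst (0ℤ ≤_) (ℤₚ.pos-* n n) (ℤ.+≤+ ℕ.z≤n)
0≤i*i ℤ.-[1+ n ] = ℤ.+≤+ ℕ.z≤n

abstract
  ∑ : ∀ {n} → (Fin n → ℤ) → ℤ
  ∑ = sum

  ∑-empty : (f : Fin 0 → ℤ) → ∑ f ≡ 0ℤ
  ∑-empty f = refl

  ∑-suc : ∀ {n} (f : Fin (suc n) → ℤ) → ∑ f ≡ f zero + ∑ (λ i → f (suc i))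
  ∑-suc f = refl

  ∑-cong : ∀ {n} {f g : Fin n → ℤ} → (∀ i → f i ≡ g i) → ∑ f ≡ ∑ g
  ∑-cong = sum-cong-≗

  ∑-swap : ∀ {m n} (f : Fin m → Fin n → ℤ) → ∑ (λ i → ∑ (f i)) ≡ ∑ (λ j → ∑ (λ i → f i j))
  ∑-swap = ∑-comm

  ∑-add : ∀ {n} (f g : Fin n → ℤ) → ∑ (λ i → f i + g i) ≡ ∑ f + ∑ g
  ∑-add = ∑-distrib-+

  ∑-*ˡ : ∀ {n} k (f : Fin n → ℤ) → ∑ (λ i → k * f i) ≡ k * ∑ f
  ∑-*ˡ k f = sym (*-distribˡ-sum k f)

  ∑-zero : ∀ {n} (f : Fin n → ℤ) → (∀ i → f i ≡ 0ℤ) → ∑ f ≡ 0ℤ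
  ∑-zero {n} f f≡0 = trans (sum-cong-≗ f≡0) (sum-replicate-zero n)

  ∑-reindex : ∀ {n} (f g : Fin n → Fin n) → (∀ i → f (g i) ≡ i) → (∀ i → g (f i) ≡ i) →
              (h : Fin n → ℤ) → ∑ (λ i → h (f i)) ≡ ∑ h
  ∑-reindex f g fg gf h = sym (sum-permute h (permutation f g fg gf))

  ∑-nonneg : ∀ {n} (f : Fin n → ℤ) → (∀ i → 0ℤ ≤ f i) → 0ℤ ≤ ∑ f
  ∑-nonneg {zero} f 0≤f = ℤₚ.≤-refl
  ∑-nonneg {suc n} f 0≤f = ℤₚ.+-mono-≤ (0≤f zero) (∑-nonneg (f ∘ suc) (0≤f ∘ suc))

  ∑-nonneg-zero : ∀ {n} (f : Fin n → ℤ) → (∀ i → 0ℤ ≤ f i) → ∑ f ≡ 0ℤ → ∀ i → f i ≡ 0ℤ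
  ∑-nonneg-zero f 0≤f eq zero = +-nonneg-zero (0≤f zero) (∑-nonneg (f ∘ suc) (0≤f ∘ suc)) eq
  ∑-nonneg-zero f 0≤f eq (suc i) = ∑-nonneg-zero (f ∘ suc) (0≤f ∘ suc)
    (+-nonneg-zero (∑-nonneg (f ∘ suc) (0≤f ∘ suc)) (0≤f zero)
      (trans (ℤₚ.+-comm (sum (f ∘ suc)) (f zero)) eq)) i

  ∑-telescope : ∀ n (f : ℕ → ℤ) → ∑ {n} (λ i → f (suc (toℕ i)) - f (toℕ i)) ≡ f n - f 0
  ∑-telescope zero f = sym (ℤₚ.+-inverseʳ (f 0))
  ∑-telescope (suc n) f =
    trans (cong (_+_ (f 1 - f 0)) (∑-telescope n (f ∘ suc))) (lem (f 0) (f 1) (f (suc n)))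
    where
    lem : ∀ a b c → (b - a) + (c - b) ≡ c - a
    lem = solve-∀

  ∑-const : ∀ n c → ∑ {n} (λ _ → c) ≡ + n * c
  ∑-const zero c = sym (ℤₚ.*-zeroˡ c)
  ∑-const (suc n) c = trans (cong (_+_ c) (∑-const n c)) (sym (ℤₚ.suc-* (+ n) c))

  ∑-remove : ∀ {n} (i : Fin (suc n)) (f : Fin (suc n) → ℤ) → ∑ f ≡ f i + ∑ (λ k → f (punchIn i k))
  ∑-remove i f = sum-remove {i = i} f

∑-sub : ∀ {n} (f g : Fin n → ℤ) → ∑ (λ i → f i - g i) ≡ ∑ f - ∑ g
∑-sub f g = begin
  ∑ (λ i → f i - g i)             ≡⟨ ∑-cong (λ i → lem (f i) (g i)) ⟩
  ∑ (λ i → f i + - 1ℤ * g i)      ≡⟨ ∑-add f (λ i → - 1ℤ * g i) ⟩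
  ∑ f + ∑ (λ i → - 1ℤ * g i)      ≡⟨ cong (_+_ (∑ f)) (∑-*ˡ (- 1ℤ) g) ⟩
  ∑ f + - 1ℤ * ∑ g                ≡⟨ sym (lem (∑ f) (∑ g)) ⟩
  ∑ f - ∑ g                       ∎
  where
  open ≡-Reasoning
  lem : ∀ a b → a - b ≡ a + - 1ℤ * b
  lem = solve-∀

-- Either `k` or the sum of `f` is zero, so the sign of `k` need not be known. This is how homology
-- coefficients enter the crossing arguments.
∑-scaled-nonneg-zero : ∀ {n} k (f : Fin n → ℤ) → (∀ i → 0ℤ ≤ f i) →
                       ∑ (λ i → k * f i) ≡ 0ℤ → ∀ i → k * f i ≡ 0ℤ
∑-scaled-nonneg-zero k f 0≤f eq i with ℤₚ.i*j≡0⇒i≡0∨j≡0 k (trans (sym (∑-*ˡ k f)) eq)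
... | inj₁ refl = ℤₚ.*-zeroˡ (f i)
... | inj₂ ∑≡0 = trans (cong (k *_) (∑-nonneg-zero f 0≤f ∑≡0 i)) (ℤₚ.*-zeroʳ k)

𝟙 : {P : Set} → Dec P → ℤ
𝟙 (yes _) = 1ℤ
𝟙 (no _) = 0ℤ

𝟙-yes : {P : Set} (p? : Dec P) → P → 𝟙 p? ≡ 1ℤ
𝟙-yes (yes _) p = refl
𝟙-yes (no ¬p) p = contradiction p ¬p

𝟙-no : {P : Set} (p? : Dec P) → ¬ P → 𝟙 p? ≡ 0ℤ
𝟙-no (yes p) ¬p = contradiction p ¬p
𝟙-no (no _) ¬p = refl

𝟙-nonneg : {P : Set} (p? : Dec P) → 0ℤ ≤ 𝟙 p?
𝟙-nonneg (yes _) = ℤ.+≤+ ℕ.z≤n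
𝟙-nonneg (no _) = ℤₚ.≤-refl

𝟙≢0 : {P : Set} (p? : Dec P) → 𝟙 p? ≢ 0ℤ → P
𝟙≢0 (yes p) _ = p
𝟙≢0 (no _) ≢0 = contradiction refl ≢0

𝟙-cong : {P Q : Set} (p? : Dec P) (q? : Dec Q) → (P → Q) → (Q → P) → 𝟙 p? ≡ 𝟙 q?
𝟙-cong (yes p) q? f g = sym (𝟙-yes q? (f p))
𝟙-cong (no ¬p) q? f g = sym (𝟙-no q? (¬p ∘ g))

∑-δ : ∀ {n} (a : Fin n) (g : Fin n → ℤ) → ∑ (λ i → 𝟙 (a ≟ i) * g i) ≡ g a
∑-δ {suc n} a g = begin
  ∑ t ≡⟨ ∑-remove a t ⟩
  t a + ∑ (λ k → t (punchIn a k))       ≡⟨ cong₂ _+_ (cong (_* g a) (𝟙-yes (a ≟ a) refl)) (∑-zero _ off) ⟩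
  1ℤ * g a + 0ℤ                           ≡⟨ trans (ℤₚ.+-identityʳ _) (ℤₚ.*-identityˡ _) ⟩
  g a                                     ∎
  where
  open ≡-Reasoning
  t = λ i → 𝟙 (a ≟ i) * g i
  off : ∀ k → t (punchIn a k) ≡ 0ℤ
  off k = cong (_* g (punchIn a k)) (𝟙-no (a ≟ punchIn a k) (λ eq → punchInᵢ≢i a k (sym eq)))

∑≢0⇒∃ : ∀ {n} (f : Fin n → ℤ) → ∑ f ≢ 0ℤ → ∃ λ i → f i ≢ 0ℤ
∑≢0⇒∃ f ∑≢0 = ¬∀⟶∃¬ _ _ (λ i → f i ℤₚ.≟ 0ℤ) (∑≢0 ∘ ∑-zero f)

Row : ℕ → Set
Row u = Fin u → ℤ

_∙_ : ∀ {u} → Row u → Row u → ℤ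
r ∙ x = ∑ (λ j → r j * x j)

-- Fraction-free Gaussian elimination: `s` is multiplied by the pivot `r j` instead of divided by
-- it.
eliminate : ∀ {u} → Row (suc u) → Fin (suc u) → Row (suc u) → Row u
eliminate r j s k = r j * s (punchIn j k) - s j * r (punchIn j k)

-- Scaling the other coordinates by the pivot `r j` keeps the pivot coordinate integral.
back-substitute : ∀ {u} → Row (suc u) → Fin (suc u) → Row u → Row (suc u)
back-substitute r j y i with i ≟ j
... | yes _ = - ∑ (λ k → r (punchIn j k) * y k)
... | no i≢j = r j * y (punchOut (i≢j ∘ sym))

module _ {u} (r : Row (suc u)) (j : Fin (suc u)) (y : Row u) where
  back-substitute-pivot : back-substitute r j y j ≡ - ∑ (λ k → r (punchIn j k) * y k)
  back-substitute-pivot with j ≟ j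
  ... | yes _ = refl
  ... | no j≢j = contradiction refl j≢j

  back-substitute-rest : ∀ k → back-substitute r j y (punchIn j k) ≡ r j * y k
  back-substitute-rest k with punchIn j k ≟ j
  ... | yes eq = contradiction eq (punchInᵢ≢i j k)
  ... | no ≢ = cong (λ t → r j * y t) (trans (punchOut-cong j refl) (punchOut-punchIn j))

  ∙-back-substitute : ∀ s → s ∙ back-substitute r j y ≡ eliminate r j s ∙ y
  ∙-back-substitute s = begin
    s ∙ x                                                              ≡⟨ ∑-remove j (λ i → s i * x i) ⟩
    s j * x j + ∑ (λ k → s (punchIn j k) * x (punchIn j k))
      ≡⟨ cong₂ (λ a b → s j * a + b) back-substitute-pivot (∑-cong (λ k → cong (s (punchIn j k) *_) (back-substitute-rest k))) ⟩
    s j * (- R) + ∑ (λ k → s (punchIn j k) * (r j * y k))            ≡⟨ lem₁ (s j) R _ ⟩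
    ∑ (λ k → s (punchIn j k) * (r j * y k)) - s j * R
      ≡⟨ cong (λ t → ∑ (λ k → s (punchIn j k) * (r j * y k)) - t) (sym (∑-*ˡ (s j) _)) ⟩
    ∑ (λ k → s (punchIn j k) * (r j * y k)) - ∑ (λ k → s j * (r (punchIn j k) * y k)) ≡⟨ sym (∑-sub _ _) ⟩
    ∑ (λ k → s (punchIn j k) * (r j * y k) - s j * (r (punchIn j k) * y k))
      ≡⟨ ∑-cong (λ k → lem₂ (s (punchIn j k)) (r j) (y k) (s j) (r (punchIn j k))) ⟩
    eliminate r j s ∙ y                                                ∎
    where
    open ≡-Reasoning
    x = back-substitute r j y
    R = ∑ (λ k → r (punchIn j k) * y k)
    lem₁ : ∀ a b c → a * (- b) + c ≡ c - a * b
    lem₁ = solve-∀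
    lem₂ : ∀ a b c d e → a * (b * c) - d * (e * c) ≡ (b * a - d * e) * c
    lem₂ = solve-∀

  ∙-back-substitute-self : r ∙ back-substitute r j y ≡ 0ℤ
  ∙-back-substitute-self = trans (∙-back-substitute r) (∑-zero _ (λ k → lem (r j) (r (punchIn j k)) (y k)))
    where
    lem : ∀ a b c → (a * b - a * b) * c ≡ 0ℤ
    lem = solve-∀

solve-system : ∀ {e u} (rows : Fin e → Row u) → e ℕ.< u →
               ∃ λ (x : Row u) → (∃ λ j → x j ≢ 0ℤ) × (∀ i → rows i ∙ x ≡ 0ℤ)
solve-system {zero} {suc u} rows _ = (λ _ → 1ℤ) , (zero , λ ()) , λ ()
solve-system {suc e} {suc u} rows (ℕ.s≤s e<u) with all? (λ j → rows zero j ℤₚ.≟ 0ℤ)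
... | yes r≡0 with x , x≢0 , sol ← solve-system (rows ∘ suc) (ℕₚ.m<n⇒m<1+n e<u) =
  x , x≢0 , λ { zero → ∑-zero _ (λ j → trans (cong (_* x j) (r≡0 j)) (ℤₚ.*-zeroˡ (x j))) ; (suc i) → sol i }
... | no r≢0
  with j , rj≢0 ← ¬∀⟶∃¬ _ _ (λ j → rows zero j ℤₚ.≟ 0ℤ) r≢0
  with y , (k , yk≢0) , sol ← solve-system (eliminate (rows zero) j ∘ rows ∘ suc) e<u =
  back-substitute r j y ,
  (punchIn j k , subst (_≢ 0ℤ) (sym (back-substitute-rest r j y k)) (i*j≢0 rj≢0 yk≢0)) ,
  λ { zero → ∙-back-substitute-self r j y
    ; (suc i) → trans (∙-back-substitute r j y (rows (suc i))) (sol i) }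
  where r = rows zero

abstract
  nontrivial-solution : ∀ {e u} (rows : Fin e → Row u) → e ℕ.< u →
                        ∃ λ (x : Row u) → (∃ λ j → x j ≢ 0ℤ) × (∀ i → rows i ∙ x ≡ 0ℤ)
  nontrivial-solution = solve-system

-- Surfaces, chains and closed walks

iter-+ : ∀ {A : Set} (f : A → A) m n x → iter f (m ℕ.+ n) x ≡ iter f m (iter f n x)
iter-+ f zero n x = refl
iter-+ f (suc m) n x = cong f (iter-+ f m n x)

iter-comm : ∀ {A : Set} (f : A → A) n x → iter f n (f x) ≡ f (iter f n x)
iter-comm f zero x = refl
iter-comm f (suc n) x = cong f (iter-comm f n x)

iter-cancel : ∀ {A : Set} {f g : A → A} → (∀ x → g (f x) ≡ x) → ∀ n x → iter g n (iter f n x) ≡ x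
iter-cancel gf zero x = refl
iter-cancel {f = f} {g} gf (suc n) x =
  trans (sym (iter-comm g n _)) (trans (cong (iter g n) (gf _)) (iter-cancel gf n x))

length-filter : ∀ {A : Set} {P : A → Set} (P? : ∀ x → Dec (P x)) {n} (f : Fin n → A) →
                + length (filter P? (tabulate f)) ≡ ∑ (λ i → 𝟙 (P? (f i)))
length-filter P? {zero} f = sym (∑-empty _)
length-filter P? {suc n} f with P? (f zero) in eq
... | yes _ = trans (cong (_+_ 1ℤ) (length-filter P? (f ∘ suc)))
                    (sym (trans (∑-suc _) (cong (λ d → 𝟙 d + ∑ (λ i → 𝟙 (P? (f (suc i))))) eq)))
... | no _ = trans (length-filter P? (f ∘ suc))
                   (sym (trans (∑-suc _) (trans (cong (λ d → 𝟙 d + ∑ (λ i → 𝟙 (P? (f (suc i))))) eq) (ℤₚ.+-identityˡ _))))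

ℤ-cancelʳ : ∀ {i j k} → i + k ≡ j + k → i ≡ j
ℤ-cancelʳ {i} {j} {k} = ∙-cancelʳ k i j
  where open import Algebra.Properties.Group (AbelianGroup.group ℤₚ.+-0-abelianGroup)

-- The data that dualises by swapping vertices and faces, so that every lemma about it applies to a
-- map, its dual and its bidual.
record Surface (M : Map) : Set where
  open Map M
  field
    nV         : ℕ
    vert       : Fin D → Fin nV
    vert-σ     : ∀ d → vert (σ d) ≡ vert d
    vert-orbit : ∀ d d′ → vert d ≡ vert d′ → ∃ λ k → iter σ k d ≡ d′
    vert-onto  : ∀ v → ∃ λ d → vert d ≡ v
    nF         : ℕ
    face       : Fin D → Fin nF
    face-φ     : ∀ d → face (φ d) ≡ face d
    face-orbit : ∀ d d′ → face d ≡ face d′ → ∃ λ k → iter φ k d ≡ d′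
    face-onto  : ∀ f → ∃ λ d → face d ≡ f
    connected  : ∀ d d′ → Star (Step M) d d′
    euler      : 2 ℕ.* (nV ℕ.+ nF) ≡ D

  φ⁻ : Fin D → Fin D
  φ⁻ d = α (σ⁻ d)

  φφ⁻ : ∀ d → φ (φ⁻ d) ≡ d
  φφ⁻ d = trans (cong σ (α-invol (σ⁻ d))) (σσ⁻ d)

  φ⁻φ : ∀ d → φ⁻ (φ d) ≡ d
  φ⁻φ d = trans (cong α (σ⁻σ (α d))) (α-invol d)

  vert-σ⁻ : ∀ d → vert (σ⁻ d) ≡ vert d
  vert-σ⁻ d = trans (sym (vert-σ (σ⁻ d))) (cong vert (σσ⁻ d))

  vert-φ : ∀ d → vert (φ d) ≡ vert (α d)
  vert-φ d = vert-σ (α d)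

  face-φ⁻ : ∀ d → face (φ⁻ d) ≡ face d
  face-φ⁻ d = trans (sym (face-φ (φ⁻ d))) (cong face (φφ⁻ d))

  -- face d is the face to the right of d, so face (α d) is the one to its left.
  face-σ : ∀ d → face (σ d) ≡ face (α d)
  face-σ d = trans (cong (face ∘ σ) (sym (α-invol d))) (face-φ (α d))

  face-σ⁻ : ∀ d → face (α (σ⁻ d)) ≡ face d
  face-σ⁻ = face-φ⁻

  vert-iter-σ : ∀ k d → vert (iter σ k d) ≡ vert d
  vert-iter-σ zero d = refl
  vert-iter-σ (suc k) d = trans (vert-σ _) (vert-iter-σ k d)

  face-iter-φ : ∀ k d → face (iter φ k d) ≡ face d
  face-iter-φ zero d = refl
  face-iter-φ (suc k) d = trans (face-φ _) (face-iter-φ k d)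

  repV : Fin nV → Fin D
  repV v = proj₁ (vert-onto v)

  repF : Fin nF → Fin D
  repF f = proj₁ (face-onto f)

  iter-invariant : ∀ {A : Set} {f : Fin D → Fin D} (g : Fin D → A) → (∀ d → g (f d) ≡ g d) →
                   ∀ k d → g (iter f k d) ≡ g d
  iter-invariant g gf zero d = refl
  iter-invariant g gf (suc k) d = trans (gf _) (iter-invariant g gf k d)

  σ-invariant : ∀ {A : Set} (g : Fin D → A) → (∀ d → g (σ d) ≡ g d) →
                ∀ {d d′} → vert d ≡ vert d′ → g d ≡ g d′
  σ-invariant g gσ {d} {d′} eq with k , refl ← vert-orbit d d′ eq = sym (iter-invariant g gσ k d)

  φ-invariant : ∀ {A : Set} (g : Fin D → A) → (∀ d → g (φ d) ≡ g d) →
                ∀ {d d′} → face d ≡ face d′ → g d ≡ g d′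
  φ-invariant g gφ {d} {d′} eq with k , refl ← face-orbit d d′ eq = sym (iter-invariant g gφ k d)

  SameVertex⇒≡ : ∀ {d d′} → SameVertex d d′ → vert d ≡ vert d′
  SameVertex⇒≡ (k , refl) = sym (vert-iter-σ k _)

  Step-invariant : ∀ {A : Set} (g : Fin D → A) → (∀ d → g (σ d) ≡ g d) → (∀ d → g (α d) ≡ g d) →
                   ∀ d d′ → g d ≡ g d′
  Step-invariant g gσ gα d d′ = go (connected d d′)
    where
    go : ∀ {d d′} → Star (Step M) d d′ → g d ≡ g d′
    go ε = refl
    go (inj₁ refl ◅ s) = trans (sym (gσ _)) (go s)
    go (inj₂ refl ◅ s) = trans (sym (gα _)) (go s)

  ∑-σ : ∀ (h : Fin D → ℤ) → ∑ (λ d → h (σ d)) ≡ ∑ h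
  ∑-σ = ∑-reindex σ σ⁻ σσ⁻ σ⁻σ

  ∑-σ⁻ : ∀ (h : Fin D → ℤ) → ∑ (λ d → h (σ⁻ d)) ≡ ∑ h
  ∑-σ⁻ = ∑-reindex σ⁻ σ σ⁻σ σσ⁻

  ∑-α : ∀ (h : Fin D → ℤ) → ∑ (λ d → h (α d)) ≡ ∑ h
  ∑-α = ∑-reindex α α α-invol α-invol

  edges : List (Fin D)
  edges = filter (λ d → d <? α d) (allFin D)

  edges-cover : ∀ d → ∃ λ i → List.lookup edges i ≡ d ⊎ List.lookup edges i ≡ α d
  edges-cover d with <-cmp d (α d)
  ... | tri< d<αd _ _ = index p , inj₁ (sym (lookup-index p))
    where p = ∈-filter⁺ (λ d → d <? α d) (∈-allFin d) d<αd
  ... | tri≈ _ d≡αd _ = contradiction (sym d≡αd) (α-fpf d)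
  ... | tri> _ _ αd<d = index p , inj₂ (sym (lookup-index p))
    where p = ∈-filter⁺ (λ d → d <? α d) (∈-allFin (α d)) (subst (α d Fin.<_) (sym (α-invol d)) αd<d)

  -- Of the two darts of an edge exactly one is smaller than its reverse, so `D` is twice the length
  -- of the list; `euler` does the rest.
  length-edges : length edges ≡ nV ℕ.+ nF
  length-edges = ℕₚ.*-cancelˡ-≡ _ _ 2 (trans (ℤₚ.+-injective (begin
    + (2 ℕ.* length edges)
      ≡⟨ trans (ℤₚ.pos-* 2 (length edges)) (lem (+ length edges)) ⟩
    + length edges + + length edges
      ≡⟨ cong₂ _+_ (length-filter _ _) (trans (length-filter _ _) (sym (∑-α _))) ⟩
    ∑ (λ d → 𝟙 (d <? α d)) + ∑ (λ d → 𝟙 (α d <? α (α d)))       ≡⟨ sym (∑-add _ _) ⟩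
    ∑ (λ d → 𝟙 (d <? α d) + 𝟙 (α d <? α (α d)))                 ≡⟨ ∑-cong one ⟩
    ∑ {D} (λ _ → 1ℤ)                                            ≡⟨ trans (∑-const D 1ℤ) (ℤₚ.*-identityʳ (+ D)) ⟩
    + D                                                         ∎)) (sym euler))
    where
    open ≡-Reasoning
    lem : ∀ a → + 2 * a ≡ a + a
    lem = solve-∀
    one : ∀ d → 𝟙 (d <? α d) + 𝟙 (α d <? α (α d)) ≡ 1ℤ
    one d rewrite α-invol d with <-cmp d (α d)
    ... | tri< a _ c = cong₂ _+_ (𝟙-yes (d <? α d) a) (𝟙-no (α d <? d) c)
    ... | tri≈ _ d≡αd _ = contradiction (sym d≡αd) (α-fpf d)
    ... | tri> a _ c = cong₂ _+_ (𝟙-no (d <? α d) a) (𝟙-yes (α d <? d) c)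

  -- The start `b` is left out: turning from the corner after `b` to the corner after `iter σ k b`
  -- sweeps over exactly the darts from `σ b` to `iter σ k b`.
  path-sum : (Fin D → ℤ) → Fin D → ℕ → ℤ
  path-sum x b zero = 0ℤ
  path-sum x b (suc k) = path-sum x b k + x (iter σ (suc k) b)

  path-sum-+ : ∀ x b t k → path-sum x b (t ℕ.+ k) ≡ path-sum x b k + path-sum x (iter σ k b) t
  path-sum-+ x b zero k = sym (ℤₚ.+-identityʳ _)
  path-sum-+ x b (suc t) k = begin
    path-sum x b (t ℕ.+ k) + x (iter σ (suc t ℕ.+ k) b)
      ≡⟨ cong₂ (λ s d → s + x d) (path-sum-+ x b t k) (iter-+ σ (suc t) k b) ⟩
    path-sum x b k + path-sum x (iter σ k b) t + x (iter σ (suc t) (iter σ k b))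
      ≡⟨ ℤₚ.+-assoc (path-sum x b k) _ _ ⟩
    path-sum x b k + path-sum x (iter σ k b) (suc t) ∎
    where open ≡-Reasoning

  visits : Fin D → ℕ → Fin D → ℤ
  visits b t d = path-sum (λ e → 𝟙 (e ≟ d)) b t

  path-sum-visits : ∀ x b t → path-sum x b t ≡ ∑ (λ d → visits b t d * x d)
  path-sum-visits x b zero = sym (∑-zero _ (λ d → ℤₚ.*-zeroˡ (x d)))
  path-sum-visits x b (suc t) = begin
    path-sum x b t + x e
      ≡⟨ cong₂ _+_ (path-sum-visits x b t) (sym (∑-δ e x)) ⟩
    ∑ (λ d → visits b t d * x d) + ∑ (λ d → 𝟙 (e ≟ d) * x d)       ≡⟨ sym (∑-add _ _) ⟩
    ∑ (λ d → visits b t d * x d + 𝟙 (e ≟ d) * x d)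
      ≡⟨ ∑-cong (λ d → sym (ℤₚ.*-distribʳ-+ (x d) (visits b t d) (𝟙 (e ≟ d)))) ⟩
    ∑ (λ d → visits b (suc t) d * x d)                             ∎
    where
    open ≡-Reasoning
    e = iter σ (suc t) b

  visits-shift : ∀ b t d → visits b t (σ d) + 𝟙 (iter σ t b ≟ d) ≡ visits b t d + 𝟙 (b ≟ d)
  visits-shift b zero d = refl
  visits-shift b (suc t) d = begin
    visits b t (σ d) + 𝟙 (σ (iter σ t b) ≟ σ d) + X
      ≡⟨ cong (λ z → visits b t (σ d) + z + X) (𝟙-cong (σ (iter σ t b) ≟ σ d) (iter σ t b ≟ d) σ-injective (cong σ)) ⟩
    visits b t (σ d) + 𝟙 (iter σ t b ≟ d) + X         ≡⟨ cong (_+ X) (visits-shift b t d) ⟩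
    visits b t d + 𝟙 (b ≟ d) + X                      ≡⟨ lem (visits b t d) (𝟙 (b ≟ d)) X ⟩
    visits b t d + X + 𝟙 (b ≟ d)                      ∎
    where
    open ≡-Reasoning
    X = 𝟙 (iter σ (suc t) b ≟ d)
    σ-injective : ∀ {d d′} → σ d ≡ σ d′ → d ≡ d′
    σ-injective {d} {d′} eq = trans (sym (σ⁻σ d)) (trans (cong σ⁻ eq) (σ⁻σ d′))
    lem : ∀ a b c → a + b + c ≡ a + c + b
    lem = solve-∀

  visits-closed : ∀ {b t} → iter σ t b ≡ b → ∀ d → visits b t (σ d) ≡ visits b t d
  visits-closed {b} {t} eq d = ℤ-cancelʳ
    (trans (cong (λ e → visits b t (σ d) + 𝟙 (e ≟ d)) (sym eq)) (visits-shift b t d))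

  -- Zero divergence at every vertex, tested against all vertex potentials at once; visit counts can
  -- be plugged in directly.
  Coclosed : (Fin D → ℤ) → Set
  Coclosed x = ∀ (p : Fin nV → ℤ) → ∑ (λ d → x d * p (vert d)) ≡ 0ℤ

  -- A turn that returns to its start, possibly after several rounds, visits all darts of a vertex
  -- equally often. The visit count is thus a vertex potential, against which `x` sums to zero.
  path-sum-closed : ∀ {x} → Coclosed x → ∀ b t → iter σ t b ≡ b → path-sum x b t ≡ 0ℤ
  path-sum-closed {x} x-coclosed b t eq = begin
    path-sum x b t                                   ≡⟨ path-sum-visits x b t ⟩
    ∑ (λ d → visits b t d * x d)
      ≡⟨ ∑-cong (λ d → trans (ℤₚ.*-comm (visits b t d) (x d))
          (cong (x d *_) (σ-invariant (visits b t) (visits-closed {b} {t} eq) (sym (proj₂ (vert-onto (vert d))))))) ⟩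
    ∑ (λ d → x d * visits b t (repV (vert d)))       ≡⟨ x-coclosed (λ v → visits b t (repV v)) ⟩
    0ℤ                                               ∎
    where open ≡-Reasoning

  path-sum-unique-≤ : ∀ {x} → Coclosed x → ∀ b {k k′} → k ℕ.≤ k′ → iter σ k b ≡ iter σ k′ b →
                      path-sum x b k′ ≡ path-sum x b k
  path-sum-unique-≤ {x} x-coclosed b {k} {k′} k≤k′ eq = begin
    path-sum x b k′                                  ≡⟨ cong (path-sum x b) k′≡ ⟩
    path-sum x b (t ℕ.+ k)                           ≡⟨ path-sum-+ x b t k ⟩
    path-sum x b k + path-sum x (iter σ k b) t
      ≡⟨ cong (_+_ (path-sum x b k)) (path-sum-closed x-coclosed (iter σ k b) t loop) ⟩
    path-sum x b k + 0ℤ                              ≡⟨ ℤₚ.+-identityʳ _ ⟩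
    path-sum x b k                                   ∎
    where
    open ≡-Reasoning
    t = k′ ℕ.∸ k
    k′≡ : k′ ≡ t ℕ.+ k
    k′≡ = sym (ℕₚ.m∸n+n≡m k≤k′)
    loop : iter σ t (iter σ k b) ≡ iter σ k b
    loop = trans (sym (iter-+ σ t k b)) (trans (cong (λ n → iter σ n b) (sym k′≡)) (sym eq))

  path-sum-unique : ∀ {x} → Coclosed x → ∀ b k k′ → iter σ k b ≡ iter σ k′ b →
                    path-sum x b k ≡ path-sum x b k′
  path-sum-unique x-coclosed b k k′ eq with ℕₚ.≤-total k k′
  ... | inj₁ k≤k′ = sym (path-sum-unique-≤ x-coclosed b k≤k′ eq)
  ... | inj₂ k′≤k = path-sum-unique-≤ x-coclosed b k′≤k (sym eq)

  -- The primitive lives on corners; the corner between d and σ d is indexed by d.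
  module Primitive {x : Fin D → ℤ} (x-coclosed : Coclosed x) where

    position : ∀ d → ∃ λ k → iter σ k (repV (vert d)) ≡ d
    position d = vert-orbit _ _ (proj₂ (vert-onto (vert d)))

    primitive-at : Fin D → ℤ
    primitive-at d = path-sum x (repV (vert d)) (proj₁ (position d))

    primitive-char : ∀ v k d → vert d ≡ v → iter σ k (repV v) ≡ d → primitive-at d ≡ path-sum x (repV v) k
    primitive-char v k d refl eq =
      path-sum-unique x-coclosed (repV v) (proj₁ (position d)) k (trans (proj₂ (position d)) (sym eq))

    primitive-jump : ∀ d → primitive-at d - primitive-at (σ⁻ d) ≡ x d
    primitive-jump d = begin
      primitive-at d - primitive-at (σ⁻ d)
        ≡⟨ cong (_- primitive-at (σ⁻ d)) (primitive-char v (suc k) d (sym (vert-σ⁻ d)) next≡) ⟩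
      primitive-at (σ⁻ d) + x (iter σ (suc k) (repV v)) - primitive-at (σ⁻ d)   ≡⟨ lem (primitive-at (σ⁻ d)) _ ⟩
      x (iter σ (suc k) (repV v))                    ≡⟨ cong x next≡ ⟩
      x d                                            ∎
      where
      open ≡-Reasoning
      v = vert (σ⁻ d)
      k = proj₁ (position (σ⁻ d))
      next≡ : iter σ (suc k) (repV v) ≡ d
      next≡ = trans (cong σ (proj₂ (position (σ⁻ d)))) (σσ⁻ d)
      lem : ∀ a b → a + b - a ≡ b
      lem = solve-∀

    primitive-vanishes : ∀ v → (∀ d → vert d ≡ v → x d ≡ 0ℤ) → ∀ d → vert d ≡ v → primitive-at d ≡ 0ℤ
    primitive-vanishes v x≡0 d refl = go (proj₁ (position d))
      where
      go : ∀ k → path-sum x (repV v) k ≡ 0ℤ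
      go zero = refl
      go (suc k) = cong₂ _+_ (go k) (x≡0 _ (trans (vert-iter-σ (suc k) _) (proj₂ (vert-onto v))))

-- The face permutation of the dual is `α ∘ σ⁻ ∘ α`, clockwise rotation conjugated by `α`; this is
-- why dual faces are named by `vert ∘ α` and not by `vert`.
dual-surface : ∀ {M} → Surface M → Surface (dual M)
dual-surface {M} S = record
  { nV = nF
  ; vert = face
  ; vert-σ = face-φ⁻
  ; vert-orbit = orbit
  ; vert-onto = face-onto
  ; nF = nV
  ; face = vert ∘ α
  ; face-φ = λ d → trans (cong vert (α-invol (σ⁻ (α d)))) (vert-σ⁻ (α d))
  ; face-orbit = λ d d′ eq → let k , p = orbit′ (α d) (α d′) eq in k , trans (conj k d) (trans (cong α p) (α-invol d′))
  ; face-onto = λ v → α (repV v) , trans (cong vert (α-invol (repV v))) (proj₂ (vert-onto v))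
  ; connected = λ d d′ → go (connected d d′)
  ; euler = trans (cong (2 ℕ.*_) (ℕₚ.+-comm nF nV)) euler
  }
  where
  open Map M
  open Surface S
  orbit : ∀ d d′ → face d ≡ face d′ → ∃ λ k → iter φ⁻ k d ≡ d′
  orbit d d′ eq with k , refl ← face-orbit d′ d (sym eq) = k , iter-cancel φ⁻φ k d′
  orbit′ : ∀ d d′ → vert d ≡ vert d′ → ∃ λ k → iter σ⁻ k d ≡ d′
  orbit′ d d′ eq with k , refl ← vert-orbit d′ d (sym eq) = k , iter-cancel σ⁻σ k d′
  conj : ∀ k d → iter (Map.φ (dual M)) k d ≡ α (iter σ⁻ k (α d))
  conj zero d = sym (α-invol d)
  conj (suc k) d = cong (α ∘ σ⁻) (trans (cong α (conj k d)) (α-invol _))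
  -- `σ d` and `α d` lie on the same face, so reversing `d` and then turning around that face
  -- reaches `σ d`.
  step : ∀ d → Star (Step (dual M)) d (σ d)
  step d = inj₂ refl ◅ back face-orbit′
    where
    face-orbit′ : ∃ λ k → iter φ⁻ k (α d) ≡ σ d
    face-orbit′ = orbit (α d) (σ d) (sym (face-σ d))
    steps : ∀ k e → Star (Step (dual M)) e (iter φ⁻ k e)
    steps zero e = ε
    steps (suc k) e = steps k e ◅◅ (inj₁ refl ◅ ε)
    back : (∃ λ k → iter φ⁻ k (α d) ≡ σ d) → Star (Step (dual M)) (α d) (σ d)
    back (k , eq) = subst (Star (Step (dual M)) (α d)) eq (steps k (α d))
  go : ∀ {d d′} → Star (Step M) d d′ → Star (Step (dual M)) d d′
  go ε = ε
  go (inj₁ refl ◅ s) = step _ ◅◅ go s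
  go (inj₂ refl ◅ s) = inj₂ refl ◅ go s

module _ {M : Map} (S : Surface M) where
  open Map M
  open Surface S

  -- Only the first `len` darts are counted. Continuing the sequence forever makes the head of every
  -- dart the tail of the next one, with no wrap-around case.
  record ClosedWalk : Set where
    field
      len    : ℕ
      dart   : ℕ → Fin D
      link   : ∀ j → vert (α (dart j)) ≡ vert (dart (suc j))
      closed : vert (dart len) ≡ vert (dart 0)

module _ {M : Map} {S : Surface M} where
  open Map M
  open Surface S

  module _ (W : ClosedWalk S) where
    open ClosedWalk W

    multiplicity : Fin D → ℤ
    multiplicity d = ∑ {len} (λ j → 𝟙 (dart (toℕ j) ≟ d))

    chain : Fin D → ℤ
    chain d = multiplicity d - multiplicity (α d)

    multiplicity-nonneg : ∀ d → 0ℤ ≤ multiplicity d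
    multiplicity-nonneg d = ∑-nonneg _ (λ j → 𝟙-nonneg (dart (toℕ j) ≟ d))

    multiplicity≢0 : ∀ d → multiplicity d ≢ 0ℤ → ∃ λ j → dart j ≡ d
    multiplicity≢0 d m≢0 with j , ≢0 ← ∑≢0⇒∃ _ m≢0 = toℕ j , 𝟙≢0 (dart (toℕ j) ≟ d) ≢0

    multiplicity-dart : ∀ (j : Fin len) → multiplicity (dart (toℕ j)) ≢ 0ℤ
    multiplicity-dart j eq = contradiction
      (trans (sym (𝟙-yes (dart (toℕ j) ≟ dart (toℕ j)) refl))
             (∑-nonneg-zero _ (λ i → 𝟙-nonneg (dart (toℕ i) ≟ dart (toℕ j))) eq j))
      (λ ())

    chain-α : ∀ d → chain (α d) ≡ - chain d
    chain-α d = trans (cong (λ e → multiplicity (α d) - multiplicity e) (α-invol d)) (lem (multiplicity (α d)) (multiplicity d))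
      where
      lem : ∀ a b → a - b ≡ - (b - a)
      lem = solve-∀

    ∑-multiplicity : ∀ (g : Fin D → ℤ) → ∑ (λ d → multiplicity d * g d) ≡ ∑ {len} (λ j → g (dart (toℕ j)))
    ∑-multiplicity g = begin
      ∑ (λ d → multiplicity d * g d)
        ≡⟨ ∑-cong (λ d → trans (ℤₚ.*-comm (multiplicity d) (g d)) (sym (∑-*ˡ (g d) _))) ⟩
      ∑ (λ d → ∑ {len} (λ j → g d * 𝟙 (dart (toℕ j) ≟ d)))            ≡⟨ ∑-swap _ ⟩
      ∑ {len} (λ j → ∑ (λ d → g d * 𝟙 (dart (toℕ j) ≟ d)))
        ≡⟨ ∑-cong (λ j → trans (∑-cong (λ d → ℤₚ.*-comm (g d) _)) (∑-δ (dart (toℕ j)) g)) ⟩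
      ∑ {len} (λ j → g (dart (toℕ j)))                                ∎
      where open ≡-Reasoning

    ∑-chain : ∀ (g : Fin D → ℤ) →
              ∑ (λ d → chain d * g d) ≡ ∑ {len} (λ j → g (dart (toℕ j)) - g (α (dart (toℕ j))))
    ∑-chain g = begin
      ∑ (λ d → chain d * g d)
        ≡⟨ ∑-cong (λ d → lem (multiplicity d) (multiplicity (α d)) (g d)) ⟩
      ∑ (λ d → multiplicity d * g d - multiplicity (α d) * g d)         ≡⟨ ∑-sub _ _ ⟩
      ∑ (λ d → multiplicity d * g d) - ∑ (λ d → multiplicity (α d) * g d)
        ≡⟨ cong (_-_ (∑ (λ d → multiplicity d * g d))) (trans
            (∑-cong (λ d → cong (λ e → multiplicity (α d) * g e) (sym (α-invol d)))) (∑-α (λ d → multiplicity d * g (α d)))) ⟩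
      ∑ (λ d → multiplicity d * g d) - ∑ (λ d → multiplicity d * g (α d))
        ≡⟨ cong₂ _-_ (∑-multiplicity g) (∑-multiplicity (g ∘ α)) ⟩
      ∑ (λ j → g (dart (toℕ j))) - ∑ {len} (λ j → g (α (dart (toℕ j)))) ≡⟨ sym (∑-sub _ _) ⟩
      ∑ {len} (λ j → g (dart (toℕ j)) - g (α (dart (toℕ j))))           ∎
      where
      open ≡-Reasoning
      lem : ∀ a b c → (a - b) * c ≡ a * c - b * c
      lem = solve-∀

    ∑-walk : ∀ (p : Fin nV → ℤ) → ∑ {len} (λ j → p (vert (α (dart (toℕ j)))) - p (vert (dart (toℕ j)))) ≡ 0ℤ
    ∑-walk p = begin
      ∑ {len} (λ j → p (vert (α (dart (toℕ j)))) - p (vert (dart (toℕ j))))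
        ≡⟨ ∑-cong (λ j → cong (λ v → p v - p (vert (dart (toℕ j)))) (link (toℕ j))) ⟩
      ∑ {len} (λ j → p (vert (dart (suc (toℕ j)))) - p (vert (dart (toℕ j))))
        ≡⟨ ∑-telescope len (λ j → p (vert (dart j))) ⟩
      p (vert (dart len)) - p (vert (dart 0))                                   ≡⟨ ℤₚ.i≡j⇒i-j≡0 (cong p closed) ⟩
      0ℤ                                                                        ∎
      where open ≡-Reasoning

    chain-coclosed : Coclosed chain
    chain-coclosed p = begin
      ∑ (λ d → chain d * p (vert d))                                          ≡⟨ ∑-chain (p ∘ vert) ⟩
      ∑ {len} (λ j → p (vert (dart (toℕ j))) - p (vert (α (dart (toℕ j)))))
        ≡⟨ ∑-cong (λ j → lem (p (vert (dart (toℕ j)))) (p (vert (α (dart (toℕ j)))))) ⟩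
      ∑ {len} (λ j → - 1ℤ * (p (vert (α (dart (toℕ j)))) - p (vert (dart (toℕ j)))))
        ≡⟨ ∑-*ˡ (- 1ℤ) (λ j → p (vert (α (dart (toℕ j)))) - p (vert (dart (toℕ j)))) ⟩
      - 1ℤ * ∑ {len} (λ j → p (vert (α (dart (toℕ j)))) - p (vert (dart (toℕ j))))     ≡⟨ cong (- 1ℤ *_) (∑-walk p) ⟩
      0ℤ                                                                      ∎
      where
      open ≡-Reasoning
      lem : ∀ a b → a - b ≡ - 1ℤ * (b - a)
      lem = solve-∀

    chain-off : ∀ d → (∀ j → dart j ≢ d) → (∀ j → dart j ≢ α d) → chain d ≡ 0ℤ
    chain-off d off off′ = cong₂ _-_ (∑-zero _ (λ j → 𝟙-no (dart (toℕ j) ≟ d) (off (toℕ j))))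
                                     (∑-zero _ (λ j → 𝟙-no (dart (toℕ j) ≟ α d) (off′ (toℕ j))))

  VertexDisjoint : ClosedWalk S → ClosedWalk S → Set
  VertexDisjoint W W′ = ∀ i j → vert (ClosedWalk.dart W i) ≢ vert (ClosedWalk.dart W′ j)

  coboundary : (Fin nV → ℤ) → Fin D → ℤ
  coboundary p d = p (vert (α d)) - p (vert d)

  boundary : (Fin nF → ℤ) → Fin D → ℤ
  boundary q d = q (face d) - q (face (α d))

  ∑-coclosed-coboundary : ∀ {x} → (∀ d → x (α d) ≡ - x d) → Coclosed x → ∀ p → ∑ (λ d → x d * coboundary p d) ≡ 0ℤ
  ∑-coclosed-coboundary {x} x-α x-coclosed p = begin
    ∑ (λ d → x d * coboundary p d)
      ≡⟨ ∑-cong (λ d → lem (x d) (p (vert (α d))) (p (vert d))) ⟩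
    ∑ (λ d → (- 1ℤ) * (- x d * p (vert (α d))) - x d * p (vert d))       ≡⟨ ∑-sub _ _ ⟩
    ∑ (λ d → (- 1ℤ) * (- x d * p (vert (α d)))) - ∑ (λ d → x d * p (vert d))
      ≡⟨ cong₂ _-_ (∑-*ˡ (- 1ℤ) _) (x-coclosed p) ⟩
    - 1ℤ * ∑ (λ d → - x d * p (vert (α d))) - 0ℤ
      ≡⟨ cong (λ t → - 1ℤ * t - 0ℤ) (trans (∑-cong (λ d → cong (_* p (vert (α d))) (sym (x-α d))))
          (trans (∑-α (λ d → x d * p (vert d))) (x-coclosed p))) ⟩
    0ℤ                                                                   ∎
    where
    open ≡-Reasoning
    lem : ∀ x a b → x * (a - b) ≡ (- 1ℤ) * (- x * a) - x * b
    lem = solve-∀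

  boundary-α : ∀ q d → boundary q (α d) ≡ - boundary q d
  boundary-α q d = trans (cong (λ e → q (face (α d)) - q (face e)) (α-invol d)) (lem (q (face (α d))) (q (face d)))
    where
    lem : ∀ a b → a - b ≡ - (b - a)
    lem = solve-∀

  -- The face to the left of `d` is the one to the right of `σ d`, so the terms telescope around
  -- each vertex.
  boundary-coclosed : ∀ q → Coclosed (boundary q)
  boundary-coclosed q p = begin
    ∑ (λ d → boundary q d * p (vert d))
      ≡⟨ ∑-cong (λ d → trans (lem (q (face d)) (q (face (α d))) (p (vert d)))
          (cong₂ (λ a b → q (face d) * p (vert d) - q a * p b) (sym (face-σ d)) (sym (vert-σ d)))) ⟩
    ∑ (λ d → q (face d) * p (vert d) - q (face (σ d)) * p (vert (σ d)))            ≡⟨ ∑-sub _ _ ⟩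
    ∑ (λ d → q (face d) * p (vert d)) - ∑ (λ d → q (face (σ d)) * p (vert (σ d)))
      ≡⟨ ℤₚ.i≡j⇒i-j≡0 (sym (∑-σ (λ d → q (face d) * p (vert d)))) ⟩
    0ℤ                                                                             ∎
    where
    open ≡-Reasoning
    lem : ∀ a b c → (a - b) * c ≡ a * c - b * c
    lem = solve-∀

-- Linear dependence of disjoint closed walks

unit : ∀ {u} → Fin u → Row u
unit k j = 𝟙 (k ≟ j)

infixl 6 _⊕_
infix 7 _·_

_⊕_ : ∀ {u} → Row u → Row u → Row u
(r ⊕ s) j = r j + s j

_·_ : ∀ {u} → ℤ → Row u → Row u
(a · r) j = a * r j

unit-∙ : ∀ {u} k (y : Row u) → unit k ∙ y ≡ y k
unit-∙ k y = ∑-δ k y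

⊕-∙ : ∀ {u} (r s y : Row u) → (r ⊕ s) ∙ y ≡ r ∙ y + s ∙ y
⊕-∙ r s y = trans (∑-cong (λ j → ℤₚ.*-distribʳ-+ (y j) (r j) (s j))) (∑-add _ _)

·-∙ : ∀ {u} a (r y : Row u) → (a · r) ∙ y ≡ a * (r ∙ y)
·-∙ a r y = trans (∑-cong (λ j → ℤₚ.*-assoc a (r j) (y j))) (∑-*ˡ a _)

·unit-∙ : ∀ {u} a k (y : Row u) → (a · unit k) ∙ y ≡ y k * a
·unit-∙ a k y = trans (·-∙ a (unit k) y) (trans (cong (a *_) (unit-∙ k y)) (ℤₚ.*-comm a (y k)))

∑-null-+ : ∀ {n} {f g : Fin n → ℤ} → ∑ f ≡ 0ℤ → ∑ g ≡ 0ℤ → ∑ (λ i → f i + g i) ≡ 0ℤ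
∑-null-+ f0 g0 = trans (∑-add _ _) (cong₂ _+_ f0 g0)

∑-null-* : ∀ {n} k {f : Fin n → ℤ} → ∑ f ≡ 0ℤ → ∑ (λ i → k * f i) ≡ 0ℤ
∑-null-* k f0 = trans (∑-*ˡ k _) (trans (cong (k *_) f0) (ℤₚ.*-zeroʳ k))

module _ {M : Map} {S : Surface M} where
  open Map M
  open Surface S

  module PushOff (W W′ : ClosedWalk S) (disjoint : VertexDisjoint W W′) where

    x x′ : Fin D → ℤ
    x = chain W
    x′ = chain W′

    open Primitive {chain W} (chain-coclosed W) using (primitive-at; primitive-jump; primitive-vanishes)

    u : Fin D → ℤ
    u = primitive-at

    -- The walk W pushed off to its side: the jumps of u along the edges.
    h : Fin D → ℤ
    h d = u (σ⁻ (α d)) - u d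

    -- Seen from either end, the jump of `u` from the right to the left side of an edge is the same,
    -- as `x` is antisymmetric. Hence the change of `u` along the edge may be read on either side,
    -- which gives `h-α`.
    quad : ∀ d → u d - u (σ⁻ d) ≡ u (σ⁻ (α d)) - u (α d)
    quad d = begin
      u d - u (σ⁻ d)               ≡⟨ primitive-jump d ⟩
      x d                          ≡⟨ trans (sym (ℤₚ.neg-involutive (x d))) (cong -_ (sym (chain-α W d))) ⟩
      - x (α d)                    ≡⟨ cong -_ (sym (primitive-jump (α d))) ⟩
      - (u (α d) - u (σ⁻ (α d)))   ≡⟨ lem (u (α d)) (u (σ⁻ (α d))) ⟩
      u (σ⁻ (α d)) - u (α d)       ∎
      where
      open ≡-Reasoning
      lem : ∀ a b → - (a - b) ≡ b - a
      lem = solve-∀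

    h-α : ∀ d → h (α d) ≡ - h d
    h-α d = trans (cong (λ e → u (σ⁻ e) - u (α d)) (α-invol d))
                  (lem (u d) (u (σ⁻ d)) (u (σ⁻ (α d))) (u (α d)) (quad d))
      where
      lem : ∀ a b c e → a - b ≡ c - e → b - e ≡ - (c - a)
      lem a b c e eq = trans (lem₁ a b e) (trans (cong (λ t → (a - e) - t) eq) (lem₂ a c e))
        where
        lem₁ : ∀ a b e → b - e ≡ (a - e) - (a - b)
        lem₁ = solve-∀
        lem₂ : ∀ a c e → (a - e) - (c - e) ≡ - (c - a)
        lem₂ = solve-∀

    -- `h d` is read on the left of `d`, and the left corner at the head of `d` is the starting
    -- corner of the next dart around that face: the terms telescope around each face.
    h-closed : ∀ (q : Fin nF → ℤ) → ∑ (λ d → h d * q (face (α d))) ≡ 0ℤ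
    h-closed q = begin
      ∑ (λ d → h d * q (face (α d)))
        ≡⟨ ∑-cong (λ d → lem (u (σ⁻ (α d))) (u d) (q (face (α d)))) ⟩
      ∑ (λ d → u (σ⁻ (α d)) * q (face (α d)) - u d * q (face (α d)))
        ≡⟨ ∑-sub _ _ ⟩
      ∑ (λ d → u (σ⁻ (α d)) * q (face (α d))) - ∑ (λ d → u d * q (face (α d)))
        ≡⟨ cong (_- ∑ (λ d → u d * q (face (α d)))) (trans (∑-α (λ d → u (σ⁻ d) * q (face d)))
            (trans (∑-cong (λ d → cong (λ f → u (σ⁻ d) * q f) (sym (face-σ⁻ d)))) (∑-σ⁻ (λ d → u d * q (face (α d)))))) ⟩
      ∑ (λ d → u d * q (face (α d))) - ∑ (λ d → u d * q (face (α d)))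
        ≡⟨ ℤₚ.+-inverseʳ (∑ (λ d → u d * q (face (α d)))) ⟩
      0ℤ ∎
      where
      open ≡-Reasoning
      lem : ∀ a b c → (a - b) * c ≡ a * c - b * c
      lem = solve-∀

    ∑-boundary-h : ∀ q → ∑ (λ d → boundary {S = S} q d * h d) ≡ 0ℤ
    ∑-boundary-h q = begin
      ∑ (λ d → boundary {S = S} q d * h d)
        ≡⟨ ∑-cong (λ d → trans (lem (q (face d)) (q (face (α d))) (h d))
            (cong₂ (λ a b → - 1ℤ * (a * q (face b)) + - 1ℤ * (h d * q (face (α d)))) (sym (h-α d)) (sym (α-invol d)))) ⟩
      ∑ (λ d → - 1ℤ * (h (α d) * q (face (α (α d)))) + - 1ℤ * (h d * q (face (α d))))
        ≡⟨ ∑-null-+ (∑-null-* (- 1ℤ) (trans (∑-α (λ d → h d * q (face (α d)))) (h-closed q))) (∑-null-* (- 1ℤ) (h-closed q)) ⟩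
      0ℤ ∎
      where
      open ≡-Reasoning
      lem : ∀ a b c → (a - b) * c ≡ - 1ℤ * (- c * a) + - 1ℤ * (c * b)
      lem = solve-∀

    -- Discrete Stokes formula for u²: both sums of squares over the four corners of an edge cancel.
    ∑-x-h : ∑ (λ d → x d * h d) ≡ 0ℤ
    ∑-x-h = [ (λ ()) , (λ eq → eq) ]′ (ℤₚ.i*j≡0⇒i≡0∨j≡0 (+ 2) (begin
      + 2 * ∑ (λ d → x d * h d)                  ≡⟨ sym (∑-*ˡ (+ 2) _) ⟩
      ∑ (λ d → + 2 * (x d * h d))                ≡⟨ ∑-cong pointwise ⟩
      ∑ (λ d → (sq (σ⁻ d) - sq d) + (sq (σ⁻ (α d)) - sq (α d)))
        ≡⟨ ∑-null-+ diff (trans (∑-α (λ d → sq (σ⁻ d) - sq d)) diff) ⟩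
      0ℤ                                         ∎))
      where
      open ≡-Reasoning
      sq : Fin D → ℤ
      sq d = u d * u d
      diff : ∑ (λ d → sq (σ⁻ d) - sq d) ≡ 0ℤ
      diff = trans (∑-sub _ _) (ℤₚ.i≡j⇒i-j≡0 (∑-σ⁻ sq))
      lem : ∀ a b c e → a - b ≡ c - e →
            + 2 * ((a - b) * (c - a)) ≡ (b * b - a * a) + (c * c - e * e)
      lem a b c e eq = trans (lem₁ a b c) (cong (λ t → (b * b - a * a) + (c * c - t * t)) (trans (cong (_-_ c) eq) (lem₂ c e)))
        where
        lem₁ : ∀ a b c → + 2 * ((a - b) * (c - a)) ≡ (b * b - a * a) + (c * c - (c - (a - b)) * (c - (a - b)))
        lem₁ = solve-∀
        lem₂ : ∀ c e → c - (c - e) ≡ e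
        lem₂ = solve-∀
      pointwise : ∀ d → + 2 * (x d * h d) ≡ (sq (σ⁻ d) - sq d) + (sq (σ⁻ (α d)) - sq (α d))
      pointwise d = trans (cong (λ t → + 2 * (t * h d)) (sym (primitive-jump d)))
                          (lem (u d) (u (σ⁻ d)) (u (σ⁻ (α d))) (u (α d)) (quad d))

    u-off : ∀ d → (∀ j → vert (ClosedWalk.dart W j) ≢ vert d) → u d ≡ 0ℤ
    u-off d off = primitive-vanishes (vert d) x≡0 d refl
      where
      x≡0 : ∀ e → vert e ≡ vert d → x e ≡ 0ℤ
      x≡0 e eq = chain-off W e (λ j eq′ → off j (trans (cong vert eq′) eq))
        (λ j eq′ → off (suc j) (trans (sym (ClosedWalk.link W j))
            (trans (cong (vert ∘ α) eq′) (trans (cong vert (α-invol e)) eq))))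

    -- `u` vanishes at every vertex that `W` avoids, in particular along `W′`. This is where
    -- disjointness enters.
    ∑-x′-h : ∑ (λ d → x′ d * h d) ≡ 0ℤ
    ∑-x′-h = trans (∑-chain W′ h) (∑-zero _ (λ j → trans (cong (_-_ (h (dart (toℕ j)))) (h-α (dart (toℕ j))))
        (cong (λ t → t - - t) (h≡0 (toℕ j)))))
      where
      open ClosedWalk W′
      h≡0 : ∀ j → h (dart j) ≡ 0ℤ
      h≡0 j = cong₂ _-_
        (u-off _ (λ i eq → disjoint i (suc j) (trans eq (trans (vert-σ⁻ _) (link j)))))
        (u-off _ (λ i → disjoint i j))

    module _ (c : ℤ) (p : Fin nV → ℤ) (c-exact : ∀ d → c * h d ≡ coboundary {S = S} p d) where

      private
        y : Fin D → ℤ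
        y d = c * u d - p (vert d)

        y-face : ∀ d → y (σ⁻ (α d)) ≡ y d
        y-face d = begin
          c * u (σ⁻ (α d)) - p (vert (σ⁻ (α d)))        ≡⟨ cong (λ v → c * u (σ⁻ (α d)) - p v) (vert-σ⁻ (α d)) ⟩
          c * u (σ⁻ (α d)) - p (vert (α d))             ≡⟨ lem₁ c (u (σ⁻ (α d))) (u d) (p (vert (α d))) ⟩
          c * h d + c * u d - p (vert (α d))            ≡⟨ cong (λ t → t + c * u d - p (vert (α d))) (c-exact d) ⟩
          coboundary {S = S} p d + c * u d - p (vert (α d))     ≡⟨ lem₂ (p (vert (α d))) (p (vert d)) (c * u d) ⟩
          y d                                           ∎
          where
          open ≡-Reasoning
          lem₁ : ∀ c a b e → c * a - e ≡ c * (a - b) + c * b - e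
          lem₁ = solve-∀
          lem₂ : ∀ a b e → a - b + e - a ≡ e - b
          lem₂ = solve-∀

        y-φ : ∀ d → y (α (φ d)) ≡ y (α d)
        y-φ d = trans (sym (y-face (α (φ d)))) (cong y (trans (cong σ⁻ (α-invol (φ d))) (σ⁻σ (α d))))

        q : Fin nF → ℤ
        q f = - y (α (repF f))

        q-face : ∀ d → q (face d) ≡ - y (α d)
        q-face d = cong -_ (φ-invariant (y ∘ α) y-φ (proj₂ (face-onto (face d))))

      -- Subtracting `p` from `c * u` cancels the jumps along the edges, so the corner function `y`
      -- depends on the face alone. Across a dart it still jumps by `c * x d`, since `p` agrees on
      -- corners of one vertex. The sign of `q` is due to `u` jumping from right to left.
      bounds : ∃ λ q → ∀ d → c * x d ≡ boundary {S = S} q d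
      bounds = q , λ d → begin
        c * x d                               ≡⟨ cong (c *_) (sym (primitive-jump d)) ⟩
        c * (u d - u (σ⁻ d))                  ≡⟨ lem c (u d) (u (σ⁻ d)) (p (vert d)) ⟩
        y d - (c * u (σ⁻ d) - p (vert d))     ≡⟨ cong (λ v → y d - (c * u (σ⁻ d) - p v)) (sym (vert-σ⁻ d)) ⟩
        y d - y (σ⁻ d)                        ≡⟨ lem′ (y d) (y (σ⁻ d)) ⟩
        - y (σ⁻ d) - - y d
          ≡⟨ cong₂ _-_ (trans (cong (λ e → - y e) (sym (α-invol (σ⁻ d))))
              (trans (sym (q-face (φ⁻ d))) (cong q (face-φ⁻ d))))
              (trans (cong (λ e → - y e) (sym (α-invol d))) (sym (q-face (α d)))) ⟩
        boundary {S = S} q d                          ∎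
        where
        open ≡-Reasoning
        lem : ∀ c a b e → c * (a - b) ≡ (c * a - e) - (c * b - e)
        lem = solve-∀
        lem′ : ∀ a b → a - b ≡ - b - - a
        lem′ = solve-∀

    unknowns : ℕ
    unknowns = 3 ℕ.+ (nV ℕ.+ nF)

    k-m k-n k-c : Fin unknowns
    k-m = zero
    k-n = suc zero
    k-c = suc (suc zero)

    k-p : Fin nV → Fin unknowns
    k-p v = 3 ↑ʳ (v ↑ˡ nF)

    k-q : Fin nF → Fin unknowns
    k-q f = 3 ↑ʳ (nV ↑ʳ f)

    row : Fin D → Row unknowns
    row d = x d · unit k-m ⊕ x′ d · unit k-n ⊕ h d · unit k-c
          ⊕ (- 1ℤ) · unit (k-q (face d)) ⊕ 1ℤ · unit (k-q (face (α d)))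
          ⊕ (- 1ℤ) · unit (k-p (vert (α d))) ⊕ 1ℤ · unit (k-p (vert d))

    equation : ℤ → ℤ → ℤ → (Fin nV → ℤ) → (Fin nF → ℤ) → Fin D → ℤ
    equation m n c p q d = m * x d + n * x′ d + c * h d - boundary {S = S} q d - coboundary {S = S} p d

    row-∙ : ∀ d y → row d ∙ y ≡ equation (y k-m) (y k-n) (y k-c) (y ∘ k-p) (y ∘ k-q) d
    row-∙ d y = begin
      row d ∙ y
        ≡⟨ split (x d · unit k-m ⊕ x′ d · unit k-n ⊕ h d · unit k-c ⊕ (- 1ℤ) · unit (k-q (face d)) ⊕ 1ℤ · unit
            (k-q (face (α d))) ⊕ (- 1ℤ) · unit (k-p (vert (α d)))) 1ℤ (k-p (vert d))
                (split (x d · unit k-m ⊕ x′ d · unit k-n ⊕ h d · unit k-c ⊕ (- 1ℤ) · unit (k-q (face d)) ⊕ 1ℤ · unit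
                    (k-q (face (α d)))) (- 1ℤ) (k-p (vert (α d)))
                (split (x d · unit k-m ⊕ x′ d · unit k-n ⊕ h d · unit k-c ⊕ (- 1ℤ) · unit (k-q (face d))) 1ℤ (k-q (face (α d)))
                (split (x d · unit k-m ⊕ x′ d · unit k-n ⊕ h d · unit k-c) (- 1ℤ) (k-q (face d))
                (split (x d · unit k-m ⊕ x′ d · unit k-n) (h d) k-c
                (split (x d · unit k-m) (x′ d) k-n
                (·unit-∙ (x d) k-m y)))))) ⟩
      _
        ≡⟨ lem (y k-m * x d + y k-n * x′ d + y k-c * h d) (y (k-q (face d))) (y (k-q (face (α d))))
            (y (k-p (vert (α d)))) (y (k-p (vert d))) ⟩
      equation (y k-m) (y k-n) (y k-c) (y ∘ k-p) (y ∘ k-q) d ∎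
      where
      open ≡-Reasoning
      split : ∀ r a k {t} → r ∙ y ≡ t → (r ⊕ a · unit k) ∙ y ≡ t + y k * a
      split r a k eq = trans (⊕-∙ r (a · unit k) y) (cong₂ _+_ eq (·unit-∙ a k y))
      lem : ∀ t a b e f → t + a * (- 1ℤ) + b * 1ℤ + e * (- 1ℤ) + f * 1ℤ ≡ t - (a - b) - (e - f)
      lem = solve-∀

    equation-α : ∀ m n c p q d → equation m n c p q (α d) ≡ - equation m n c p q d
    equation-α m n c p q d = trans
      (cong₂ _-_ (cong₂ _-_ (cong₂ _+_ (cong₂ _+_ (negate m (chain-α W d)) (negate n (chain-α W′ d))) (negate c (h-α d)))
                            (boundary-α {S = S} q d))
                 (cong (λ e → p (vert e) - p (vert (α d))) (α-invol d)))
      (lem (m * x d) (n * x′ d) (c * h d) (boundary {S = S} q d) (p (vert d)) (p (vert (α d))))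
      where
      negate : ∀ k {a b} → a ≡ - b → k * a ≡ - (k * b)
      negate k {b = b} eq = trans (cong (k *_) eq) (sym (ℤₚ.neg-distribʳ-* k b))
      lem : ∀ a b e f g i → - a + - b + - e - - f - (g - i) ≡ - (a + b + e - f - (i - g))
      lem = solve-∀

    v₀ : Fin nV
    v₀ = vert (ClosedWalk.dart W 0)

    f₀ : Fin nF
    f₀ = face (ClosedWalk.dart W 0)

    -- Two rows pin `p` and `q` at a base vertex and a base face, to exclude constants, which solve
    -- every edge equation. One row per edge is enough because the equation is antisymmetric. With
    -- `nV + nF` edges there is one more unknown than rows.
    system : Fin (2 ℕ.+ length edges) → Row unknowns
    system zero = unit (k-p v₀)
    system (suc zero) = unit (k-q f₀)
    system (suc (suc i)) = row (List.lookup edges i)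

    record Solution : Set where
      field
        m n c : ℤ
        p     : Fin nV → ℤ
        q     : Fin nF → ℤ
        p₀    : p v₀ ≡ 0ℤ
        q₀    : q f₀ ≡ 0ℤ
        solves : ∀ d → equation m n c p q d ≡ 0ℤ
        nontrivial : m ≡ 0ℤ → n ≡ 0ℤ → c ≡ 0ℤ → (∀ v → p v ≡ 0ℤ) → (∀ f → q f ≡ 0ℤ) → ⊥

    from-vector : ∀ y → (∃ λ k → y k ≢ 0ℤ) → (∀ i → system i ∙ y ≡ 0ℤ) → Solution
    from-vector y (k , yk≢0) sol = record
      { m = y k-m ; n = y k-n ; c = y k-c ; p = y ∘ k-p ; q = y ∘ k-q
      ; p₀ = trans (sym (unit-∙ (k-p v₀) y)) (sol zero)
      ; q₀ = trans (sym (unit-∙ (k-q f₀) y)) (sol (suc zero))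
      ; solves = solves
      ; nontrivial = λ m≡0 n≡0 c≡0 p≡0 q≡0 → yk≢0 (all-zero k m≡0 n≡0 c≡0 p≡0 q≡0)
      }
      where
      eqn = equation (y k-m) (y k-n) (y k-c) (y ∘ k-p) (y ∘ k-q)
      at-edge : ∀ i → eqn (List.lookup edges i) ≡ 0ℤ
      at-edge i = trans (sym (row-∙ (List.lookup edges i) y)) (sol (suc (suc i)))
      solves : ∀ d → eqn d ≡ 0ℤ
      solves d with edges-cover d
      ... | i , inj₁ eq = subst (λ e → eqn e ≡ 0ℤ) eq (at-edge i)
      ... | i , inj₂ eq = begin
        eqn d             ≡⟨ cong eqn (sym (α-invol d)) ⟩
        eqn (α (α d))     ≡⟨ equation-α (y k-m) (y k-n) (y k-c) (y ∘ k-p) (y ∘ k-q) (α d) ⟩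
        - eqn (α d)       ≡⟨ cong -_ (subst (λ e → eqn e ≡ 0ℤ) eq (at-edge i)) ⟩
        0ℤ                ∎
        where open ≡-Reasoning
      all-zero : ∀ k → y k-m ≡ 0ℤ → y k-n ≡ 0ℤ → y k-c ≡ 0ℤ → (∀ v → y (k-p v) ≡ 0ℤ) → (∀ f → y (k-q f) ≡ 0ℤ) → y k ≡ 0ℤ
      all-zero zero m≡0 _ _ _ _ = m≡0
      all-zero (suc zero) _ n≡0 _ _ _ = n≡0
      all-zero (suc (suc zero)) _ _ c≡0 _ _ = c≡0
      all-zero (suc (suc (suc k))) _ _ _ p≡0 q≡0 with splitAt nV k | join-splitAt nV nF k
      ... | inj₁ v | eq = trans (cong (λ t → y (3 ↑ʳ t)) (sym eq)) (p≡0 v)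
      ... | inj₂ f | eq = trans (cong (λ t → y (3 ↑ʳ t)) (sym eq)) (q≡0 f)

    few-equations : 2 ℕ.+ length edges ℕ.< unknowns
    few-equations = ℕₚ.≤-reflexive (cong (3 ℕ.+_) length-edges)

    abstract
      solution : Solution
      solution = let y , y≢0 , sol = nontrivial-solution system few-equations in from-vector y y≢0 sol

    module _ (sol : Solution) where
      open Solution sol

      private
        z z′ : Fin D → ℤ
        z d = m * x d + n * x′ d - boundary {S = S} q d
        z′ d = coboundary {S = S} p d - c * h d

        z≡z′ : ∀ d → z d ≡ z′ d
        z≡z′ d = ℤₚ.i-j≡0⇒i≡j _ _ (trans (lem (m * x d) (n * x′ d) (c * h d) (boundary {S = S} q d)
            (coboundary {S = S} p d)) (solves d))
          where
          lem : ∀ a b e f g → (a + b - f) - (g - e) ≡ a + b + e - f - g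
          lem = solve-∀

        ∑-*-z′ : ∀ {w : Fin D → ℤ} → ∑ (λ d → w d * coboundary {S = S} p d) ≡ 0ℤ → ∑ (λ d → w d * h d) ≡ 0ℤ →
                 ∑ (λ d → w d * z′ d) ≡ 0ℤ
        ∑-*-z′ {w} wp wh = trans (∑-cong (λ d → lem (w d) (coboundary {S = S} p d) c (h d)))
                                 (∑-null-+ wp (∑-null-* (- c) wh))
          where
          lem : ∀ w k c h → w * (k - c * h) ≡ w * k + - c * (w * h)
          lem = solve-∀

        -- Writing one factor as `z′` leaves the six pairings of `x`, `x′` and the boundary of `q`
        -- with the coboundary of `p` and with `h`, each of which is zero.
        ∑z²≡0 : ∑ (λ d → z d * z d) ≡ 0ℤ
        ∑z²≡0 = begin
          ∑ (λ d → z d * z d)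
            ≡⟨ ∑-cong (λ d → trans (cong (z d *_) (z≡z′ d)) (lem m (x d) n (x′ d) (boundary {S = S} q d) (z′ d))) ⟩
          ∑ (λ d → m * (x d * z′ d) + n * (x′ d * z′ d) + - 1ℤ * (boundary {S = S} q d * z′ d))
            ≡⟨ ∑-null-+ (∑-null-+
                 (∑-null-* m (∑-*-z′ {x} (∑-coclosed-coboundary {S = S} {x} (chain-α W) (chain-coclosed W) p) ∑-x-h))
                 (∑-null-* n (∑-*-z′ {x′} (∑-coclosed-coboundary {S = S} {x′} (chain-α W′) (chain-coclosed W′) p) ∑-x′-h)))
                 (∑-null-* (- 1ℤ) (∑-*-z′ {boundary {S = S} q}
                     (∑-coclosed-coboundary {S = S} {boundary {S = S} q} (boundary-α {S = S} q)
                     (boundary-coclosed {S = S} q) p) (∑-boundary-h q))) ⟩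
          0ℤ ∎
          where
          open ≡-Reasoning
          lem : ∀ m x n x′ b w → (m * x + n * x′ - b) * w ≡ m * (x * w) + n * (x′ * w) + - 1ℤ * (b * w)
          lem = solve-∀

        z≡0 : ∀ d → z d ≡ 0ℤ
        z≡0 d = [ (λ eq → eq) , (λ eq → eq) ]′ (ℤₚ.i*j≡0⇒i≡0∨j≡0 (z d) (∑-nonneg-zero _ (λ d → 0≤i*i (z d)) ∑z²≡0 d))

      combination-bounds : ∀ d → m * x d + n * x′ d ≡ boundary {S = S} q d
      combination-bounds d = ℤₚ.i-j≡0⇒i≡j _ _ (z≡0 d)

      pushoff-exact : ∀ d → c * h d ≡ coboundary {S = S} p d
      pushoff-exact d = sym (ℤₚ.i-j≡0⇒i≡j _ _ (trans (sym (z≡z′ d)) (z≡0 d)))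

      degenerate : m ≡ 0ℤ → n ≡ 0ℤ → c ≢ 0ℤ
      degenerate refl refl refl = nontrivial refl refl refl p≡0 q≡0
        where
        q-step : ∀ d → q (face d) ≡ q (face (α d))
        q-step d = ℤₚ.i-j≡0⇒i≡j _ _ (trans (sym (combination-bounds d)) (lem (x d) (x′ d)))
          where
          lem : ∀ a b → 0ℤ * a + 0ℤ * b ≡ 0ℤ
          lem = solve-∀
        p-step : ∀ d → p (vert (α d)) ≡ p (vert d)
        p-step d = ℤₚ.i-j≡0⇒i≡j _ _ (trans (sym (pushoff-exact d)) (ℤₚ.*-zeroˡ (h d)))
        q≡0 : ∀ f → q f ≡ 0ℤ
        q≡0 f = trans (cong q (sym (proj₂ (face-onto f)))) (trans
          (Step-invariant (q ∘ face) (λ d → trans (cong q (face-σ d)) (sym (q-step d))) (λ d → sym (q-step d)) _ _) q₀)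
        p≡0 : ∀ v → p v ≡ 0ℤ
        p≡0 v = trans (cong p (sym (proj₂ (vert-onto v)))) (trans
          (Step-invariant (p ∘ vert) (λ d → cong p (vert-σ d)) p-step _ _) p₀)

    Dependent : Set
    Dependent = ∃₂ λ m n → ∃ λ q → (m ≢ 0ℤ ⊎ n ≢ 0ℤ) × (∀ d → m * x d + n * x′ d ≡ boundary {S = S} q d)

    -- If `m` and `n` both vanish, then `c` does not, and a nonzero multiple of the push-off is
    -- exact. By `bounds` the walk `W` is then dependent on its own.
    dependent : (sol : Solution) → Dec (Solution.m sol ≡ 0ℤ) → Dec (Solution.n sol ≡ 0ℤ) → Dependent
    dependent sol (no m≢0) _ = m , n , q , inj₁ m≢0 , combination-bounds sol
      where open Solution sol
    dependent sol (yes _) (no n≢0) = m , n , q , inj₂ n≢0 , combination-bounds sol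
      where open Solution sol
    dependent sol (yes m≡0) (yes n≡0) =
      c , 0ℤ , proj₁ b , inj₁ (degenerate sol m≡0 n≡0) , λ d → trans (lem (c * x d) (x′ d)) (proj₂ b d)
      where
      open Solution sol
      b : ∃ λ q → ∀ d → c * x d ≡ boundary {S = S} q d
      b = bounds c p (pushoff-exact sol)
      lem : ∀ a b → a + 0ℤ * b ≡ a
      lem = solve-∀

  -- First homology has rank 2: disjoint closed walks are linearly dependent.  The witness comes from
  -- a linear system with one more unknown than equations, whose solutions split by a Hodge argument:
  -- a vector that is both closed and coclosed and orthogonal to itself vanishes.
  abstract
    disjoint⇒dependent : (W W′ : ClosedWalk S) → VertexDisjoint W W′ →
      ∃₂ λ m n → ∃ λ q → (m ≢ 0ℤ ⊎ n ≢ 0ℤ) × (∀ d → m * chain W d + n * chain W′ d ≡ boundary {S = S} q d)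
    disjoint⇒dependent W W′ disjoint = dependent solution (Solution.m solution ℤₚ.≟ 0ℤ) (Solution.n solution ℤₚ.≟ 0ℤ)
      where open PushOff W W′ disjoint

-- Angle labellings

Colour : Set
Colour = Fin 3

pattern 0F = zero
pattern 1F = suc zero
pattern 2F = suc (suc zero)

prev-next : ∀ c → prev3 (next3 c) ≡ c
prev-next 0F = refl
prev-next 1F = refl
prev-next 2F = refl

next-prev : ∀ c → next3 (prev3 c) ≡ c
next-prev 0F = refl
next-prev 1F = refl
next-prev 2F = refl

next-next : ∀ c → next3 (next3 c) ≡ prev3 c
next-next 0F = refl
next-next 1F = refl
next-next 2F = refl

prev-prev : ∀ c → prev3 (prev3 c) ≡ next3 c
prev-prev 0F = refl
prev-prev 1F = refl
prev-prev 2F = refl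

next≢ : ∀ c → next3 c ≢ c
next≢ 0F ()
next≢ 1F ()
next≢ 2F ()

prev≢ : ∀ c → prev3 c ≢ c
prev≢ 0F ()
prev≢ 1F ()
prev≢ 2F ()

next≢prev : ∀ c → next3 c ≢ prev3 c
next≢prev 0F ()
next≢prev 1F ()
next≢prev 2F ()

prev-injective : ∀ {c c′} → prev3 c ≡ prev3 c′ → c ≡ c′
prev-injective {c} {c′} eq = trans (sym (next-prev c)) (trans (cong next3 eq) (next-prev c′))

colour-cases : ∀ c c′ → c′ ≡ c ⊎ c′ ≡ next3 c ⊎ c′ ≡ prev3 c
colour-cases 0F 0F = inj₁ refl
colour-cases 0F 1F = inj₂ (inj₁ refl)
colour-cases 0F 2F = inj₂ (inj₂ refl)
colour-cases 1F 0F = inj₂ (inj₂ refl)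
colour-cases 1F 1F = inj₁ refl
colour-cases 1F 2F = inj₂ (inj₁ refl)
colour-cases 2F 0F = inj₂ (inj₁ refl)
colour-cases 2F 1F = inj₂ (inj₂ refl)
colour-cases 2F 2F = inj₁ refl

nothing≢just : ∀ {A : Set} {m : Maybe A} {a} → m ≡ nothing → m ≢ just a
nothing≢just refl ()

just-unique : ∀ {A : Set} {m : Maybe A} {a b} → m ≡ just a → m ≡ just b → a ≡ b
just-unique refl refl = refl

module _ {M : Map} (S : Surface M) (out : Fin (Map.D M) → Maybe Colour) where
  open Map M
  open Surface S

  -- A Schnyder wood seen through its angle labelling: ℓ d labels the corner between d and σ d.
  -- The corners labelled c form the sector between the outgoing edges of colours c + 1 and c − 1.
  record AngleLabelling : Set where
    field
      ℓ          : Fin D → Colour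
      ℓ-out      : ∀ {d c} → out d ≡ just c → ℓ d ≡ prev3 c
      ℓ-before   : ∀ {d c} → out d ≡ just c → ℓ (σ⁻ d) ≡ next3 c
      ℓ-none     : ∀ {d} → out d ≡ nothing → ℓ d ≡ ℓ (σ⁻ d)
      ℓ-in       : ∀ {d c} → out d ≡ nothing → out (α d) ≡ just c → ℓ d ≡ c
      oriented   : ∀ {d} → out d ≡ nothing → out (α d) ≢ nothing
      bidistinct : ∀ {d c} → out d ≡ just c → out (α d) ≢ just c

  record OutDarts : Set where
    field
      e        : Colour → Fin nV → Fin D
      vert-e   : ∀ c v → vert (e c v) ≡ v
      out-e    : ∀ c v → out (e c v) ≡ just c
      e-unique : ∀ {d c} → out d ≡ just c → d ≡ e c (vert d)

    e-unique′ : ∀ {d c v} → out d ≡ just c → vert d ≡ v → d ≡ e c v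
    e-unique′ out≡ refl = e-unique out≡

    e-colour : ∀ {c c′ v} → e c v ≡ e c′ v → c ≡ c′
    e-colour {c} {c′} {v} eq = just-unique (out-e c v) (trans (cong out eq) (out-e c′ v))

    successor : Colour → Fin nV → Fin nV
    successor c v = vert (α (e c v))

    -- With one outgoing dart per colour, monochromatic cycles are periodic orbits of `successor c`.
    -- The period need not be minimal.
    OnCycle : Colour → Fin nV → Set
    OnCycle c v = ∃ λ L → iter (successor c) (suc L) v ≡ v

    OnCycle-iter : ∀ {c v} n → OnCycle c v → OnCycle c (iter (successor c) n v)
    OnCycle-iter {c} {v} n (L , eq) = L , (begin
      iter s (suc L) (iter s n v)      ≡⟨ sym (iter-+ s (suc L) n v) ⟩
      iter s (suc L ℕ.+ n) v           ≡⟨ cong (λ k → iter s k v) (ℕₚ.+-comm (suc L) n) ⟩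
      iter s (n ℕ.+ suc L) v           ≡⟨ iter-+ s n (suc L) v ⟩
      iter s n (iter s (suc L) v)      ≡⟨ cong (iter s n) eq ⟩
      iter s n v                       ∎)
      where
      open ≡-Reasoning
      s = successor c

    CyclesMeet : Set
    CyclesMeet = ∀ c c′ v → c′ ≢ c → OnCycle c v → ∃ λ n → OnCycle c′ (iter (successor c) n v)

module SectorInduction {M : Map} {S : Surface M} {out : Fin (Map.D M) → Maybe Colour}
                       (A : AngleLabelling S out) (O : OutDarts S out) where
  open Map M
  open Surface S
  open AngleLabelling A
  open OutDarts O

  -- Turning clockwise, the label changes only at outgoing darts, and an outgoing dart whose own
  -- corner is labelled `l` has colour `next3 l`. The distance `k` along the orbit only bounds the
  -- recursion.
  backward-induction : ∀ (P : Fin D → Set) l v → P (e (next3 l) v) →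
    (∀ w → vert w ≡ v → out w ≡ nothing → ℓ w ≡ l → P (σ⁻ w) → P w) →
    ∀ w → vert w ≡ v → ℓ w ≡ l → P w
  backward-induction P l v base step w vert≡ ℓ≡
    with k , eq ← vert-orbit (e (next3 l) v) w (trans (vert-e _ v) (sym vert≡)) = go k w eq vert≡ ℓ≡
    where
    go : ∀ k w → iter σ k (e (next3 l) v) ≡ w → vert w ≡ v → ℓ w ≡ l → P w
    go zero w refl _ _ = base
    go (suc k) w eq vert≡ ℓ≡ with out w in out≡
    ... | just c = subst P (sym (trans (e-unique′ out≡ vert≡) (cong (λ c → e c v) c≡))) base
      where
      c≡ : c ≡ next3 l
      c≡ = trans (sym (next-prev c)) (cong next3 (trans (sym (ℓ-out out≡)) ℓ≡))
    ... | nothing = step w vert≡ out≡ ℓ≡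
      (go k (σ⁻ w) (trans (sym (σ⁻σ _)) (cong σ⁻ eq)) (trans (vert-σ⁻ w) vert≡) (trans (sym (ℓ-none out≡)) ℓ≡))

  forward-induction : ∀ (P : Fin D → Set) l v → P (σ⁻ (e (prev3 l) v)) →
    (∀ w → vert w ≡ v → out (σ w) ≡ nothing → ℓ w ≡ l → P (σ w) → P w) →
    ∀ w → vert w ≡ v → ℓ w ≡ l → P w
  forward-induction P l v base step w vert≡ ℓ≡
    with k , eq ← vert-orbit w (e (prev3 l) v) (trans vert≡ (sym (vert-e _ v))) = go k w eq vert≡ ℓ≡
    where
    go : ∀ k w → iter σ k w ≡ e (prev3 l) v → vert w ≡ v → ℓ w ≡ l → P w
    go zero w refl _ ℓ≡ =
      contradiction (trans (sym (prev-prev l)) (trans (sym (ℓ-out (out-e (prev3 l) v))) ℓ≡)) (next≢ l)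
    go (suc k) w eq vert≡ ℓ≡ with out (σ w) in out≡
    ... | just c = subst P (trans (cong σ⁻ (sym σw≡)) (σ⁻σ w)) base
      where
      c≡ : c ≡ prev3 l
      c≡ = trans (sym (prev-next c)) (cong prev3 (trans (sym (ℓ-before out≡)) (trans (cong ℓ (σ⁻σ w)) ℓ≡)))
      σw≡ : σ w ≡ e (prev3 l) v
      σw≡ = e-unique′ (subst (λ c → out (σ w) ≡ just c) c≡ out≡) (trans (vert-σ w) vert≡)
    ... | nothing = step w vert≡ out≡ ℓ≡
      (go k (σ w) (trans (iter-comm σ k w) eq) (trans (vert-σ w) vert≡)
        (trans (ℓ-none out≡) (trans (cong ℓ (σ⁻σ w)) ℓ≡)))

  sector : ∀ l v w → vert w ≡ v → ℓ w ≡ l →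
           ∃ λ k → iter σ k (e (next3 l) v) ≡ w × (∀ j → j ℕ.≤ k → ℓ (iter σ j (e (next3 l) v)) ≡ l)
  sector l v = backward-induction _ l v
    (0 , refl , λ { _ z≤n → trans (ℓ-out (out-e (next3 l) v)) (prev-next l) })
    λ { w _ _ ℓ≡ (k , eq , labels) → suc k , trans (cong σ eq) (σσ⁻ w) , extend w k ℓ≡ eq labels }
    where
    extend : ∀ w k → ℓ w ≡ l → iter σ k (e (next3 l) v) ≡ σ⁻ w →
             (∀ j → j ℕ.≤ k → ℓ (iter σ j (e (next3 l) v)) ≡ l) →
             ∀ j → j ℕ.≤ suc k → ℓ (iter σ j (e (next3 l) v)) ≡ l
    extend w k ℓ≡ eq labels j j≤1+k with ℕₚ.m≤n⇒m<n∨m≡n j≤1+k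
    ... | inj₁ (s≤s j≤k) = labels j j≤k
    ... | inj₂ refl = trans (cong ℓ (trans (cong σ eq) (σσ⁻ w))) ℓ≡

module _ {M : Map} (S : Surface M) (col : Colouring M) where
  open Map M
  open Surface S

  private
    o : Fin D → Maybe Colour
    o = out M col

  module _ (O : OutDarts S o) where
    open OutDarts O

    MonoCycle⇒iter : ∀ {c} (C : MonoCycle M col c) → ∀ j →
      iter (successor c) (toℕ j) (vert (MonoCycle.cyc C zero)) ≡ vert (MonoCycle.cyc C j)
    MonoCycle⇒iter {c} C = <-weakInduction _ refl λ i eq →
      trans (cong (successor c) (trans (cong (λ k → iter (successor c) k _) (sym (toℕ-inject₁ i))) eq)) (next i)
      where
      open MonoCycle C
      next : ∀ i → successor c (vert (cyc (inject₁ i))) ≡ vert (cyc (suc i))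
      next i = trans (cong (vert ∘ α) (sym (e-unique (colour _)))) (SameVertex⇒≡ (link i))

    MonoCycle-close : ∀ {c} (C : MonoCycle M col c) →
      successor c (vert (MonoCycle.cyc C (fromℕ (MonoCycle.len C)))) ≡ vert (MonoCycle.cyc C zero)
    MonoCycle-close C = trans (cong (vert ∘ α) (sym (e-unique (colour _)))) (SameVertex⇒≡ close)
      where open MonoCycle C

    MonoCycle⇒OnCycle : ∀ {c} (C : MonoCycle M col c) → ∀ j → OnCycle c (vert (MonoCycle.cyc C j))
    MonoCycle⇒OnCycle {c} C j = subst (OnCycle c) (MonoCycle⇒iter C j) (OnCycle-iter (toℕ j) (len ,
      trans (cong (successor c) (trans (cong (λ k → iter (successor c) k (vert (cyc zero))) (sym (toℕ-fromℕ len)))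
          (MonoCycle⇒iter C (fromℕ len))))
            (MonoCycle-close C)))
      where open MonoCycle C

    iter⇒MonoCycle : ∀ {c} (C : MonoCycle M col c) → ∀ n →
      ∃ λ j → vert (MonoCycle.cyc C j) ≡ iter (successor c) n (vert (MonoCycle.cyc C zero))
    iter⇒MonoCycle C zero = zero , refl
    iter⇒MonoCycle {c} C (suc n) with iter⇒MonoCycle C n
    ... | j , eq with view j
    ... | ‵fromℕ = zero , trans (sym (MonoCycle-close C)) (cong (successor c) eq)
    ... | ‵inject₁ i = suc i , trans (sym (SameVertex⇒≡ (link i)))
        (trans (cong (vert ∘ α) (e-unique (colour (inject₁ i)))) (cong (successor c) eq))
      where open MonoCycle C

    OnCycle⇒MonoCycle : ∀ {c v} → OnCycle c v → Σ (MonoCycle M col c) λ C →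
      ∀ j → vert (MonoCycle.cyc C j) ≡ iter (successor c) (toℕ j) v
    OnCycle⇒MonoCycle {c} {v} (L , eq) = record
      { len = L
      ; cyc = λ j → e c (at (toℕ j))
      ; colour = λ j → out-e c _
      ; link = λ j → vert-orbit _ _ (trans (cong (λ k → successor c (at k)) (toℕ-inject₁ j)) (sym (vert-e c _)))
      ; close = vert-orbit _ _ (trans (cong (λ k → successor c (at k)) (toℕ-fromℕ L)) (trans eq (sym (vert-e c v))))
      } , λ j → vert-e c _
      where
      at : ℕ → Fin nV
      at k = iter (successor c) k v

  module _ (A : AngleLabelling S o) (O : OutDarts S o) (meet : OutDarts.CyclesMeet O) where
    open AngleLabelling A
    open OutDarts O
    open SectorInduction A O

    labelling⇒wood : IsSchnyderWood M col
    labelling⇒wood = record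
      { oriented = λ d → oriented
      ; bidistinct = λ d i → bidistinct
      ; out-exists = λ d i → e i (vert d) , vert-orbit _ _ (sym (vert-e i (vert d))) , out-e i (vert d)
      ; out-unique = λ d d′ i same out≡ out≡′ →
          trans (e-unique out≡) (trans (cong (e i) (SameVertex⇒≡ same)) (sym (e-unique out≡′)))
      ; ccw-order = ccw
      ; entering = entering
      ; T2 = λ i C → meets i (prev3 i) (prev≢ i) C , meets i (next3 i) (next≢ i) C
      }
      where
      -- For an outgoing dart `d` at the far end of the closed sector, the corner of `d` carries the
      -- next label. The search therefore goes to the corner before `d` and takes one more step.
      sector-before : ∀ a b d l → out M col a ≡ just (next3 l) → ℓ b ≢ l → ℓ (σ⁻ d) ≡ l →
                      SameVertex a d → InSector a b d
      sector-before a b d l out≡ b≢ ℓ≡ same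
        with k , eq , labels ← sector l (vert a) (σ⁻ d) (trans (vert-σ⁻ d) (sym (SameVertex⇒≡ same))) ℓ≡
        rewrite sym (e-unique out≡) = suc k , trans (cong σ eq) (σσ⁻ d) , λ { j (s≤s j≤k) refl → b≢ (labels j j≤k) }
      sector-at : ∀ a b d l → out M col a ≡ just (next3 l) → ℓ b ≢ l → ℓ d ≡ l →
                  SameVertex a d → InSector a b d
      sector-at a b d l out≡ b≢ ℓ≡ same
        with k , eq , labels ← sector l (vert a) d (sym (SameVertex⇒≡ same)) ℓ≡
        rewrite sym (e-unique out≡) = k , eq , λ { j j<k refl → b≢ (labels j (ℕₚ.<⇒≤ j<k)) }
      ccw : ∀ d₀ d₁ d₂ → SameVertex d₀ d₁ → SameVertex d₀ d₂ → out M col d₀ ≡ just 0F →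
            out M col d₁ ≡ just 1F → out M col d₂ ≡ just 2F → InSector d₀ d₂ d₁
      ccw d₀ d₁ d₂ s₁ s₂ o₀ o₁ o₂ = sector-before d₀ d₂ d₁ 2F o₀ (subst (_≢ 2F) (sym (ℓ-out o₂)) (λ ())) (ℓ-before o₁) s₁
      entering : ∀ d i e₊ e₋ → out M col (α d) ≡ just i → SameVertex d e₊ → SameVertex d e₋ →
                 out M col e₊ ≡ just (next3 i) → out M col e₋ ≡ just (prev3 i) → InSector e₊ e₋ d
      entering d i e₊ e₋ in≡ s₊ s₋ o₊ o₋ with out M col d in out≡
      ... | nothing = sector-at e₊ e₋ d i o₊ e₋≢ (ℓ-in out≡ in≡) (vert-orbit _ _ (sym (SameVertex⇒≡ s₊)))
        where
        e₋≢ : ℓ e₋ ≢ i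
        e₋≢ eq = next≢ i (trans (sym (prev-prev i)) (trans (sym (ℓ-out o₋)) eq))
      ... | just c with colour-cases i c
      ... | inj₁ refl = contradiction in≡ (bidistinct out≡)
      ... | inj₂ (inj₁ refl) = 0 , trans (e-unique o₊) (trans (cong (e (next3 i)) (sym (SameVertex⇒≡ s₊)))
          (sym (e-unique out≡))) , λ _ ()
      ... | inj₂ (inj₂ refl) = sector-before e₊ e₋ d i o₊ e₋≢ (trans (ℓ-before out≡) (next-prev i))
          (vert-orbit _ _ (sym (SameVertex⇒≡ s₊)))
        where
        e₋≢ : ℓ e₋ ≢ i
        e₋≢ eq = next≢ i (trans (sym (prev-prev i)) (trans (sym (ℓ-out o₋)) eq))
      meets : ∀ i i′ → i′ ≢ i → (C : MonoCycle M col i) → ∃ λ (C′ : MonoCycle M col i′) → Intersect M col C C′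
      meets i i′ i′≢i C with n , on ← meet i i′ (vert (MonoCycle.cyc C zero)) i′≢i (MonoCycle⇒OnCycle O C zero)
        with j , eq ← iter⇒MonoCycle O C n
        with C′ , at ← OnCycle⇒MonoCycle O on = C′ , j , zero , vert-orbit _ _ (trans eq (sym (at zero)))

module WoodLabelling {M : Map} (S : Surface M) (col : Colouring M) (W : IsSchnyderWood M col) where
  open Map M
  open Surface S
  private
    module W = IsSchnyderWood W
    o : Fin D → Maybe Colour
    o = out M col

  outDarts : OutDarts S o
  outDarts = record
    { e = λ c v → proj₁ (W.out-exists (repV v) c)
    ; vert-e = λ c v → trans (sym (SameVertex⇒≡ (proj₁ (proj₂ (W.out-exists (repV v) c))))) (proj₂ (vert-onto v))
    ; out-e = λ c v → proj₂ (proj₂ (W.out-exists (repV v) c))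
    ; e-unique = λ {d} {c} out≡ → let _ , same , out≡′ = W.out-exists (repV (vert d)) c in
        W.out-unique d _ c (vert-orbit _ _ (trans (sym (proj₂ (vert-onto (vert d)))) (SameVertex⇒≡ same))) out≡ out≡′
    }

  open OutDarts outDarts

  iter-σ-cancel : ∀ {m n a b} → m ℕ.≤ n → iter σ m a ≡ iter σ n b → a ≡ iter σ (n ℕ.∸ m) b
  iter-σ-cancel {m} {n} {a} {b} m≤n eq = begin
    a                                              ≡⟨ sym (iter-cancel σ⁻σ m a) ⟩
    iter σ⁻ m (iter σ m a)                         ≡⟨ cong (iter σ⁻ m) eq ⟩
    iter σ⁻ m (iter σ n b)                         ≡⟨ cong (λ k → iter σ⁻ m (iter σ k b)) (sym (ℕₚ.m+[n∸m]≡n m≤n)) ⟩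
    iter σ⁻ m (iter σ (m ℕ.+ (n ℕ.∸ m)) b)         ≡⟨ cong (iter σ⁻ m) (iter-+ σ m (n ℕ.∸ m) b) ⟩
    iter σ⁻ m (iter σ m (iter σ (n ℕ.∸ m) b))      ≡⟨ iter-cancel σ⁻σ m _ ⟩
    iter σ (n ℕ.∸ m) b                             ∎
    where open ≡-Reasoning

  -- The last outgoing dart met when turning clockwise from d, d included, is the one of colour c.
  record LastOut (v : Fin nV) (c : Colour) (d : Fin D) : Set where
    field
      distance : ℕ
      reaches  : iter σ distance (e c v) ≡ d
      gap      : ∀ j → 0 ℕ.< j → j ℕ.≤ distance → o (iter σ j (e c v)) ≡ nothing

  open LastOut

  lastOut-self : ∀ {v c d} → d ≡ e c v → LastOut v c d
  lastOut-self refl = record { distance = 0 ; reaches = refl ; gap = λ { _ () z≤n } }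

  lastOut-step : ∀ {v c d} → o d ≡ nothing → LastOut v c (σ⁻ d) → LastOut v c d
  lastOut-step {v} {c} {d} out≡ L = record { distance = suc (distance L) ; reaches = reaches′ ; gap = gap′ }
    where
    reaches′ : σ (iter σ (distance L) (e c v)) ≡ d
    reaches′ = trans (cong σ (reaches L)) (σσ⁻ d)
    gap′ : ∀ j → 0 ℕ.< j → j ℕ.≤ suc (distance L) → o (iter σ j (e c v)) ≡ nothing
    gap′ j 0<j j≤ with ℕₚ.m≤n⇒m<n∨m≡n j≤
    ... | inj₁ (s≤s j≤k) = gap L j 0<j j≤k
    ... | inj₂ refl = trans (cong o reaches′) out≡

  lastOut : ∀ d → ∃ λ c → LastOut (vert d) c d
  lastOut d with k , eq ← vert-orbit (e zero (vert d)) d (vert-e zero (vert d)) = go k d refl eq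
    where
    go : ∀ {v} k w → vert w ≡ v → iter σ k (e zero v) ≡ w → ∃ λ c → LastOut v c w
    go zero w vert≡ eq = zero , lastOut-self (sym eq)
    go (suc k) w vert≡ eq with o w in out≡
    ... | just c = c , lastOut-self (e-unique′ out≡ vert≡)
    ... | nothing = let c , L = go k (σ⁻ w) (trans (vert-σ⁻ w) vert≡) (trans (sym (σ⁻σ _)) (cong σ⁻ eq)) in
      c , lastOut-step out≡ L

  -- Behind `e c v` no dart up to `d` is outgoing, so an outgoing `a` that turns to `d` has to pass
  -- through `e c v` or start there.
  lastOut-before : ∀ {v c d a c′} (L : LastOut v c d) → o a ≡ just c′ → ∀ m → iter σ m a ≡ d →
                   distance L ℕ.≤ m × iter σ (m ℕ.∸ distance L) a ≡ e c v
  lastOut-before {v} {c} {d} {a} L out≡ m eq with distance L ℕₚ.≤? m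
  ... | yes k≤m = k≤m , sym (iter-σ-cancel k≤m (trans (reaches L) (sym eq)))
  ... | no k≰m = contradiction out≡ (nothing≢just (trans (cong o a≡) (gap L _ (ℕₚ.m<n⇒0<n∸m m<k) (ℕₚ.m∸n≤m _ m))))
    where
    m<k = ℕₚ.≰⇒> k≰m
    a≡ : a ≡ iter σ (distance L ℕ.∸ m) (e c v)
    a≡ = iter-σ-cancel (ℕₚ.<⇒≤ m<k) (trans eq (sym (reaches L)))

  lastOut-unique : ∀ {v c c′ d} → LastOut v c d → LastOut v c′ d → c ≡ c′
  lastOut-unique {v} {c} {c′} L L′ with lastOut-before L (out-e c′ v) (distance L′) (reaches L′)
  ... | k≤k′ , eq with ℕₚ.m≤n⇒m<n∨m≡n k≤k′
  ... | inj₁ k<k′ = contradiction (out-e c v) (nothing≢just (trans (cong o (sym eq))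
      (gap L′ _ (ℕₚ.m<n⇒0<n∸m k<k′) (ℕₚ.m∸n≤m _ (distance L)))))
  ... | inj₂ k≡k′ = sym (e-colour (trans (cong (λ m → iter σ m (e c′ v))
      (sym (trans (cong (ℕ._∸ distance L) (sym k≡k′)) (ℕₚ.n∸n≡0 (distance L))))) eq))

  module _ (v : Fin nV) where

    Precedes : Colour → Colour → Set
    Precedes c′ c = LastOut v c′ (σ⁻ (e c v))

    predecessor : ∀ c → ∃ λ c′ → Precedes c′ c
    predecessor c = let c′ , L = lastOut (σ⁻ (e c v)) in
      c′ , subst (λ w → LastOut w c′ (σ⁻ (e c v))) (trans (vert-σ⁻ _) (vert-e c v)) L

    precedes-before : ∀ {c′ c a c″} (P : Precedes c′ c) → o a ≡ just c″ → a ≢ e c v → ∀ m → iter σ m a ≡ e c v →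
                      ∃ λ m′ → m′ ℕ.< m × iter σ m′ a ≡ e c′ v
    precedes-before P out≡ a≢ zero eq = contradiction eq a≢
    precedes-before P out≡ a≢ (suc m) eq =
      m ℕ.∸ distance P , s≤s (ℕₚ.m∸n≤m m (distance P)) ,
      proj₂ (lastOut-before P out≡ m (trans (sym (σ⁻σ _)) (cong σ⁻ eq)))

    -- Infinite descent: whatever number of turns leads from another outgoing dart to `e c v`, a
    -- smaller number would do as well.
    ¬Precedes-self : ∀ {c} → ¬ Precedes c c
    ¬Precedes-self {c} P with k , eq ← vert-orbit (e (next3 c) v) (e c v) (trans (vert-e _ v) (sym (vert-e c v))) =
      go k (<-wellFounded k) eq
      where
      go : ∀ m → Acc ℕ._<_ m → iter σ m (e (next3 c) v) ≢ e c v
      go m (acc rs) eq with m′ , m′<m , eq′ ← precedes-before P (out-e _ v) (λ eq → next≢ c (e-colour eq)) m eq =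
        go m′ (rs m′<m) eq′

    Precedes-¬closer : ∀ {c a b} (P : Precedes c a) (Q : Precedes c b) → ¬ (distance P ℕ.< distance Q)
    Precedes-¬closer {a = a} P Q lt = nothing≢just (gap Q (suc (distance P)) (s≤s z≤n) lt)
      (trans (cong o (trans (cong σ (reaches P)) (σσ⁻ _))) (out-e a v))

    Precedes-injective : ∀ {c a b} → Precedes c a → Precedes c b → a ≡ b
    Precedes-injective {c} {a} {b} P Q with ℕₚ.<-cmp (distance P) (distance Q)
    ... | tri< lt _ _ = contradiction lt (Precedes-¬closer P Q)
    ... | tri> _ _ gt = contradiction gt (Precedes-¬closer Q P)
    ... | tri≈ _ eq _ = e-colour (begin
      e a v                             ≡⟨ sym (σσ⁻ _) ⟩
      σ (σ⁻ (e a v))                    ≡⟨ cong σ (sym (reaches P)) ⟩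
      iter σ (suc (distance P)) (e c v) ≡⟨ cong (λ k → iter σ (suc k) (e c v)) eq ⟩
      iter σ (suc (distance Q)) (e c v) ≡⟨ cong σ (reaches Q) ⟩
      σ (σ⁻ (e b v))                    ≡⟨ σσ⁻ _ ⟩
      e b v                             ∎)
      where open ≡-Reasoning

    -- Colour 2 is excluded by `ccw-order`, since it would be met between colours 0 and 1. The other
    -- two relations then follow from injectivity.
    precedes₁ : Precedes 0F 1F
    precedes₁ with predecessor 1F
    ... | 0F , P = P
    ... | 1F , P = contradiction P ¬Precedes-self
    ... | 2F , P with m , eq , avoids ← W.ccw-order (e 0F v) (e 1F v) (e 2F v)
                        (vert-orbit _ _ (trans (vert-e _ v) (sym (vert-e _ v))))
                        (vert-orbit _ _ (trans (vert-e _ v) (sym (vert-e _ v)))) (out-e _ v) (out-e _ v) (out-e _ v)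
      with m′ , m′<m , eq′ ← precedes-before P (out-e 0F v) (λ eq → case e-colour eq of λ ()) m eq =
      contradiction eq′ (avoids m′ m′<m)

    precedes₂ : Precedes 1F 2F
    precedes₂ with predecessor 2F
    ... | 0F , P = case Precedes-injective precedes₁ P of λ ()
    ... | 1F , P = P
    ... | 2F , P = contradiction P ¬Precedes-self

    precedes₀ : Precedes 2F 0F
    precedes₀ with predecessor 0F
    ... | 0F , P = contradiction P ¬Precedes-self
    ... | 1F , P = case Precedes-injective precedes₂ P of λ ()
    ... | 2F , P = P

    precedes : ∀ c → Precedes (prev3 c) c
    precedes 0F = precedes₀
    precedes 1F = precedes₁
    precedes 2F = precedes₂

  ℓ : Fin D → Colour
  ℓ d = prev3 (proj₁ (lastOut d))

  ℓ-lastOut : ∀ {v c d} → vert d ≡ v → LastOut v c d → ℓ d ≡ prev3 c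
  ℓ-lastOut {d = d} refl L = cong prev3 (lastOut-unique (proj₂ (lastOut d)) L)

  -- The turn from `e (next3 c) v` to `d` passes the last outgoing dart before `d`. If that had
  -- colour `prev3 c`, or colour `c`, which `prev3 c` immediately precedes, the turn would hit
  -- `e (prev3 c) v`, which it avoids.
  entering-sector : ∀ {d c} → o d ≡ nothing → o (α d) ≡ just c → LastOut (vert d) (next3 c) d
  entering-sector {d} {c} out≡ in≡ = from (lastOut d)
    where
    v = vert d
    sec : InSector (e (next3 c) v) (e (prev3 c) v) d
    sec = W.entering d c (e (next3 c) v) (e (prev3 c) v) in≡
      (vert-orbit _ _ (sym (vert-e _ v))) (vert-orbit _ _ (sym (vert-e _ v))) (out-e _ v) (out-e _ v)
    m = proj₁ sec
    avoids = proj₂ (proj₂ sec)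
    back : ∀ {c′} (L : LastOut v c′ d) → ∃ λ m′ → m′ ℕ.< m × iter σ m′ (e (next3 c) v) ≡ e c′ v
    back {c′} L with distance L in k≡ | lastOut-before L (out-e _ v) m (proj₁ (proj₂ sec))
    ... | zero | _ = contradiction (out-e c′ v) (nothing≢just
        (trans (cong o (trans (cong (λ k → iter σ k (e c′ v)) (sym k≡)) (reaches L))) out≡))
    ... | suc k | k<m , eq = m ℕ.∸ suc k , ℕₚ.∸-monoʳ-< (s≤s z≤n) k<m , eq
    from : (∃ λ c′ → LastOut v c′ d) → LastOut v (next3 c) d
    from (c′ , L) with colour-cases c c′ | back L
    ... | inj₂ (inj₁ refl) | _ = L
    ... | inj₂ (inj₂ refl) | m′ , m′<m , eq = contradiction eq (avoids m′ m′<m)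
    ... | inj₁ refl | m′ , m′<m , eq
      with m″ , m″<m′ , eq′ ← precedes-before v (precedes v c) (out-e _ v) (λ eq → next≢ c (e-colour eq)) m′ eq =
      contradiction eq′ (avoids m″ (ℕₚ.<-trans m″<m′ m′<m))

  angleLabelling : AngleLabelling S o
  angleLabelling = record
    { ℓ = ℓ
    ; ℓ-out = λ out≡ → ℓ-lastOut refl (lastOut-self (e-unique out≡))
    ; ℓ-before = λ {d} {c} out≡ → trans
        (ℓ-lastOut (vert-σ⁻ d) (subst (λ w → LastOut (vert d) (prev3 c) (σ⁻ w)) (sym (e-unique out≡)) (precedes (vert d) c)))
        (prev-prev c)
    ; ℓ-none = λ {d} out≡ → ℓ-lastOut refl
        (lastOut-step out≡ (subst (λ v → LastOut v (proj₁ (lastOut (σ⁻ d))) (σ⁻ d)) (vert-σ⁻ d) (proj₂ (lastOut (σ⁻ d)))))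
    ; ℓ-in = λ {d} {c} out≡ in≡ → trans (ℓ-lastOut refl (entering-sector out≡ in≡)) (prev-next c)
    ; oriented = λ {d} → W.oriented d
    ; bidistinct = λ {d} {c} → W.bidistinct d c
    }

  cyclesMeet : CyclesMeet
  cyclesMeet c c′ v c′≢c on
    with C , at ← OnCycle⇒MonoCycle S col outDarts on with colour-cases c c′
  ... | inj₁ refl = contradiction refl c′≢c
  ... | inj₂ (inj₁ refl) with C′ , j , j′ , same ← proj₂ (W.T2 c C) =
    toℕ j , subst (OnCycle c′) (trans (sym (SameVertex⇒≡ same)) (at j)) (MonoCycle⇒OnCycle S col outDarts C′ j′)
  ... | inj₂ (inj₂ refl) with C′ , j , j′ , same ← proj₁ (W.T2 c C) =
    toℕ j , subst (OnCycle c′) (trans (sym (SameVertex⇒≡ same)) (at j)) (MonoCycle⇒OnCycle S col outDarts C′ j′)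

-- Monochromatic cycles are not null-homologous

k*i≡0 : ∀ {k i} → k ≢ 0ℤ → k * i ≡ 0ℤ → i ≡ 0ℤ
k*i≡0 {k} k≢0 eq = [ (λ k≡0 → contradiction k≡0 k≢0) , (λ i≡0 → i≡0) ]′ (ℤₚ.i*j≡0⇒i≡0∨j≡0 k eq)

module _ {M : Map} {S : Surface M} {out : Fin (Map.D M) → Maybe Colour} (O : OutDarts S out) where
  open Map M
  open Surface S
  open OutDarts O

  -- The walk may run around its cycle several times, so multiplicities on it are positive but not
  -- necessarily one.
  cycle-walk : ∀ {c v} → OnCycle c v → ClosedWalk S
  cycle-walk {c} {v} (L , eq) = record
    { len = suc L
    ; dart = λ j → e c (iter (successor c) j v)
    ; link = λ j → sym (vert-e c _)
    ; closed = cong (vert ∘ e c) eq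
    }

  cycle-walk-vert : ∀ {c v} (on : OnCycle c v) j → vert (ClosedWalk.dart (cycle-walk on) j) ≡ iter (successor c) j v
  cycle-walk-vert {c} on j = vert-e c _

  cycle-index : ∀ {c v} (on : OnCycle c v) n → ∃ λ (j : Fin (suc (proj₁ on))) → iter (successor c) n v ≡ iter
      (successor c) (toℕ j) v
  cycle-index on zero = zero , refl
  cycle-index {c} {v} on@(L , eq) (suc n) with cycle-index on n
  ... | j , eq′ with view j
  ... | ‵fromℕ = zero , trans (cong (successor c) (trans eq′ (cong (λ k → iter (successor c) k v) (toℕ-fromℕ L)))) eq
  ... | ‵inject₁ i = suc i , cong (successor c) (trans eq′ (cong (λ k → iter (successor c) k v) (toℕ-inject₁ i)))

  multiplicity-colour : ∀ {c v} (on : OnCycle c v) d → out d ≢ just c → multiplicity (cycle-walk on) d ≡ 0ℤ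
  multiplicity-colour {c} on d out≢ = ∑-zero _ (λ j → 𝟙-no (_ ≟ d) (λ eq → out≢ (trans (cong out (sym eq)) (out-e c _))))

  multiplicity-on : ∀ {c v} (on : OnCycle c v) n → multiplicity (cycle-walk on) (e c (iter (successor c) n v)) ≢ 0ℤ
  multiplicity-on {c} {v} on n with j , eq ← cycle-index on n =
    subst (λ w → multiplicity (cycle-walk on) (e c w) ≢ 0ℤ) (sym eq) (multiplicity-dart (cycle-walk on) j)

  -- Around the cycle the changes of `F` add up to zero, yet all have the sign of `k`, so each of
  -- them vanishes. `P` records what a vanishing change means at its vertex.
  cycle-monotone : ∀ {c} (F : Fin nV → ℤ) k → k ≢ 0ℤ → (P : Fin nV → Set) →
    (∀ u → ∃ λ t → 0ℤ ≤ t × F (successor c u) - F u ≡ k * t × (t ≡ 0ℤ → P u)) →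
    ∀ {u} → OnCycle c u → P u
  cycle-monotone {c} F k k≢0 P step {u} on = proj₂ (proj₂ (proj₂ (step u)))
    (k*i≡0 k≢0 (∑-scaled-nonneg-zero k t (λ j → proj₁ (proj₂ (step (at j)))) ∑≡0 zero))
    where
    L = suc (proj₁ on)
    at : Fin L → Fin nV
    at j = iter (successor c) (toℕ j) u
    t : Fin L → ℤ
    t j = proj₁ (step (at j))
    ∑≡0 : ∑ (λ j → k * t j) ≡ 0ℤ
    ∑≡0 = trans (∑-cong (λ j → sym (trans (cong (λ w → F (successor c (at j)) - F w) (vert-e c (at j)))
        (proj₁ (proj₂ (proj₂ (step (at j)))))))) (∑-walk (cycle-walk on) F)

module _ {M : Map} {S : Surface M} {out : Fin (Map.D M) → Maybe Colour}
         (A : AngleLabelling S out) (O : OutDarts S out) where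
  open Map M
  open Surface S
  open AngleLabelling A
  open OutDarts O
  open SectorInduction A O

  -- Suppose a multiple of the c-cycle through v bounds q.  Follow a cycle of another colour c′ along its side:
  -- q changes only where c′ crosses the c-cycle, always with the same sign, so no crossing occurs.
  -- A c′-cycle meeting the c-cycle therefore runs along its reversal, which is impossible for
  -- both colours c′ ≠ c at once.
  module NonContractible {c : Colour} {v : Fin nV} (on : OnCycle c v) {m : ℤ} (m≢0 : m ≢ 0ℤ)
           (q : Fin nF → ℤ) (bounds : ∀ d → m * chain (cycle-walk O on) d ≡ boundary {S = S} q d) where

    private
      N : Fin D → ℤ
      N = multiplicity (cycle-walk O on)

      G H : Fin nV → ℤ
      G u = q (face (α (e c u)))
      H u = q (face (e c u))

      H-G : ∀ u → H u - G u ≡ m * N (e c u)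
      H-G u = trans (sym (bounds (e c u))) (cong (m *_)
        (trans (cong (_-_ (N (e c u))) (multiplicity-colour O on _ (bidistinct (out-e c u)))) (ℤₚ.+-identityʳ _)))

      flat : ∀ {w} → out w ≡ nothing → ℓ w ≢ c → q (face w) ≡ q (face (α w))
      flat {w} out≡ ℓ≢ = ℤₚ.i-j≡0⇒i≡j _ _ (trans (sym (bounds w)) (trans (cong (m *_) (cong₂ _-_
        (multiplicity-colour O on w (nothing≢just out≡))
        (multiplicity-colour O on (α w) (ℓ≢ ∘ ℓ-in out≡)))) (ℤₚ.*-zeroʳ m)))

      -- The sector labelled `prev3 c` starts on the left side of `e c u`, and the edges entering
      -- inside it have colour `prev3 c`. The walk does not use them, so `q` keeps its value.
      -- `corner-next` is the mirror image on the right side.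
      corner-prev : ∀ {u} w → vert w ≡ u → ℓ w ≡ prev3 c → q (face (α w)) ≡ G u
      corner-prev {u} = backward-induction (λ w → q (face (α w)) ≡ G u) (prev3 c) u
        (cong (λ c → q (face (α (e c u)))) (next-prev c))
        λ w _ out≡ ℓ≡ eq → trans (sym (flat out≡ (λ ℓ≡c → prev≢ c (trans (sym ℓ≡) ℓ≡c))))
          (trans (cong q (sym (face-σ⁻ w))) eq)

      corner-next : ∀ {u} w → vert w ≡ u → ℓ w ≡ next3 c → q (face (α w)) ≡ H u
      corner-next {u} = forward-induction (λ w → q (face (α w)) ≡ H u) (next3 c) u
        (trans (cong q (face-σ⁻ _)) (cong (λ c → q (face (e c u))) (prev-next c)))
        λ w _ out≡ ℓ≡ eq → trans (cong q (sym (face-σ w)))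
          (trans (flat out≡ (λ ℓ≡c → next≢ c (trans (sym ℓ≡)
              (trans (cong ℓ (sym (σ⁻σ w))) (trans (sym (ℓ-none out≡)) ℓ≡c))))) eq)

      Along : Colour → Fin nV → Set
      Along c′ u = out (α (e c′ u)) ≡ just c ⊎ N (e c (successor c′ u)) ≡ 0ℤ

      i-i : ∀ {i j} k → j ≡ i → j - i ≡ k * 0ℤ
      i-i {i} k refl = trans (ℤₚ.+-inverseʳ i) (sym (ℤₚ.*-zeroʳ k))

      -- A dart of colour `next3 c` closes the sector left of `e c u`, so it starts beside the value
      -- `G u`. If its reverse has colour `c`, it arrives beside `G` again; otherwise it arrives in
      -- the sector right of the next `c`-dart, beside `H`. So `G` changes by `- m` times a
      -- multiplicity or not at all.
      along-next : ∀ {u} → OnCycle (next3 c) u → Along (next3 c) u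
      along-next = cycle-monotone O G (- m) (λ eq → m≢0 (ℤₚ.neg-injective eq)) (Along (next3 c)) step
        where
        tail : ∀ u → G u ≡ q (face (e (next3 c) u))
        tail u = trans (sym (corner-prev (σ⁻ (e (next3 c) u)) (trans (vert-σ⁻ _) (vert-e _ u))
                   (trans (ℓ-before (out-e _ u)) (next-next c)))) (cong q (face-σ⁻ _))
        crossing : ∀ u → ℓ (α (e (next3 c) u)) ≡ next3 c →
                   G (successor (next3 c) u) - G u ≡ - m * N (e c (successor (next3 c) u))
        crossing u ℓ≡ = begin
          G u′ - G u
            ≡⟨ cong (_-_ (G u′)) (trans (tail u) (trans (cong (q ∘ face) (sym (α-invol _))) (corner-next _ refl ℓ≡))) ⟩
          G u′ - H u′   ≡⟨ lem (G u′) (H u′) ⟩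
          - (H u′ - G u′) ≡⟨ trans (cong -_ (H-G u′)) (ℤₚ.neg-distribˡ-* m _) ⟩
          - m * N (e c u′) ∎
          where
          open ≡-Reasoning
          u′ = successor (next3 c) u
          lem : ∀ a b → a - b ≡ - (b - a)
          lem = solve-∀
        step : ∀ u → ∃ λ t → 0ℤ ≤ t × G (successor (next3 c) u) - G u ≡ - m * t × (t ≡ 0ℤ → Along (next3 c) u)
        step u with out (α (e (next3 c) u)) in out≡
        ... | nothing = _ , multiplicity-nonneg (cycle-walk O on) _ ,
          crossing u (ℓ-in out≡ (trans (cong out (α-invol _)) (out-e _ u))) , inj₂
        ... | just c″ with colour-cases c c″
        ... | inj₁ refl = 0ℤ , ℤₚ.≤-refl , i-i (- m) (sym (trans (tail u)
            (trans (cong (q ∘ face) (sym (α-invol _))) (corner-prev _ refl (ℓ-out out≡))))) , λ _ → inj₁ refl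
        ... | inj₂ (inj₁ refl) = contradiction out≡ (bidistinct (out-e _ u))
        ... | inj₂ (inj₂ refl) = _ , multiplicity-nonneg (cycle-walk O on) _ ,
          crossing u (trans (ℓ-out out≡) (prev-prev c)) , inj₂

      along-prev : ∀ {u} → OnCycle (prev3 c) u → Along (prev3 c) u
      along-prev = cycle-monotone O H m m≢0 (Along (prev3 c)) step
        where
        tail : ∀ u → H u ≡ q (face (α (e (prev3 c) u)))
        tail u = sym (corner-next (e (prev3 c) u) (vert-e _ u) (trans (ℓ-out (out-e _ u)) (prev-prev c)))
        crossing : ∀ u → ℓ (σ⁻ (α (e (prev3 c) u))) ≡ prev3 c →
                   H (successor (prev3 c) u) - H u ≡ m * N (e c (successor (prev3 c) u))
        crossing u ℓ≡ = trans (cong (_-_ (H (successor (prev3 c) u)))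
          (trans (tail u) (trans (cong q (sym (face-σ⁻ _))) (corner-prev _ (vert-σ⁻ _) ℓ≡)))) (H-G _)
        step : ∀ u → ∃ λ t → 0ℤ ≤ t × H (successor (prev3 c) u) - H u ≡ m * t × (t ≡ 0ℤ → Along (prev3 c) u)
        step u with out (α (e (prev3 c) u)) in out≡
        ... | nothing = _ , multiplicity-nonneg (cycle-walk O on) _ ,
          crossing u (trans (sym (ℓ-none out≡)) (ℓ-in out≡ (trans (cong out (α-invol _)) (out-e _ u)))) , inj₂
        ... | just c″ with colour-cases c c″
        ... | inj₁ refl = 0ℤ , ℤₚ.≤-refl , i-i m (sym (trans (tail u)
            (trans (cong q (sym (face-σ⁻ _))) (corner-next _ (vert-σ⁻ _) (ℓ-before out≡))))) , λ _ → inj₁ refl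
        ... | inj₂ (inj₁ refl) = _ , multiplicity-nonneg (cycle-walk O on) _ ,
          crossing u (trans (ℓ-before out≡) (next-next c)) , inj₂
        ... | inj₂ (inj₂ refl) = contradiction out≡ (bidistinct (out-e _ u))

      -- `along` is applied one step back on the `c′`-cycle, that is `L` steps ahead. Its second
      -- alternative fails on the `c`-cycle, so the `c′`-edge arriving here is the outgoing `c`-edge
      -- reversed.
      reversed : ∀ {c′} → (∀ {u} → OnCycle c′ u → Along c′ u) → ∀ n → OnCycle c′ (iter (successor c) n v) →
                 out (α (e c (iter (successor c) n v))) ≡ just c′ × OnCycle c′ (iter (successor c) (suc n) v)
      reversed {c′} along n (L , eq) with along {iter (successor c′) L (iter (successor c) n v)} (OnCycle-iter L (L , eq))
      ... | inj₂ N≡0 = contradiction (subst (λ w → N (e c w) ≡ 0ℤ) eq N≡0) (multiplicity-on O on n)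
      ... | inj₁ out≡ = trans (cong (out ∘ α) (sym αe≡)) (trans (cong out (α-invol _)) (out-e c′ u′)) ,
        subst (OnCycle c′) (trans (sym (vert-e c′ u′)) (trans (cong vert (sym (α-invol _))) (cong (vert ∘ α) αe≡)))
            (OnCycle-iter L (L , eq))
        where
        u′ = iter (successor c′) L (iter (successor c) n v)
        αe≡ : α (e c′ u′) ≡ e c (iter (successor c) n v)
        αe≡ = e-unique′ out≡ eq

      keeps : ∀ {c′} → (∀ {u} → OnCycle c′ u → Along c′ u) → ∀ k n → OnCycle c′ (iter (successor c) n v) →
              OnCycle c′ (iter (successor c) (k ℕ.+ n) v)
      keeps along zero n on′ = on′
      keeps along (suc k) n on′ = proj₂ (reversed along (k ℕ.+ n) (keeps along k n on′))

    impossible : CyclesMeet → ⊥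
    impossible meet
      with n₁ , on₁ ← meet c (next3 c) v (next≢ c) on
      with n₂ , on₂ ← meet c (prev3 c) (iter (successor c) n₁ v) (prev≢ c) (OnCycle-iter n₁ on) =
      -- The cycle of colour `next3 c` is carried along the `c`-cycle to the vertex where the one of
      -- colour `prev3 c` meets it, so that both reverse the same edge.
      next≢prev c (just-unique
        (proj₁ (reversed along-next (n₂ ℕ.+ n₁) (keeps along-next n₂ n₁ on₁)))
        (proj₁ (reversed along-prev (n₂ ℕ.+ n₁) (subst (OnCycle (prev3 c)) (sym (iter-+ (successor c) n₂ n₁ v)) on₂))))

-- The dual labelling

-- Obtained by reading the four corner labels of the edge with ends and sides exchanged: an edge
-- oriented once becomes bidirected and a bidirected one oriented once. The arguments are the
-- colours of `d` and `α d`.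
dual-colour : Maybe Colour → Maybe Colour → Maybe Colour
dual-colour (just i) nothing  = just (prev3 i)
dual-colour nothing  (just i) = just (next3 i)
dual-colour nothing  nothing  = nothing
dual-colour (just i) (just j) = if does (j ≟ next3 i) then just (prev3 i) else nothing

data EdgeView (a b : Maybe Colour) : Set where
  forward  : ∀ i → a ≡ just i → b ≡ nothing →
             dual-colour a b ≡ just (prev3 i) → dual-colour b a ≡ just (next3 i) → EdgeView a b
  backward : ∀ i → a ≡ nothing → b ≡ just i →
             dual-colour a b ≡ just (next3 i) → dual-colour b a ≡ just (prev3 i) → EdgeView a b
  up       : ∀ i → a ≡ just i → b ≡ just (next3 i) →
             dual-colour a b ≡ just (prev3 i) → dual-colour b a ≡ nothing → EdgeView a b
  down     : ∀ i → a ≡ just (next3 i) → b ≡ just i →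
             dual-colour a b ≡ nothing → dual-colour b a ≡ just (prev3 i) → EdgeView a b

edge-view : ∀ a b → (a ≡ nothing → b ≢ nothing) → (∀ {c} → a ≡ just c → b ≢ just c) → EdgeView a b
edge-view nothing nothing oriented _ = contradiction refl (oriented refl)
edge-view nothing (just i) _ _ = backward i refl refl refl refl
edge-view (just i) nothing _ _ = forward i refl refl refl refl
edge-view (just 0F) (just 0F) _ distinct = contradiction refl (distinct refl)
edge-view (just 0F) (just 1F) _ _ = up 0F refl refl refl refl
edge-view (just 0F) (just 2F) _ _ = down 2F refl refl refl refl
edge-view (just 1F) (just 0F) _ _ = down 0F refl refl refl refl
edge-view (just 1F) (just 1F) _ distinct = contradiction refl (distinct refl)
edge-view (just 1F) (just 2F) _ _ = up 1F refl refl refl refl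
edge-view (just 2F) (just 0F) _ _ = up 2F refl refl refl refl
edge-view (just 2F) (just 1F) _ _ = down 1F refl refl refl refl
edge-view (just 2F) (just 2F) _ distinct = contradiction refl (distinct refl)

-- The order of the two dual colours is swapped because dualising twice reverses every dart.
dual-colour-involutive : ∀ {a b} → EdgeView a b → dual-colour (dual-colour b a) (dual-colour a b) ≡ a
dual-colour-involutive (forward 0F refl refl _ _) = refl
dual-colour-involutive (forward 1F refl refl _ _) = refl
dual-colour-involutive (forward 2F refl refl _ _) = refl
dual-colour-involutive (backward 0F refl refl _ _) = refl
dual-colour-involutive (backward 1F refl refl _ _) = refl
dual-colour-involutive (backward 2F refl refl _ _) = refl
dual-colour-involutive (up 0F refl refl _ _) = refl
dual-colour-involutive (up 1F refl refl _ _) = refl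
dual-colour-involutive (up 2F refl refl _ _) = refl
dual-colour-involutive (down 0F refl refl _ _) = refl
dual-colour-involutive (down 1F refl refl _ _) = refl
dual-colour-involutive (down 2F refl refl _ _) = refl

_≟ᶜ_ : (o o′ : Maybe Colour) → Dec (o ≡ o′)
_≟ᶜ_ = ≡-dec _≟_

[_↦_] : Maybe Colour → Colour → ℤ
[ o ↦ c ] = 𝟙 (o ≟ᶜ just c)

coloured : Maybe Colour → ℤ
coloured o = [ o ↦ 0F ] + [ o ↦ 1F ] + [ o ↦ 2F ]

coloured-just : ∀ c → coloured (just c) ≡ 1ℤ
coloured-just 0F = refl
coloured-just 1F = refl
coloured-just 2F = refl

module _ {M : Map} {S : Surface M} {out : Fin (Map.D M) → Maybe Colour} where
  open Map M
  open Surface S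

  ∑-vert : ∀ (g : Fin D → ℤ) → ∑ (λ v → ∑ (λ d → 𝟙 (vert d ≟ v) * g d)) ≡ ∑ g
  ∑-vert g = trans (∑-swap _) (∑-cong (λ d → ∑-δ (vert d) (λ _ → g d)))

  module _ (A : AngleLabelling S out) where
    open AngleLabelling A

    outdegree : Colour → Fin nV → ℤ
    outdegree c v = ∑ (λ d → 𝟙 (vert d ≟ v) * [ out d ↦ c ])

    outdegree-nonneg : ∀ c v d → 0ℤ ≤ 𝟙 (vert d ≟ v) * [ out d ↦ c ]
    outdegree-nonneg c v d with vert d ≟ v
    ... | yes _ = subst (0ℤ ≤_) (sym (ℤₚ.*-identityˡ [ out d ↦ c ])) (𝟙-nonneg (out d ≟ᶜ just c))
    ... | no _ = ℤₚ.≤-reflexive (sym (ℤₚ.*-zeroˡ [ out d ↦ c ]))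

    -- Around a vertex, label l is entered (at colour l + 1) as often as it is left (at colour l − 1).
    outdegree-balanced : ∀ l v → outdegree (next3 l) v ≡ outdegree (prev3 l) v
    outdegree-balanced l v = ℤₚ.i-j≡0⇒i≡j _ _ (begin
      outdegree (next3 l) v - outdegree (prev3 l) v          ≡⟨ sym (∑-sub _ _) ⟩
      ∑ (λ d → at d * [ out d ↦ next3 l ] - at d * [ out d ↦ prev3 l ])  ≡⟨ ∑-cong pointwise ⟩
      ∑ (λ d → at d * label d - at (σ⁻ d) * label (σ⁻ d))    ≡⟨ ∑-sub _ _ ⟩
      ∑ (λ d → at d * label d) - ∑ (λ d → at (σ⁻ d) * label (σ⁻ d))
        ≡⟨ ℤₚ.i≡j⇒i-j≡0 (sym (∑-σ⁻ (λ d → at d * label d))) ⟩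
      0ℤ                                                     ∎)
      where
      open ≡-Reasoning
      at label : Fin D → ℤ
      at d = 𝟙 (vert d ≟ v)
      label d = 𝟙 (ℓ d ≟ l)
      jump : ∀ d → [ out d ↦ next3 l ] - [ out d ↦ prev3 l ] ≡ label d - label (σ⁻ d)
      jump d with out d in out≡
      ... | nothing = sym (ℤₚ.i≡j⇒i-j≡0 (cong (λ l′ → 𝟙 (l′ ≟ l)) (ℓ-none out≡)))
      ... | just c = cong₂ _-_
        (𝟙-cong (just c ≟ᶜ just (next3 l)) (ℓ d ≟ l) (λ eq → trans (ℓ-out out≡)
            (trans (cong prev3 (just-injective eq)) (prev-next l)))
                    (λ eq → cong just (trans (sym (next-prev c)) (cong next3 (trans (sym (ℓ-out out≡)) eq)))))
        (𝟙-cong (just c ≟ᶜ just (prev3 l)) (ℓ (σ⁻ d) ≟ l) (λ eq → trans (ℓ-before out≡)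
            (trans (cong next3 (just-injective eq)) (next-prev l)))
                    (λ eq → cong just (trans (sym (prev-next c)) (cong prev3 (trans (sym (ℓ-before out≡)) eq)))))
      pointwise : ∀ d → at d * [ out d ↦ next3 l ] - at d * [ out d ↦ prev3 l ] ≡ at d * label d - at (σ⁻ d) * label (σ⁻ d)
      pointwise d = begin
        at d * [ out d ↦ next3 l ] - at d * [ out d ↦ prev3 l ]   ≡⟨ lem (at d) _ _ ⟩
        at d * ([ out d ↦ next3 l ] - [ out d ↦ prev3 l ])        ≡⟨ cong (at d *_) (jump d) ⟩
        at d * (label d - label (σ⁻ d))                           ≡⟨ sym (lem (at d) _ _) ⟩
        at d * label d - at d * label (σ⁻ d)
          ≡⟨ cong (λ w → at d * label d - 𝟙 (w ≟ v) * label (σ⁻ d)) (sym (vert-σ⁻ d)) ⟩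
        at d * label d - at (σ⁻ d) * label (σ⁻ d)                 ∎
        where
        lem : ∀ a b c → a * b - a * c ≡ a * (b - c)
        lem = solve-∀

    outdegree-const : ∀ c v → outdegree c v ≡ outdegree 0F v
    outdegree-const 0F v = refl
    outdegree-const 1F v = sym (outdegree-balanced 2F v)
    outdegree-const 2F v = outdegree-balanced 1F v

    -- By balance all colours have the same outdegree at a vertex; it is positive and 1 on average.
    module CountOutDarts (∑-coloured : ∑ (λ d → coloured (out d)) ≡ + 3 * + nV)
             (nonempty : ∀ v → ¬ (∀ d → vert d ≡ v → out d ≡ nothing)) where

      ∑-outdegree : ∑ (outdegree 0F) ≡ + nV
      ∑-outdegree = ℤₚ.*-cancelˡ-≡ (+ 3) _ _ (begin
        + 3 * ∑ (outdegree 0F)                                           ≡⟨ lem (∑ (outdegree 0F)) ⟩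
        ∑ (outdegree 0F) + ∑ (outdegree 0F) + ∑ (outdegree 0F)
          ≡⟨ cong₂ (λ a b → ∑ (outdegree 0F) + a + b) (∑-cong (λ v → sym (outdegree-const 1F v)))
              (∑-cong (λ v → sym (outdegree-const 2F v))) ⟩
        ∑ (outdegree 0F) + ∑ (outdegree 1F) + ∑ (outdegree 2F)
          ≡⟨ cong₂ _+_ (cong₂ _+_ (∑-vert _) (∑-vert _)) (∑-vert _) ⟩
        ∑ (λ d → [ out d ↦ 0F ]) + ∑ (λ d → [ out d ↦ 1F ]) + ∑ (λ d → [ out d ↦ 2F ])
          ≡⟨ sym (trans (∑-add _ _) (cong (_+ ∑ (λ d → [ out d ↦ 2F ])) (∑-add _ _))) ⟩
        ∑ (λ d → coloured (out d))                                       ≡⟨ ∑-coloured ⟩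
        + 3 * + nV                                                       ∎)
        where
        open ≡-Reasoning
        lem : ∀ a → + 3 * a ≡ a + a + a
        lem = solve-∀

      outdegree≢0 : ∀ v → outdegree 0F v ≢ 0ℤ
      outdegree≢0 v eq = nonempty v none
        where
        none : ∀ d → vert d ≡ v → out d ≡ nothing
        none d vert≡ with out d in out≡
        ... | nothing = refl
        ... | just c = contradiction
          (trans (sym (cong₂ _*_ (𝟙-yes (vert d ≟ v) vert≡) (𝟙-yes (out d ≟ᶜ just c) out≡)))
                 (∑-nonneg-zero _ (outdegree-nonneg c v) (trans (outdegree-const c v) eq) d))
          (λ ())

      outdegree≡1 : ∀ c v → outdegree c v ≡ 1ℤ
      outdegree≡1 c v = trans (outdegree-const c v) (ℤₚ.i-j≡0⇒i≡j _ _
        (∑-nonneg-zero _ (λ v → pos (∑-nonneg _ (outdegree-nonneg 0F v)) (outdegree≢0 v))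
          (trans (∑-sub _ _) (ℤₚ.i≡j⇒i-j≡0 (trans ∑-outdegree (sym (trans (∑-const nV 1ℤ) (ℤₚ.*-identityʳ (+ nV))))))) v))
        where
        pos : ∀ {i} → 0ℤ ≤ i → i ≢ 0ℤ → 0ℤ ≤ i - 1ℤ
        pos {+ zero} _ i≢0 = contradiction refl i≢0
        pos {+ suc n} _ _ = ℤ.+≤+ z≤n

      out-dart : ∀ c v → ∃ λ d → vert d ≡ v × out d ≡ just c
      out-dart c v = d , 𝟙≢0 (vert d ≟ v) (λ eq → ≢0 (trans (cong (_* [ out d ↦ c ]) eq) (ℤₚ.*-zeroˡ [ out d ↦ c ]))) ,
        𝟙≢0 (out d ≟ᶜ just c) (λ eq → ≢0 (trans (cong (𝟙 (vert d ≟ v) *_) eq) (ℤₚ.*-zeroʳ (𝟙 (vert d ≟ v)))))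
        where
        term : ∃ λ d → 𝟙 (vert d ≟ v) * [ out d ↦ c ] ≢ 0ℤ
        term = ∑≢0⇒∃ _ (λ eq → contradiction (trans (sym (outdegree≡1 c v)) eq) (λ ()))
        d = proj₁ term
        ≢0 = proj₂ term

      -- The summand of `outdegree` dominates the indicator of `x`, and both have sum one, so they
      -- agree at `d`.
      out-dart-unique : ∀ {c v x d} → vert x ≡ v → out x ≡ just c → vert d ≡ v → out d ≡ just c → d ≡ x
      out-dart-unique {c} {v} {x} {d} vert-x out-x vert-d out-d =
        sym (𝟙≢0 (x ≟ d) (λ eq → contradiction (trans (sym (t≡1 vert-d out-d)) (trans t≡δ eq)) (λ ())))
        where
        t : Fin D → ℤ
        t y = 𝟙 (vert y ≟ v) * [ out y ↦ c ]
        t≡1 : ∀ {y} → vert y ≡ v → out y ≡ just c → t y ≡ 1ℤ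
        t≡1 {y} vert≡ out≡ = cong₂ _*_ (𝟙-yes (vert y ≟ v) vert≡) (𝟙-yes (out y ≟ᶜ just c) out≡)
        above-δ : ∀ y → Dec (x ≡ y) → 0ℤ ≤ t y - 𝟙 (x ≟ y)
        above-δ y (yes refl) = ℤₚ.≤-reflexive (sym (cong₂ _-_ (t≡1 vert-x out-x) (𝟙-yes (x ≟ x) refl)))
        above-δ y (no x≢y) = subst (0ℤ ≤_)
          (trans (sym (ℤₚ.+-identityʳ (t y))) (cong (_-_ (t y)) (sym (𝟙-no (x ≟ y) x≢y)))) (outdegree-nonneg c v y)
        ∑δ : ∑ (λ y → 𝟙 (x ≟ y)) ≡ 1ℤ
        ∑δ = trans (∑-cong (λ y → sym (ℤₚ.*-identityʳ (𝟙 (x ≟ y))))) (∑-δ x (λ _ → 1ℤ))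
        t≡δ : t d ≡ 𝟙 (x ≟ d)
        t≡δ = ℤₚ.i-j≡0⇒i≡j _ _ (∑-nonneg-zero _ (λ y → above-δ y (x ≟ y))
          (trans (∑-sub _ _) (ℤₚ.i≡j⇒i-j≡0 (trans (outdegree≡1 c v) (sym ∑δ)))) d)

      outDarts-from-count : OutDarts S out
      outDarts-from-count = record
        { e = λ c v → proj₁ (out-dart c v)
        ; vert-e = λ c v → proj₁ (proj₂ (out-dart c v))
        ; out-e = λ c v → proj₂ (proj₂ (out-dart c v))
        ; e-unique = λ {d} {c} out≡ → let _ , vert≡ , out≡′ = out-dart c (vert d) in out-dart-unique vert≡ out≡′ refl out≡
        }

  module _ (O : OutDarts S out) where
    open OutDarts O

    ∑-out : ∀ c → ∑ (λ d → [ out d ↦ c ]) ≡ + nV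
    ∑-out c = begin
      ∑ (λ d → [ out d ↦ c ])
        ≡⟨ ∑-cong (λ d → sym (∑-δ (vert d) (λ _ → [ out d ↦ c ]))) ⟩
      ∑ (λ d → ∑ (λ v → 𝟙 (vert d ≟ v) * [ out d ↦ c ]))    ≡⟨ ∑-cong (λ d → ∑-cong (λ v → pointwise d v)) ⟩
      ∑ (λ d → ∑ (λ v → 𝟙 (e c v ≟ d) * 1ℤ))                ≡⟨ ∑-swap _ ⟩
      ∑ (λ v → ∑ (λ d → 𝟙 (e c v ≟ d) * 1ℤ))                ≡⟨ ∑-cong (λ v → ∑-δ (e c v) (λ _ → 1ℤ)) ⟩
      ∑ {nV} (λ v → 1ℤ)                                     ≡⟨ trans (∑-const nV 1ℤ) (ℤₚ.*-identityʳ (+ nV)) ⟩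
      + nV                                                  ∎
      where
      open ≡-Reasoning
      pointwise : ∀ d v → 𝟙 (vert d ≟ v) * [ out d ↦ c ] ≡ 𝟙 (e c v ≟ d) * 1ℤ
      pointwise d v with e c v ≟ d
      ... | yes refl = cong₂ _*_ (𝟙-yes (vert d ≟ v) (vert-e c v)) (𝟙-yes (out d ≟ᶜ just c) (out-e c v))
      ... | no e≢d with vert d ≟ v | out d ≟ᶜ just c
      ... | no _ | b = ℤₚ.*-zeroˡ (𝟙 b)
      ... | yes _ | no _ = refl
      ... | yes vert≡ | yes out≡ = contradiction (sym (e-unique′ out≡ vert≡)) e≢d

    ∑-coloured-out : ∑ (λ d → coloured (out d)) ≡ + 3 * + nV
    ∑-coloured-out = trans (trans (∑-add _ _) (cong₂ _+_ (trans (∑-add _ _) (cong₂ _+_ (∑-out 0F) (∑-out 1F))) (∑-out 2F)))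
                           (lem (+ nV))
      where
      lem : ∀ a → a + a + a ≡ + 3 * a
      lem = solve-∀

module DualLabelling {M : Map} {S : Surface M} {out : Fin (Map.D M) → Maybe Colour} (A : AngleLabelling S out) where
  open Map M
  open Surface S
  open AngleLabelling A

  out* : Fin D → Maybe Colour
  out* d = dual-colour (out d) (out (α d))

  edge-type : ∀ d → EdgeView (out d) (out (α d))
  edge-type d = edge-view (out d) (out (α d)) oriented bidistinct

  out*-α : ∀ d → out* (α d) ≡ dual-colour (out (α d)) (out d)
  out*-α d = cong (λ e → dual-colour (out (α d)) (out e)) (α-invol d)

  private
    out-αα : ∀ {d o} → out d ≡ o → out (α (α d)) ≡ o
    out-αα = trans (cong out (α-invol _))

  -- The dual corner between `d` and `α (σ⁻ d)` is the primal corner between `σ⁻ d` and `d`, hence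
  -- the shift by `σ⁻`.
  dual-labelling : AngleLabelling (dual-surface S) out*
  dual-labelling = record
    { ℓ = λ d → ℓ (σ⁻ d)
    ; ℓ-out = ℓ*-out
    ; ℓ-before = λ {d} out≡ → trans (cong ℓ (σ⁻σ (α d))) (ℓ*-before out≡)
    ; ℓ-none = λ {d} out≡ → trans (ℓ*-none out≡) (cong ℓ (sym (σ⁻σ (α d))))
    ; ℓ-in = ℓ*-in
    ; oriented = λ {d} out≡ out≡′ → oriented* out≡ (trans (sym (out*-α d)) out≡′)
    ; bidistinct = λ {d} out≡ out≡′ → bidistinct* out≡ (trans (sym (out*-α d)) out≡′)
    }
    where
    ℓ*-out : ∀ {d c} → out* d ≡ just c → ℓ (σ⁻ d) ≡ prev3 c
    ℓ*-out {d} out*≡ with edge-type d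
    ... | forward i o≡ _ p _ with refl ← just-unique p out*≡ = trans (ℓ-before o≡) (sym (prev-prev i))
    ... | backward i o≡ o≡′ p _ with refl ← just-unique p out*≡ =
      trans (sym (ℓ-none o≡)) (trans (ℓ-in o≡ o≡′) (sym (prev-next i)))
    ... | up i o≡ _ p _ with refl ← just-unique p out*≡ = trans (ℓ-before o≡) (sym (prev-prev i))
    ... | down i _ _ p _ = contradiction out*≡ (nothing≢just p)
    ℓ*-before : ∀ {d c} → out* d ≡ just c → ℓ (α d) ≡ next3 c
    ℓ*-before {d} out*≡ with edge-type d
    ... | forward i o≡ o≡′ p _ with refl ← just-unique p out*≡ = trans (ℓ-in o≡′ (out-αα o≡)) (sym (next-prev i))
    ... | backward i o≡ o≡′ p _ with refl ← just-unique p out*≡ = trans (ℓ-out o≡′) (sym (next-next i))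
    ... | up i _ o≡′ p _ with refl ← just-unique p out*≡ = trans (ℓ-out o≡′) (trans (prev-next i) (sym (next-prev i)))
    ... | down i _ _ p _ = contradiction out*≡ (nothing≢just p)
    ℓ*-none : ∀ {d} → out* d ≡ nothing → ℓ (σ⁻ d) ≡ ℓ (α d)
    ℓ*-none {d} out*≡ with edge-type d
    ... | forward i _ _ p _ = contradiction p (nothing≢just out*≡)
    ... | backward i _ _ p _ = contradiction p (nothing≢just out*≡)
    ... | up i _ _ p _ = contradiction p (nothing≢just out*≡)
    ... | down i o≡ o≡′ _ _ = trans (ℓ-before o≡) (trans (next-next i) (sym (ℓ-out o≡′)))
    ℓ*-in : ∀ {d c} → out* d ≡ nothing → out* (α d) ≡ just c → ℓ (σ⁻ d) ≡ c
    ℓ*-in {d} out*≡ out*≡′ with edge-type d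
    ... | forward i _ _ p _ = contradiction p (nothing≢just out*≡)
    ... | backward i _ _ p _ = contradiction p (nothing≢just out*≡)
    ... | up i _ _ p _ = contradiction p (nothing≢just out*≡)
    ... | down i o≡ _ _ p with refl ← just-unique p (trans (sym (out*-α d)) out*≡′) = trans (ℓ-before o≡) (next-next i)
    oriented* : ∀ {d} → out* d ≡ nothing → dual-colour (out (α d)) (out d) ≢ nothing
    oriented* {d} out*≡ out*≡′ with edge-type d
    ... | forward i _ _ p _ = contradiction p (nothing≢just out*≡)
    ... | backward i _ _ p _ = contradiction p (nothing≢just out*≡)
    ... | up i _ _ p _ = contradiction p (nothing≢just out*≡)
    ... | down i _ _ _ p = contradiction p (nothing≢just out*≡′)
    bidistinct* : ∀ {d c} → out* d ≡ just c → dual-colour (out (α d)) (out d) ≢ just c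
    bidistinct* {d} out*≡ out*≡′ with edge-type d
    ... | forward i _ _ p p′ = next≢prev i (trans (just-unique p′ out*≡′) (just-unique out*≡ p))
    ... | backward i _ _ p p′ = next≢prev i (trans (just-unique p out*≡) (just-unique out*≡′ p′))
    ... | up i _ _ _ p′ = contradiction out*≡′ (nothing≢just p′)
    ... | down i _ _ p _ = contradiction out*≡ (nothing≢just p)

  -- Of an edge and its dual, one is bidirected and the other oriented once.
  edge-total : ∀ d → (coloured (out d) + coloured (out (α d))) + (coloured (out* d) + coloured (out* (α d))) ≡ + 3
  edge-total d = trans
    (cong (λ o → (coloured (out d) + coloured (out (α d))) + (coloured (out* d) + coloured o)) (out*-α d))
    (total (edge-type d))
    where
    one : ∀ {o i} → o ≡ just i → coloured o ≡ 1ℤ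
    one {i = i} refl = coloured-just i
    none : ∀ {o} → o ≡ nothing → coloured o ≡ 0ℤ
    none refl = refl
    total : EdgeView (out d) (out (α d)) →
            (coloured (out d) + coloured (out (α d))) + (coloured (out* d) + coloured (dual-colour (out (α d)) (out d))) ≡ + 3
    total (forward i o o′ p p′)  = cong₂ _+_ (cong₂ _+_ (one o) (none o′)) (cong₂ _+_ (one p) (one p′))
    total (backward i o o′ p p′) = cong₂ _+_ (cong₂ _+_ (none o) (one o′)) (cong₂ _+_ (one p) (one p′))
    total (up i o o′ p p′)       = cong₂ _+_ (cong₂ _+_ (one o) (one o′)) (cong₂ _+_ (one p) (none p′))
    total (down i o o′ p p′)     = cong₂ _+_ (cong₂ _+_ (one o) (one o′)) (cong₂ _+_ (none p) (one p′))

  -- Each of the `nV + nF` edges has three coloured darts, primal and dual together, and the primal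
  -- ones number `3 * nV`. Summing `edge-total` over darts counts edges twice, whence the factor 2.
  ∑-coloured-out* : ∑ (λ d → coloured (out d)) ≡ + 3 * + nV → ∑ (λ d → coloured (out* d)) ≡ + 3 * + nF
  ∑-coloured-out* ∑out = ℤₚ.*-cancelˡ-≡ (+ 2) _ _ (begin
    + 2 * P*                                             ≡⟨ lem₁ (+ 3 * + nV) P* ⟩
    ((+ 3 * + nV + + 3 * + nV) + (P* + P*)) - (+ 3 * + nV + + 3 * + nV)
      ≡⟨ cong (λ t → ((t + t) + (P* + P*)) - (+ 3 * + nV + + 3 * + nV)) (sym ∑out) ⟩
    ((P + P) + (P* + P*)) - (+ 3 * + nV + + 3 * + nV)    ≡⟨ cong (_- (+ 3 * + nV + + 3 * + nV)) total ⟩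
    + 3 * (+ 2 * (+ nV + + nF)) - (+ 3 * + nV + + 3 * + nV)   ≡⟨ lem₂ (+ nV) (+ nF) ⟩
    + 2 * (+ 3 * + nF)                                   ∎)
    where
    open ≡-Reasoning
    P P* : ℤ
    P = ∑ (λ d → coloured (out d))
    P* = ∑ (λ d → coloured (out* d))
    lem₁ : ∀ a b → + 2 * b ≡ ((a + a) + (b + b)) - (a + a)
    lem₁ = solve-∀
    lem₂ : ∀ a b → + 3 * (+ 2 * (a + b)) - (+ 3 * a + + 3 * a) ≡ + 2 * (+ 3 * b)
    lem₂ = solve-∀
    twice : ∀ (o : Fin D → Maybe Colour) → ∑ (λ d → coloured (o d) + coloured (o (α d))) ≡ ∑ (λ d → coloured (o d)) + ∑
        (λ d → coloured (o d))
    twice o = trans (∑-add _ _) (cong (_+_ (∑ (λ d → coloured (o d)))) (∑-α (λ d → coloured (o d))))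
    total : (P + P) + (P* + P*) ≡ + 3 * (+ 2 * (+ nV + + nF))
    total = begin
      (P + P) + (P* + P*)      ≡⟨ cong₂ _+_ (sym (twice out)) (sym (twice out*)) ⟩
      ∑ (λ d → coloured (out d) + coloured (out (α d))) + ∑ (λ d → coloured (out* d) + coloured (out* (α d)))
        ≡⟨ sym (∑-add _ _) ⟩
      ∑ (λ d → (coloured (out d) + coloured (out (α d))) + (coloured (out* d) + coloured (out* (α d))))
        ≡⟨ ∑-cong edge-total ⟩
      ∑ {D} (λ _ → + 3)        ≡⟨ trans (∑-const D (+ 3)) (ℤₚ.*-comm (+ D) (+ 3)) ⟩
      + 3 * + D                ≡⟨ cong (+ 3 *_) (trans (cong +_ (sym euler)) (ℤₚ.pos-* 2 (nV ℕ.+ nF))) ⟩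
      + 3 * (+ 2 * (+ nV + + nF)) ∎

  module _ (O : OutDarts S out) (meet : OutDarts.CyclesMeet O) where
    open OutDarts O
    open SectorInduction A O

    -- The boundary of a face with no outgoing dual edge would be a cycle bidirected in two colours i and i + 1;
    -- no edge of the third colour can enter its vertices, so it would violate the intersection axiom.
    face-nonempty : ∀ f → ¬ (∀ d → face d ≡ f → out* d ≡ nothing)
    face-nonempty f none = main (edge-type d₀)
      where
      d₀ = repF f
      in-face : ∀ n → face (iter φ n d₀) ≡ f
      in-face n = trans (face-iter-φ n d₀) (proj₂ (face-onto f))

      main : EdgeView (out d₀) (out (α d₀)) → ⊥
      main (forward _ _ _ p _) = contradiction p (nothing≢just (none d₀ (in-face 0)))
      main (backward _ _ _ p _) = contradiction p (nothing≢just (none d₀ (in-face 0)))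
      main (up _ _ _ p _) = contradiction p (nothing≢just (none d₀ (in-face 0)))
      main (down i o₀ o₀′ _ _) = blocked (meet (next3 i) (prev3 i) (vert d₀) (λ eq → next≢prev i (sym eq)) cycle)
        where
        Boundary : Fin D → Set
        Boundary d = out d ≡ just (next3 i) × out (α d) ≡ just i
        boundary-step : ∀ d → face (φ d) ≡ f → Boundary d → Boundary (φ d)
        boundary-step d face≡ (o≡ , o≡′) with edge-type (φ d)
        ... | forward _ _ _ p _ = contradiction p (nothing≢just (none _ face≡))
        ... | backward _ _ _ p _ = contradiction p (nothing≢just (none _ face≡))
        ... | up _ _ _ p _ = contradiction p (nothing≢just (none _ face≡))
        ... | down j p p′ _ _ with refl ← prev-injective {j} {i} (trans (sym (next-next j))
          (trans (sym (ℓ-before p)) (trans (cong ℓ (σ⁻σ (α d))) (ℓ-out o≡′)))) = p , p′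
        boundary-iter : ∀ n → Boundary (iter φ n d₀)
        boundary-iter zero = o₀ , o₀′
        boundary-iter (suc n) = boundary-step _ (in-face (suc n)) (boundary-iter n)
        successor-iter : ∀ n → iter (successor (next3 i)) n (vert d₀) ≡ vert (iter φ n d₀)
        successor-iter zero = refl
        successor-iter (suc n) = trans (cong (successor (next3 i)) (successor-iter n))
          (trans (cong (vert ∘ α) (sym (e-unique (proj₁ (boundary-iter n))))) (sym (vert-φ _)))
        period : ∃ λ k → iter φ (suc k) d₀ ≡ d₀
        period = let k , eq = face-orbit (φ d₀) d₀ (face-φ d₀) in k , trans (sym (iter-comm φ k d₀)) eq
        cycle : OnCycle (next3 i) (vert d₀)
        cycle = proj₁ period , trans (successor-iter (suc (proj₁ period))) (cong vert (proj₂ period))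
        before : ∀ d → face d ≡ f → ∃ λ n → iter φ n d₀ ≡ φ⁻ d
        before d face≡ = face-orbit d₀ (φ⁻ d) (trans (in-face 0) (sym (trans (face-φ⁻ d) face≡)))
        -- Here `σ⁻ d₁` and `d₁` are outgoing in colours `i` and `next3 i`, so the sector labelled
        -- `prev3 i` is the single corner between them and leaves no room for an entering dart. An
        -- outgoing `b` is excluded by the colours of the reversed darts.
        entering : ∀ d₁ b → face d₁ ≡ f → Boundary d₁ → Boundary (φ⁻ d₁) → vert b ≡ vert d₁ → out (α b) ≡ just (prev3 i) → ⊥
        entering d₁ b face≡ (o≡ , o≡′) (q , q′) vert≡ in≡ with out b in out≡
        ... | just x with colour-cases i x
        ... | inj₁ refl = next≢prev i (just-unique q (trans (cong out (trans (cong α (sym b≡)) refl)) in≡))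
          where
          b≡ : b ≡ σ⁻ d₁
          b≡ = trans (e-unique′ out≡ vert≡) (sym (e-unique′ (trans (cong out (sym (α-invol (σ⁻ d₁)))) q′) (vert-σ⁻ d₁)))
        ... | inj₂ (inj₁ refl) = prev≢ i (just-unique (trans
            (cong (out ∘ α) (sym (trans (e-unique′ out≡ vert≡) (sym (e-unique o≡))))) in≡) o≡′)
        ... | inj₂ (inj₂ refl) = bidistinct out≡ in≡
        entering d₁ b face≡ (o≡ , o≡′) (q , q′) vert≡ in≡ | nothing
          with k , eq , labels ← sector (prev3 i) (vert d₁) b vert≡ (ℓ-in out≡ in≡) = contra k eq labels
          where
          σ⁻d₁≡ : e (next3 (prev3 i)) (vert d₁) ≡ σ⁻ d₁
          σ⁻d₁≡ = sym (e-unique′ (trans (trans (cong out (sym (α-invol (σ⁻ d₁)))) q′) (cong just (sym (next-prev i))))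
              (vert-σ⁻ d₁))
          contra : ∀ k → iter σ k (e (next3 (prev3 i)) (vert d₁)) ≡ b →
                   (∀ j → j ℕ.≤ k → ℓ (iter σ j (e (next3 (prev3 i)) (vert d₁))) ≡ prev3 i) → ⊥
          contra zero eq _ = nothing≢just out≡ (trans (cong out (sym eq)) (out-e _ _))
          contra (suc k) _ labels = prev≢ i (trans (sym (labels 1 (s≤s z≤n)))
            (trans (cong ℓ (trans (cong σ σ⁻d₁≡) (σσ⁻ d₁))) (trans (ℓ-out o≡) (prev-next i))))
        blocked : (∃ λ n → OnCycle (prev3 i) (iter (successor (next3 i)) n (vert d₀))) → ⊥
        blocked (n , L , eq) = let n′ , φ⁻≡ = before d₁ (in-face n) in
          entering d₁ (α (e (prev3 i) u)) (in-face n) (boundary-iter n) (subst Boundary φ⁻≡ (boundary-iter n′))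
            (trans eq (successor-iter n)) (trans (cong out (α-invol _)) (out-e _ u))
          where
          d₁ = iter φ n d₀
          u = iter (successor (prev3 i)) L (iter (successor (next3 i)) n (vert d₀))

    abstract
      dual-outDarts : OutDarts (dual-surface S) out*
      dual-outDarts = CountOutDarts.outDarts-from-count dual-labelling (∑-coloured-out* (∑-coloured-out O)) face-nonempty

-- Monochromatic cycles of the dual

maximum : ∀ {n} (p : Fin n → ℤ) → Fin n → ∃ λ v → ∀ u → p u ≤ p v
maximum {suc zero} p _ = zero , λ { zero → ℤₚ.≤-refl }
maximum {suc (suc n)} p _ with maximum (p ∘ suc) zero
... | v , max with ℤₚ.≤-total (p zero) (p (suc v))
... | inj₁ p₀≤ = suc v , λ { zero → p₀≤ ; (suc u) → max u }
... | inj₂ ≤p₀ = zero , λ { zero → ℤₚ.≤-refl ; (suc u) → ℤₚ.≤-trans (max u) ≤p₀ }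

*-nonneg : ∀ {i j} → 0ℤ ≤ i → 0ℤ ≤ j → 0ℤ ≤ i * j
*-nonneg {+ m} {+ n} _ _ = subst (0ℤ ≤_) (ℤₚ.pos-* m n) (ℤ.+≤+ z≤n)

eventually-periodic : ∀ {n} (s : Fin n → Fin n) x → ∃₂ λ t L → iter s (suc L) (iter s t x) ≡ iter s t x
eventually-periodic {n} s x with i , j , i<j , eq ← pigeonhole (ℕₚ.n<1+n n) (λ k → iter s (toℕ k) x) =
  toℕ i , toℕ j ℕ.∸ suc (toℕ i) , (begin
    iter s (suc (toℕ j ℕ.∸ suc (toℕ i))) (iter s (toℕ i) x)
      ≡⟨ sym (iter-+ s (suc (toℕ j ℕ.∸ suc (toℕ i))) (toℕ i) x) ⟩
    iter s (suc (toℕ j ℕ.∸ suc (toℕ i) ℕ.+ toℕ i)) x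
      ≡⟨ cong (λ k → iter s k x) (trans (sym (ℕₚ.+-suc _ (toℕ i))) (ℕₚ.m∸n+n≡m i<j)) ⟩
    iter s (toℕ j) x                                         ≡⟨ sym eq ⟩
    iter s (toℕ i) x                                         ∎)
  where open ≡-Reasoning

module _ {M : Map} {S : Surface M} where
  open Map M
  open Surface S

  -- If the potential p takes the value P on W and other values on W′, and jumps only where the
  -- two-chain q takes the value c₀, then cutting q − c₀ down to the region p = P leaves W alone as its boundary.
  cut-off : (W W′ : ClosedWalk S) (m n : ℤ) (q : Fin nF → ℤ) (c₀ : ℤ) (p : Fin nV → ℤ) (P : ℤ) →
    (∀ d → m * chain W d + n * chain W′ d ≡ boundary {S = S} q d) →
    (∀ d → p (vert d) ≢ p (vert (α d)) → q (face d) ≡ c₀) →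
    (∀ j → p (vert (ClosedWalk.dart W j)) ≡ P) → (∀ j → p (vert (ClosedWalk.dart W′ j)) ≢ P) →
    ∃ λ r → ∀ d → m * chain W d ≡ boundary {S = S} r d
  cut-off W W′ m n q c₀ p P bounds jump on off = r , λ d → sym (begin
    r (face d) - r (face (α d))
      ≡⟨ cong₂ _-_ (r-face d) (trans (cong r (sym (face-σ d)))
          (trans (r-face (σ d)) (cong₂ (λ v f → 𝟙 (p v ℤₚ.≟ P) * (q f - c₀)) (vert-σ d) (face-σ d)))) ⟩
    χ d * (q (face d) - c₀) - χ d * (q (face (α d)) - c₀)   ≡⟨ lem (χ d) (q (face d)) (q (face (α d))) c₀ ⟩
    χ d * boundary {S = S} q d                              ≡⟨ cong (χ d *_) (sym (bounds d)) ⟩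
    χ d * (m * chain W d + n * chain W′ d)                  ≡⟨ select d ⟩
    m * chain W d                                           ∎)
    where
    open ≡-Reasoning
    χ R : Fin D → ℤ
    χ d = 𝟙 (p (vert d) ℤₚ.≟ P)
    R d = χ d * (q (face d) - c₀)
    lem : ∀ χ a b c → χ * (a - c) - χ * (b - c) ≡ χ * (a - b)
    lem = solve-∀
    -- Along a face, the indicator `χ` changes only where `p` jumps, and there the factor `q - c₀`
    -- is zero.
    R-φ : ∀ d → R (φ d) ≡ R d
    R-φ d with q (face d) ℤₚ.≟ c₀
    ... | yes q≡ = trans (vanish (φ d) (trans (cong q (face-φ d)) q≡)) (sym (vanish d q≡))
      where
      vanish : ∀ d → q (face d) ≡ c₀ → R d ≡ 0ℤ
      vanish d q≡ = trans (cong (χ d *_) (ℤₚ.i≡j⇒i-j≡0 q≡)) (ℤₚ.*-zeroʳ (χ d))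
    ... | no q≢ with p (vert d) ℤₚ.≟ p (vert (α d))
    ... | no p≢ = contradiction (jump d p≢) q≢
    ... | yes p≡ = cong₂ (λ t f → 𝟙 (t ℤₚ.≟ P) * (q f - c₀)) (trans (cong p (vert-φ d)) (sym p≡)) (face-φ d)
    r : Fin nF → ℤ
    r f = R (repF f)
    r-face : ∀ d → r (face d) ≡ R d
    r-face d = φ-invariant R R-φ (proj₂ (face-onto (face d)))
    chain≡0 : ∀ (W : ClosedWalk S) d → (∀ j → p (vert (ClosedWalk.dart W j)) ≢ p (vert d)) → chain W d ≡ 0ℤ
    chain≡0 W d off = chain-off W d (λ j eq → off j (cong (p ∘ vert) eq))
      (λ j eq → off (suc j) (cong p (trans (sym (ClosedWalk.link W j)) (cong vert (trans (cong α eq) (α-invol d))))))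
    drop-right : ∀ m n a {b} → b ≡ 0ℤ → 1ℤ * (m * a + n * b) ≡ m * a
    drop-right m n a refl = drop m n a
      where
      drop : ∀ m n a → 1ℤ * (m * a + n * 0ℤ) ≡ m * a
      drop = solve-∀
    select : ∀ d → χ d * (m * chain W d + n * chain W′ d) ≡ m * chain W d
    select d with p (vert d) ℤₚ.≟ P
    ... | yes p≡ = drop-right m n (chain W d) (chain≡0 W′ d (λ j eq → off j (trans eq p≡)))
    ... | no p≢ = trans (ℤₚ.*-zeroˡ (m * chain W d + n * chain W′ d))
        (sym (trans (cong (m *_) (chain≡0 W d (λ j eq → p≢ (trans (sym eq) (on j))))) (ℤₚ.*-zeroʳ m)))

module DualCycles {M : Map} {S : Surface M} {out : Fin (Map.D M) → Maybe Colour}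
                  (A : AngleLabelling S out) (O : OutDarts S out) (meet : OutDarts.CyclesMeet O) where
  open Map M
  open Surface S
  open OutDarts O
  open DualLabelling A
  private
    O* : OutDarts (dual-surface S) out*
    O* = dual-outDarts O meet
    module A* = AngleLabelling dual-labelling
    module O* = OutDarts O*

  -- Together with `out*-head`: a `c`-edge is crossed from right to left only in dual colour
  -- `prev3 c`, from left to right only in `next3 c`, and never in `c`. So crossings of given
  -- colours all have one sign.
  out*-tail : ∀ {d c j} → out d ≡ just c → out* d ≡ just j → j ≡ prev3 c
  out*-tail {d} {c} out≡ out*≡ with edge-type d
  ... | forward i o≡ _ p _ = trans (just-unique out*≡ p) (cong prev3 (just-unique o≡ out≡))
  ... | backward i o≡ _ _ _ = contradiction out≡ (nothing≢just o≡)
  ... | up i o≡ _ p _ = trans (just-unique out*≡ p) (cong prev3 (just-unique o≡ out≡))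
  ... | down i _ _ p _ = contradiction out*≡ (nothing≢just p)

  out*-head : ∀ {d c j} → out d ≡ just c → out* (α d) ≡ just j → j ≡ next3 c
  out*-head {d} {c} out≡ out*≡ with edge-type d
  ... | forward i o≡ _ _ p = trans (just-unique (trans (sym (out*-α d)) out*≡) p) (cong next3 (just-unique o≡ out≡))
  ... | backward i o≡ _ _ _ = contradiction out≡ (nothing≢just o≡)
  ... | up i _ _ _ p = contradiction (trans (sym (out*-α d)) out*≡) (nothing≢just p)
  ... | down i o≡ _ _ p = trans (just-unique (trans (sym (out*-α d)) out*≡) p)
    (trans (sym (next-next i)) (cong next3 (just-unique o≡ out≡)))

  module _ {j : Colour} {h : Fin nF} (on : O*.OnCycle j h) where
    private
      N : Fin D → ℤ
      N = multiplicity (cycle-walk O* on)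
      x : Fin D → ℤ
      x = chain (cycle-walk O* on)

    crossing-same : ∀ {d} → out d ≡ just j → x d ≡ 0ℤ
    crossing-same {d} out≡ = cong₂ _-_
      (multiplicity-colour O* on d (λ out*≡ → prev≢ j (sym (out*-tail out≡ out*≡))))
      (multiplicity-colour O* on (α d) (λ out*≡ → next≢ j (sym (out*-head out≡ out*≡))))

    crossing-next : ∀ {d} → out d ≡ just (next3 j) → x d ≡ N d
    crossing-next {d} out≡ = trans (cong (_-_ (N d))
      (multiplicity-colour O* on (α d) (λ out*≡ → prev≢ j (sym (trans (out*-head out≡ out*≡) (next-next j))))))
      (ℤₚ.+-identityʳ (N d))

    crossing-prev : ∀ {d} → out d ≡ just (prev3 j) → x d ≡ - N (α d)
    crossing-prev {d} out≡ = trans (cong (_- N (α d))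
      (multiplicity-colour O* on d (λ out*≡ → next≢ j (sym (trans (out*-tail out≡ out*≡) (prev-prev j))))))
      (ℤₚ.+-identityˡ (- N (α d)))

    -- The reverse of a dart of colour `j` does not have colour `j`, so nothing cancels in the
    -- chain.
    chain-own : ∀ n → x (O*.e j (iter (O*.successor j) n h)) ≢ 0ℤ
    chain-own n eq = multiplicity-on O* on n (trans (sym (ℤₚ.+-identityʳ _)) (trans
      (cong (_-_ (N d)) (sym (multiplicity-colour O* on (α d) (A*.bidistinct (O*.out-e j _))))) eq))
      where d = O*.e j (iter (O*.successor j) n h)

  -- E and D are disjoint dual cycles of distinct colours κ and i, joined by a dual path of colour κ.
  -- A relation a E + b D = dp confines primal κ-cycles C₁ and C₂ to the maximum and the minimum of p.
  -- A relation m C₁ + n C₂ = ∂q then has q constant wherever p jumps, as neither the path nor E crosses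
  -- primal κ-cycles; cutting off shows that C₁ or C₂ alone bounds.
  module Disjoint {κ i : Colour} (κ≢i : κ ≢ i) {f : Fin nF} (onD : O*.OnCycle i f) (t : ℕ)
                  (onE : O*.OnCycle κ (iter (O*.successor κ) t f))
                  (disjoint : VertexDisjoint (cycle-walk O* onE) (cycle-walk O* onD)) where
    private
      WE WD : ClosedWalk (dual-surface S)
      WE = cycle-walk O* onE
      WD = cycle-walk O* onD
      NE ND xE xD : Fin D → ℤ
      NE = multiplicity WE
      ND = multiplicity WD
      xE = chain WE
      xD = chain WD

    record Potential : Set where
      field
        a b : ℤ
        p   : Fin nV → ℤ
        dp  : ∀ d → p (vert (α d)) - p (vert d) ≡ a * xE d + b * xD d

    negate : Potential → Potential
    negate Φ = record
      { a = - a ; b = - b ; p = λ v → - p v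
      ; dp = λ d → trans (lem₁ (p (vert (α d))) (p (vert d))) (trans (cong -_ (dp d)) (lem₂ a (xE d) b (xD d)))
      }
      where
      open Potential Φ
      lem₁ : ∀ s t → - s - - t ≡ - (s - t)
      lem₁ = solve-∀
      lem₂ : ∀ a s b t → - (a * s + b * t) ≡ - a * s + - b * t
      lem₂ = solve-∀

    module _ (Φ : Potential) where
      open Potential Φ

      private
        only-D : ∀ {s t} k → s ≡ 0ℤ → t ≡ k → a * s + b * t ≡ b * k
        only-D k refl refl = trans (cong (_+ b * k) (ℤₚ.*-zeroʳ a)) (ℤₚ.+-identityˡ (b * k))
        only-E : ∀ {s t} k → s ≡ k → t ≡ 0ℤ → a * s + b * t ≡ a * k
        only-E k refl refl = trans (cong (_+_ (a * k)) (ℤₚ.*-zeroʳ b)) (ℤₚ.+-identityʳ (a * k))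
        nn : ∀ {W : ClosedWalk (dual-surface S)} d → 0ℤ ≤ multiplicity W d
        nn {W} = multiplicity-nonneg W
        neg-* : ∀ {k l} → k ≤ 0ℤ → 0ℤ ≤ l → 0ℤ ≤ k * - l
        neg-* {k} {l} k≤0 0≤l = subst (0ℤ ≤_) (lem k l) (*-nonneg (ℤₚ.neg-mono-≤ k≤0) 0≤l)
          where
          lem : ∀ k l → - k * l ≡ k * - l
          lem = solve-∀

      -- Edges of colours `i`, `next3 i`, `prev3 i` cross D with sign 0, +, -, and the same holds
      -- for E with `κ` in place of `i`. As `κ` differs from `i`, for all signs of `a` and `b` some
      -- colour makes both contributions nonnegative.
      monotone-colour : ∃ λ c → ∀ {d} → out d ≡ just c → 0ℤ ≤ p (vert (α d)) - p (vert d)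
      monotone-colour with colour-cases i κ
      ... | inj₁ κ≡i = contradiction κ≡i κ≢i
      ... | inj₂ (inj₁ refl) with ℤₚ.≤-total 0ℤ b | ℤₚ.≤-total 0ℤ a
      ... | inj₁ 0≤b | _ = next3 i , λ {d} out≡ → subst (0ℤ ≤_)
        (sym (trans (dp d) (only-D (ND d) (crossing-same onE out≡) (crossing-next onD out≡))))
        (*-nonneg 0≤b (nn {WD} d))
      ... | inj₂ b≤0 | inj₂ a≤0 = i , λ {d} out≡ → subst (0ℤ ≤_)
        (sym (trans (dp d) (only-E (- NE (α d)) (crossing-prev onE (trans out≡ (cong just (sym (prev-next i)))))
            (crossing-same onD out≡))))
        (neg-* a≤0 (nn {WE} (α d)))
      ... | inj₂ b≤0 | inj₁ 0≤a = prev3 i , λ {d} out≡ → subst (0ℤ ≤_)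
        (sym (trans (dp d) (cong₂ (λ s t → a * s + b * t)
          (crossing-next onE (trans out≡ (cong just (sym (next-next i))))) (crossing-prev onD out≡))))
        (ℤₚ.+-mono-≤ (*-nonneg 0≤a (nn {WE} d)) (neg-* b≤0 (nn {WD} (α d))))
      monotone-colour | inj₂ (inj₂ refl) with ℤₚ.≤-total 0ℤ b | ℤₚ.≤-total 0ℤ a
      ... | inj₂ b≤0 | _ = prev3 i , λ {d} out≡ → subst (0ℤ ≤_)
        (sym (trans (dp d) (only-D (- ND (α d)) (crossing-same onE out≡) (crossing-prev onD out≡))))
        (neg-* b≤0 (nn {WD} (α d)))
      ... | inj₁ 0≤b | inj₁ 0≤a = i , λ {d} out≡ → subst (0ℤ ≤_)
        (sym (trans (dp d) (only-E (NE d) (crossing-next onE (trans out≡ (cong just (sym (next-prev i)))))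
            (crossing-same onD out≡))))
        (*-nonneg 0≤a (nn {WE} d))
      ... | inj₁ 0≤b | inj₂ a≤0 = next3 i , λ {d} out≡ → subst (0ℤ ≤_)
        (sym (trans (dp d) (cong₂ (λ s t → a * s + b * t)
          (crossing-prev onE (trans out≡ (cong just (sym (prev-prev i))))) (crossing-next onD out≡))))
        (ℤₚ.+-mono-≤ (neg-* a≤0 (nn {WE} (α d))) (*-nonneg 0≤b (nn {WD} d)))

      -- From a maximal vertex the monotone colour stays at the maximal level and runs into a cycle
      -- there; by `meet` a `κ`-cycle passes through one of its vertices.
      cycle-at-maximum : ∃ λ v → OnCycle κ v × ∀ u → p u ≤ p v
      cycle-at-maximum = proceed monotone-colour
        where
        proceed : (∃ λ c → ∀ {d} → out d ≡ just c → 0ℤ ≤ p (vert (α d)) - p (vert d)) → ∃ λ v → OnCycle κ v × ∀ u → p u ≤ p v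
        proceed (c , mono) = finish (κ ≟ c)
          where
          w : Fin nV
          w = proj₁ (maximum p (vert (repF f)))
          at : ℕ → Fin nV
          at n = iter (successor c) n w
          top : ∀ n u → p u ≤ p (at n)
          top zero u = proj₂ (maximum p (vert (repF f))) u
          top (suc n) u = ℤₚ.≤-trans (top n u) (subst (λ v → p v ≤ p (at (suc n))) (vert-e c (at n))
              (ℤₚ.0≤i-j⇒j≤i (mono (out-e c (at n)))))
          period = eventually-periodic (successor c) w
          s = proj₁ period
          on : OnCycle c (at s)
          on = proj₂ period
          finish : Dec (κ ≡ c) → ∃ λ v → OnCycle κ v × ∀ u → p u ≤ p v
          finish (yes refl) = at s , on , top s
          finish (no κ≢c) with n , on′ ← meet c κ (at s) κ≢c on =
            at (n ℕ.+ s) , subst (OnCycle κ) (sym (iter-+ (successor c) n s w)) on′ , top (n ℕ.+ s)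

      -- A `κ`-edge never crosses E and crosses D in one direction only, so `p` changes along it by
      -- `b` or `- b` times a count.
      record UniformCrossing : Set where
        field
          factor       : ℤ
          b≡0⇒factor≡0 : b ≡ 0ℤ → factor ≡ 0ℤ
          factor≡0⇒b≡0 : factor ≡ 0ℤ → b ≡ 0ℤ
          count        : Fin D → ℤ
          count-nonneg : ∀ d → 0ℤ ≤ count d
          jump         : ∀ {d} → out d ≡ just κ → p (vert (α d)) - p (vert d) ≡ factor * count d

      D-crossing : UniformCrossing
      D-crossing with colour-cases i κ
      ... | inj₁ κ≡i = contradiction κ≡i κ≢i
      ... | inj₂ (inj₁ refl) = record
        { factor = b
        ; b≡0⇒factor≡0 = λ eq → eq
        ; factor≡0⇒b≡0 = λ eq → eq
        ; count = ND
        ; count-nonneg = nn {WD}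
        ; jump = λ {d} out≡ → trans (dp d) (only-D (ND d) (crossing-same onE out≡) (crossing-next onD out≡))
        }
      ... | inj₂ (inj₂ refl) = record
        { factor = - b
        ; b≡0⇒factor≡0 = λ eq → cong ℤ.-_ eq
        ; factor≡0⇒b≡0 = λ eq → ℤₚ.neg-injective eq
        ; count = ND ∘ α
        ; count-nonneg = λ d → nn {WD} (α d)
        ; jump = λ {d} out≡ → trans (dp d) (trans (only-D (- ND (α d)) (crossing-same onE out≡) (crossing-prev onD out≡))
            (trans (sym (ℤₚ.neg-distribʳ-* b (ND (α d)))) (ℤₚ.neg-distribˡ-* b (ND (α d)))))
        }

      constant-step : ∀ {u} → OnCycle κ u → p (successor κ u) ≡ p u
      constant-step {u} on = decide (b ℤₚ.≟ 0ℤ)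
        where
        open UniformCrossing D-crossing
        jump-e : ∀ u → p (successor κ u) - p u ≡ factor * count (e κ u)
        jump-e u = trans (cong (λ v → p (successor κ u) - p v) (sym (vert-e κ u))) (jump (out-e κ u))
        decide : Dec (b ≡ 0ℤ) → p (successor κ u) ≡ p u
        decide (yes b≡0) = ℤₚ.i-j≡0⇒i≡j _ _
          (trans (jump-e u) (trans (cong (_* count (e κ u)) (b≡0⇒factor≡0 b≡0)) (ℤₚ.*-zeroˡ (count (e κ u)))))
        decide (no b≢0) = cycle-monotone O p factor (b≢0 ∘ factor≡0⇒b≡0) (λ u → p (successor κ u) ≡ p u)
          (λ u → count (e κ u) , count-nonneg (e κ u) , jump-e u ,
             λ count≡0 → ℤₚ.i-j≡0⇒i≡j _ _ (trans (jump-e u) (trans (cong (factor *_) count≡0) (ℤₚ.*-zeroʳ factor)))) on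

      constant : ∀ {v} → OnCycle κ v → ∀ n → p (iter (successor κ) n v) ≡ p v
      constant on zero = refl
      constant on (suc n) = trans (constant-step (OnCycle-iter n on)) (constant on n)

      -- `p` is constant along the cycle and E is not crossed, so only `b * xD d` remains. For `b`
      -- zero nothing follows, but then D causes no jump of `p`.
      D-uncrossed : ∀ {v} (on : OnCycle κ v) → b ≢ 0ℤ → ∀ {d} n → e κ (iter (successor κ) n v) ≡ d → xD d ≡ 0ℤ
      D-uncrossed on b≢0 n refl = k*i≡0 b≢0 (trans
        (sym (only-D _ (crossing-same onE (out-e κ _)) refl))
        (trans (sym (dp _)) (ℤₚ.i≡j⇒i-j≡0 (trans (constant-step (OnCycle-iter n on)) (cong p (sym (vert-e κ _)))))))

    dependence : ∃₂ λ a b → ∃ λ p → (a ≢ 0ℤ ⊎ b ≢ 0ℤ) × (∀ d → a * xE d + b * xD d ≡ boundary {S = dual-surface S} p d)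
    dependence = disjoint⇒dependent WE WD disjoint

    Φ : Potential
    Φ = let a , b , p , _ , eq = dependence in record
      { a = a ; b = b ; p = p
      ; dp = λ d → sym (trans (eq d) (cong (λ e → p (vert (α d)) - p (vert e)) (α-invol d)))
      }

    open Potential Φ

    nontrivial : a ≢ 0ℤ ⊎ b ≢ 0ℤ
    nontrivial = proj₁ (proj₂ (proj₂ (proj₂ dependence)))

    private
      abstract
        top : ∃ λ v → OnCycle κ v × ∀ u → p u ≤ p v
        top = cycle-at-maximum Φ
        bottom : ∃ λ v → OnCycle κ v × ∀ u → - p u ≤ - p v
        bottom = cycle-at-maximum (negate Φ)
      v₁ v₂ : Fin nV
      v₁ = proj₁ top
      v₂ = proj₁ bottom
      on₁ : OnCycle κ v₁
      on₁ = proj₁ (proj₂ top)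
      on₂ : OnCycle κ v₂
      on₂ = proj₁ (proj₂ bottom)
      W₁ W₂ : ClosedWalk S
      W₁ = cycle-walk O on₁
      W₂ = cycle-walk O on₂

    chains-disjoint : ∀ (W W′ : ClosedWalk (dual-surface S)) → VertexDisjoint W W′ → ∀ n → chain W′ (ClosedWalk.dart W n) ≡ 0ℤ
    chains-disjoint W W′ disj n = chain-off W′ _
      (λ j eq → disj n j (cong face (sym eq)))
      (λ j eq → disj (suc n) j (trans (sym (ClosedWalk.link W n)) (cong face (sym eq))))

    -- On a dart of E the chain of D vanishes and that of E does not, so a constant `p` forces `a`
    -- to be zero; likewise `b` on a dart of D.
    p-nonconstant : ¬ (∀ u v → p u ≡ p v)
    p-nonconstant const = [ (λ a≢0 → a≢0 a≡0) , (λ b≢0 → b≢0 b≡0) ]′ nontrivial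
      where
      flat : ∀ d → a * xE d + b * xD d ≡ 0ℤ
      flat d = trans (sym (dp d)) (ℤₚ.i≡j⇒i-j≡0 (const _ _))
      solve-left : ∀ {k l s t} → s ≢ 0ℤ → t ≡ 0ℤ → k * s + l * t ≡ 0ℤ → k ≡ 0ℤ
      solve-left {k} {l} {s} s≢0 refl eq = [ (λ k≡0 → k≡0) , (λ s≡0 → contradiction s≡0 s≢0) ]′
        (ℤₚ.i*j≡0⇒i≡0∨j≡0 k (trans (sym (trans (cong (_+_ (k * s)) (ℤₚ.*-zeroʳ l)) (ℤₚ.+-identityʳ (k * s)))) eq))
      a≡0 : a ≡ 0ℤ
      a≡0 = solve-left {a} {b} (chain-own onE 0) (chains-disjoint WE WD disjoint 0) (flat _)
      b≡0 : b ≡ 0ℤ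
      b≡0 = solve-left {b} {a} (chain-own onD 0) (chains-disjoint WD WE (λ i j eq → disjoint j i (sym eq)) 0)
          (trans (ℤₚ.+-comm (b * xD _) (a * xE _)) (flat _))

    p₁≢p₂ : p v₁ ≢ p v₂
    p₁≢p₂ eq = p-nonconstant (λ u v → trans (const u) (sym (const v)))
      where
      const : ∀ u → p u ≡ p v₁
      const u = ℤₚ.≤-antisym (proj₂ (proj₂ top) u)
        (ℤₚ.≤-trans (ℤₚ.≤-reflexive eq) (ℤₚ.neg-cancel-≤ (proj₂ (proj₂ bottom) u)))

    at-level : ∀ {v} (on : OnCycle κ v) j → p (vert (ClosedWalk.dart (cycle-walk O on) j)) ≡ p v
    at-level on j = trans (cong p (cycle-walk-vert O on j)) (constant Φ on j)

    primal-disjoint : VertexDisjoint W₁ W₂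
    primal-disjoint j k eq = p₁≢p₂ (trans (sym (at-level on₁ j)) (trans (cong p eq) (at-level on₂ k)))

    module _ (m n : ℤ) (q : Fin nF → ℤ) (bounds : ∀ d → m * chain W₁ d + n * chain W₂ d ≡ boundary {S = S} q d) where

      private
        -- The face `f` lies on D and starts the dual `κ`-path into E, so its value can be
        -- transported to both.
        c₀ : ℤ
        c₀ = q f

      q-step : ∀ {d} → chain W₁ d ≡ 0ℤ → chain W₂ d ≡ 0ℤ → q (face (α d)) ≡ q (face d)
      q-step {d} eq₁ eq₂ = sym (ℤₚ.i-j≡0⇒i≡j _ _ (trans (sym (bounds d))
        (trans (cong₂ (λ s t → m * s + n * t) eq₁ eq₂) (cong₂ _+_ (ℤₚ.*-zeroʳ m) (ℤₚ.*-zeroʳ n)))))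

      κ-uncrossed : ∀ {v} (on : OnCycle κ v) {d} → out* d ≡ just κ → chain (cycle-walk O on) d ≡ 0ℤ
      κ-uncrossed on {d} out*≡ = cong₂ _-_
        (multiplicity-colour O on d (λ out≡ → prev≢ κ (sym (out*-tail out≡ out*≡))))
        (multiplicity-colour O on (α d) (λ out≡ → next≢ κ (sym (out*-head out≡ (trans (cong out* (α-invol d)) out*≡)))))

      q-κ : ∀ h → q (O*.successor κ h) ≡ q h
      q-κ h = trans (q-step (κ-uncrossed on₁ (O*.out-e κ h)) (κ-uncrossed on₂ (O*.out-e κ h))) (cong q (O*.vert-e κ h))

      q-κ-iter : ∀ n h → q (iter (O*.successor κ) n h) ≡ q h
      q-κ-iter zero h = refl
      q-κ-iter (suc n) h = trans (q-κ _) (q-κ-iter n h)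

      q-E : ∀ n → q (face (ClosedWalk.dart WE n)) ≡ c₀
      q-E n = trans (cong q (O*.vert-e κ _)) (trans (q-κ-iter n _) (q-κ-iter t f))

      D-uncrossing : b ≢ 0ℤ → ∀ {v} (on : OnCycle κ v) n → chain (cycle-walk O on) (ClosedWalk.dart WD n) ≡ 0ℤ
      D-uncrossing b≢0 on n = chain-off (cycle-walk O on) _
        (λ j eq → chain-own onD n (D-uncrossed Φ on b≢0 j eq))
        (λ j eq → chain-own onD n (trans (sym (ℤₚ.neg-involutive (xD d)))
          (cong -_ (trans (sym (chain-α WD d)) (D-uncrossed Φ on b≢0 j eq)))))
        where d = ClosedWalk.dart WD n

      q-D : b ≢ 0ℤ → ∀ n → q (face (ClosedWalk.dart WD n)) ≡ c₀
      q-D b≢0 zero = cong q (O*.vert-e i f)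
      q-D b≢0 (suc n) = trans (cong q (sym (ClosedWalk.link WD n)))
        (trans (q-step (D-uncrossing b≢0 on₁ n) (D-uncrossing b≢0 on₂ n)) (q-D b≢0 n))

      on-walk : ∀ (W : ClosedWalk (dual-surface S)) → (∀ n → q (face (ClosedWalk.dart W n)) ≡ c₀) →
                ∀ d → chain W d ≢ 0ℤ → q (face d) ≡ c₀
      on-walk W q-W d chain≢0 with multiplicity W d ℤₚ.≟ 0ℤ | multiplicity W (α d) ℤₚ.≟ 0ℤ
      ... | yes N≡0 | yes N′≡0 = contradiction (cong₂ _-_ N≡0 N′≡0) chain≢0
      ... | no N≢0 | _ with j , refl ← multiplicity≢0 W d N≢0 = q-W j
      on-walk W q-W d chain≢0 | yes _ | no N′≢0 with j , eq ← multiplicity≢0 W (α d) N′≢0 =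
        trans (cong (q ∘ face) (sym (α-invol d))) (trans (cong (q ∘ face ∘ α) (sym eq))
            (trans (cong q (ClosedWalk.link W j)) (q-W (suc j))))

      q-at-jump : ∀ d → p (vert d) ≢ p (vert (α d)) → q (face d) ≡ c₀
      -- Testing `b * xD d` instead of `xD d` supplies the `b ≢ 0ℤ` that `q-D` requires.
      q-at-jump d p≢ with xE d ℤₚ.≟ 0ℤ | b * xD d ℤₚ.≟ 0ℤ
      ... | yes xE≡0 | yes bxD≡0 = contradiction
        (sym (ℤₚ.i-j≡0⇒i≡j _ _ (trans (dp d) (cong₂ _+_ (trans (cong (a *_) xE≡0) (ℤₚ.*-zeroʳ a)) bxD≡0)))) p≢
      ... | no xE≢0 | _ = on-walk WE q-E d xE≢0
      ... | yes _ | no bxD≢0 = on-walk WD (q-D (λ b≡0 → bxD≢0 (trans (cong (_* xD d) b≡0) (ℤₚ.*-zeroˡ (xD d))))) d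
        (λ xD≡0 → bxD≢0 (trans (cong (b *_) xD≡0) (ℤₚ.*-zeroʳ b)))

      contradictory : m ≢ 0ℤ ⊎ n ≢ 0ℤ → ⊥
      contradictory (inj₁ m≢0) =
        let r , eq = cut-off W₁ W₂ m n q c₀ p (p v₁) bounds q-at-jump (at-level on₁)
                (λ j eq → p₁≢p₂ (trans (sym eq) (at-level on₂ j)))
        in NonContractible.impossible A O on₁ m≢0 r eq meet
      contradictory (inj₂ n≢0) =
        let r , eq = cut-off W₂ W₁ n m q c₀ p (p v₂) (λ d → trans (ℤₚ.+-comm (n * chain W₂ d) (m * chain W₁ d)) (bounds d))
                       q-at-jump (at-level on₂) (λ j eq → p₁≢p₂ (trans (sym (at-level on₁ j)) eq))
        in NonContractible.impossible A O on₂ n≢0 r eq meet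

    impossible : ⊥
    impossible = let m , n , q , nz , bounds = disjoint⇒dependent W₁ W₂ primal-disjoint in contradictory m n q bounds nz

  -- Following colour `κ` from `f` ends in a cycle E by finiteness. Whether E meets the given cycle
  -- is decidable, and disjointness is refuted above.
  dual-cyclesMeet : O*.CyclesMeet
  dual-cyclesMeet i κ f κ≢i onD = decide (any? (λ m → any? (λ n → iter (O*.successor i) (toℕ m) f ≟ iter
      (O*.successor κ) (toℕ n) g)))
    where
    period = eventually-periodic (O*.successor κ) f
    t = proj₁ period
    g = iter (O*.successor κ) t f
    onE : O*.OnCycle κ g
    onE = proj₂ period
    Meeting : Set
    Meeting = ∃ λ (m : Fin (suc (proj₁ onD))) → ∃ λ (n : Fin (suc (proj₁ onE))) →
              iter (O*.successor i) (toℕ m) f ≡ iter (O*.successor κ) (toℕ n) g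
    decide : Dec Meeting → ∃ λ n → O*.OnCycle κ (iter (O*.successor i) n f)
    decide (yes (m , n , eq)) = toℕ m , subst (O*.OnCycle κ) (sym eq) (O*.OnCycle-iter (toℕ n) onE)
    decide (no none) = ⊥-elim (Disjoint.impossible κ≢i onD t onE disjoint)
      where
      disjoint : VertexDisjoint (cycle-walk O* onE) (cycle-walk O* onD)
      disjoint j k eq = none (proj₁ kD , proj₁ jE ,
        trans (sym (proj₂ kD)) (trans (sym (cycle-walk-vert O* onD k))
            (trans (sym eq) (trans (cycle-walk-vert O* onE j) (proj₂ jE)))))
        where
        jE = cycle-index O* onE j
        kD = cycle-index O* onD k

-- The bijection

module _ {M : Map} {S : Surface M} {o o′ : Fin (Map.D M) → Maybe Colour} (eq : ∀ d → o d ≡ o′ d) where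

  AngleLabelling-resp : AngleLabelling S o → AngleLabelling S o′
  AngleLabelling-resp A = record
    { ℓ = ℓ
    ; ℓ-out = λ out≡ → ℓ-out (trans (eq _) out≡)
    ; ℓ-before = λ out≡ → ℓ-before (trans (eq _) out≡)
    ; ℓ-none = λ out≡ → ℓ-none (trans (eq _) out≡)
    ; ℓ-in = λ out≡ in≡ → ℓ-in (trans (eq _) out≡) (trans (eq _) in≡)
    ; oriented = λ out≡ in≡ → oriented (trans (eq _) out≡) (trans (eq _) in≡)
    ; bidistinct = λ out≡ in≡ → bidistinct (trans (eq _) out≡) (trans (eq _) in≡)
    }
    where open AngleLabelling A

  OutDarts-resp : OutDarts S o → OutDarts S o′
  OutDarts-resp O = record
    { e = e
    ; vert-e = vert-e
    ; out-e = λ c v → trans (sym (eq _)) (out-e c v)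
    ; e-unique = λ out≡ → e-unique (trans (eq _) out≡)
    }
    where open OutDarts O

module _ {M : Map} {S : Surface M} {o : Fin (Map.D M) → Maybe Colour} where
  open Map M
  open Surface S

  -- The bidual is M with every dart reversed.
  undual-labelling : AngleLabelling (dual-surface (dual-surface S)) o → AngleLabelling S (o ∘ α)
  undual-labelling A = record
    { ℓ = ℓ ∘ α
    ; ℓ-out = ℓ-out
    ; ℓ-before = λ {d} out≡ → trans (cong ℓ (shift d)) (ℓ-before out≡)
    ; ℓ-none = λ {d} out≡ → trans (ℓ-none out≡) (cong ℓ (sym (shift d)))
    ; ℓ-in = ℓ-in
    ; oriented = oriented
    ; bidistinct = bidistinct
    }
    where
    open AngleLabelling A
    shift : ∀ d → α (σ⁻ d) ≡ α (σ⁻ (α (α d)))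
    shift d = cong (α ∘ σ⁻) (sym (α-invol d))

  undual-outDarts : OutDarts (dual-surface (dual-surface S)) o → OutDarts S (o ∘ α)
  undual-outDarts O = record
    { e = λ c v → α (e c v)
    ; vert-e = vert-e
    ; out-e = λ c v → trans (cong o (α-invol (e c v))) (out-e c v)
    ; e-unique = λ {d} {c} out≡ → trans (sym (α-invol d))
        (cong α (trans (e-unique out≡) (cong (λ d → e c (vert d)) (α-invol d))))
    }
    where open OutDarts O

module _ (M : Map) where
  open Map M

  dual-wood : Colouring M → Colouring (dual M)
  dual-wood c = Vec.tabulate λ d → dual-colour (lookup c d) (lookup c (α d))

  -- Left unreduced, `α (α d)` makes the entry at `d` match `out* (α d)` definitionally, the form
  -- delivered by `undual-labelling`.
  primal-wood : Colouring (dual M) → Colouring M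
  primal-wood c = Vec.tabulate λ d → dual-colour (lookup c (α d)) (lookup c (α (α d)))

  private
    involution : ∀ (o : Fin D → Maybe Colour) → (∀ d → EdgeView (o d) (o (α d))) → ∀ d →
      dual-colour (dual-colour (o (α d)) (o (α (α d)))) (dual-colour (o (α (α d))) (o (α (α (α d))))) ≡ o d
    involution o views d rewrite α-invol d = dual-colour-involutive (views d)

    wood-views : ∀ {N : Map} {c : Colouring N} → IsSchnyderWood N c → ∀ d → EdgeView (lookup c d) (lookup c (Map.α N d))
    wood-views W d = edge-view _ _ (IsSchnyderWood.oriented W d) (IsSchnyderWood.bidistinct W d _)

  primal-dual : ∀ c → IsSchnyderWood M c → primal-wood (dual-wood c) ≡ c
  primal-dual c W = trans (tabulate-cong λ d → trans
      (cong₂ dual-colour (lookup∘tabulate _ (α d)) (lookup∘tabulate _ (α (α d))))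
      (involution (lookup c) (wood-views W) d))
    (tabulate∘lookup c)

  dual-primal : ∀ c → IsSchnyderWood (dual M) c → dual-wood (primal-wood c) ≡ c
  dual-primal c W = trans (tabulate-cong λ d → trans
      (cong₂ dual-colour (lookup∘tabulate _ d) (lookup∘tabulate _ (α d)))
      (involution (lookup c) (wood-views W) d))
    (tabulate∘lookup c)

  module _ (S : Surface M) where

    dual-wood-isWood : ∀ c → IsSchnyderWood M c → IsSchnyderWood (dual M) (dual-wood c)
    dual-wood-isWood c W = labelling⇒wood (dual-surface S) (dual-wood c)
      (AngleLabelling-resp eq dual-labelling) (OutDarts-resp eq (dual-outDarts outDarts cyclesMeet))
      (DualCycles.dual-cyclesMeet angleLabelling outDarts cyclesMeet)
      where
      open WoodLabelling S c W
      open DualLabelling angleLabelling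
      eq : ∀ d → out* d ≡ lookup (dual-wood c) d
      eq d = sym (lookup∘tabulate _ d)

    primal-wood-isWood : ∀ c → IsSchnyderWood (dual M) c → IsSchnyderWood M (primal-wood c)
    primal-wood-isWood c W = labelling⇒wood S (primal-wood c)
      (AngleLabelling-resp eq (undual-labelling dual-labelling))
      (OutDarts-resp eq (undual-outDarts (dual-outDarts outDarts cyclesMeet)))
      (DualCycles.dual-cyclesMeet angleLabelling outDarts cyclesMeet)
      where
      open WoodLabelling (dual-surface S) c W
      open DualLabelling angleLabelling
      eq : ∀ d → out* (α d) ≡ lookup (primal-wood c) d
      eq d = sym (lookup∘tabulate _ d)

toroidal-surface : (G : ToroidalMap) → Surface (ToroidalMap.map G)
toroidal-surface G = record
  { nV = nV ; vert = vert ; vert-σ = vert-σ ; vert-orbit = vert-orbit ; vert-onto = vert-onto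
  ; nF = nF ; face = face ; face-φ = face-φ ; face-orbit = face-orbit ; face-onto = face-onto
  ; connected = connected ; euler = euler
  }
  where open ToroidalMap G

theorem7 : (G : ToroidalMap) → SWBijection (ToroidalMap.map G) (dual (ToroidalMap.map G))
theorem7 G = dual-wood M , primal-wood M , dual-wood-isWood M S , primal-wood-isWood M S , primal-dual M , dual-primal M
  where
  M = ToroidalMap.map G
  S = toroidal-surface G
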